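{- For every graph $H$ with $\chi(H)\ge 3$ and every $\delta>0$, there exists a constant $C>0$ such that the following holds: for every $\eta>0$ there is $n_0$ such that for all $n\ge n_0$ and all integers $m$ with $Cn^{2-1/m_2(H)}\le m\le\binom n2$, the number of labelled $H$-free graphs on vertex set $[n]$ with exactly $m$ edges that are not $(\delta,\chi(H)-1)$-partite is at most $\eta$ times the number of all labelled $H$-free graphs on $[n]$ with exactly $m$ edges. (That is, almost all $H$-free graphs with $n$ vertices and $m$ edges are $(\delta,\chi(H)-1)$-partite.)
   Context: $\chi(H)$ is the chromatic number. For a graph $H$ with at least three vertices, $m_2(H)=\max\{(e(H')-1)/(v(H')-2): H'\subseteq H,\ v(H')\ge 3\}$. A graph is $H$-free if it contains no (not necessarily induced) subgraph isomorphic to $H$. A graph $G$ is $(\delta,k)$-partite if $G$ can be made $k$-partite by removing at most $\delta e(G)$ edges. -}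

module Defs where

open import Data.Nat using (ℕ; zero; suc; _+_; _*_; _∸_; _^_; _≤_; _<_; _<ᵇ_)
open import Data.Integer as ℤ using (ℤ; +_)
open import Data.Bool using (Bool; true; false; _∧_; if_then_else_)
open import Data.Fin using (Fin; toℕ)
open import Data.Fin.Subset using (Subset; _∈_; ∣_∣)
open import Data.Vec using (Vec; lookup; tabulate; sum)
open import Data.List using (List; length)
open import Data.List.Relation.Unary.Unique.Propositional using (Unique)
import Data.List.Membership.Propositional as L
open import Data.Product using (Σ; _×_; ∃; ∃-syntax)
open import Function.Bundles using (_⇔_)
open import Function.Definitions using (Injective)
open import Relation.Binary.PropositionalEquality using (_≡_)
open import Relation.Nullary using (¬_)

Mat : ℕ → Set
Mat n = Vec (Vec Bool n) n

adj : ∀ {n} → Mat n → Fin n → Fin n → Bool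
adj G i j = lookup (lookup G i) j

IsGraph : ∀ {n} → Mat n → Set
IsGraph {n} G = (∀ (i : Fin n) → adj G i i ≡ false)
              × (∀ (i j : Fin n) → adj G i j ≡ adj G j i)

e : ∀ {n} → Mat n → ℕ
e {n} G = sum (tabulate λ (i : Fin n) → sum (tabulate λ (j : Fin n) →
            if (toℕ i <ᵇ toℕ j) ∧ adj G i j then 1 else 0))

_⊆E_ : ∀ {n} → Mat n → Mat n → Set
_⊆E_ {n} G' G = ∀ (i j : Fin n) → adj G' i j ≡ true → adj G i j ≡ true

ProperColouring : ∀ {n} → Mat n → (k : ℕ) → (Fin n → Fin k) → Set
ProperColouring {n} G k c = ∀ (i j : Fin n) → adj G i j ≡ true → ¬ (c i ≡ c j)

Colourable : ∀ {n} → Mat n → ℕ → Set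
Colourable {n} G k = ∃[ c ] ProperColouring G k c

IsChromaticNumber : ∀ {n} → Mat n → ℕ → Set
IsChromaticNumber G k = Colourable G k × (∀ j → Colourable G j → k ≤ j)

Contains : ∀ {h n} → Mat n → Mat h → Set
Contains {h} {n} G H =
  ∃[ f ] (Injective _≡_ _≡_ f
         × (∀ (i j : Fin h) → adj H i j ≡ true → adj G (f i) (f j) ≡ true))

Free : ∀ {h n} → Mat h → Mat n → Set
Free H G = ¬ Contains G H

-- (δ,k)-partite with δ = dp / dq: G becomes k-partite after removing at
-- most δ e(G) edges, i.e. there is a spanning subgraph G' ⊆ G which is
-- k-partite and e(G) - e(G') ≤ (dp/dq) e(G).

Partite : ∀ {n} → (dp dq : ℕ) → (k : ℕ) → Mat n → Set
Partite {n} dp dq k G =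
  ∃[ G' ] (IsGraph G' × G' ⊆E G × Colourable G' k
          × (e G ∸ e G') * dq ≤ dp * e G)

-- Subgraphs H' ⊆ H: a vertex subset S and a graph on Fin h whose edges
-- are edges of H with both endpoints in S.  v(H') = |S|, e(H') = e(E).

IsSubgraph : ∀ {h} → Mat h → Subset h → Mat h → Set
IsSubgraph {h} H S E = IsGraph E × E ⊆E H
  × (∀ (i j : Fin h) → adj E i j ≡ true → (i ∈ S × j ∈ S))

-- m₂(H) = p / q  (p, q natural, q > 0), i.e. p/q is the maximum of
-- (e(H')-1)/(v(H')-2) over subgraphs H' with v(H') ≥ 3 (computed in ℤ).
IsM2 : ∀ {h} → Mat h → ℕ → ℕ → Set
IsM2 {h} H p q = 0 < q
  × (∃[ S ] ∃[ E ] (IsSubgraph H S E × 3 ≤ ∣ S ∣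
       × (+ e E ℤ.- + 1) ℤ.* + q ≡ + p ℤ.* (+ ∣ S ∣ ℤ.- + 2)))
  × (∀ S E → IsSubgraph H S E → 3 ≤ ∣ S ∣
       → (+ e E ℤ.- + 1) ℤ.* + q ℤ.≤ + p ℤ.* (+ ∣ S ∣ ℤ.- + 2))

HasCount : {A : Set} → (A → Set) → ℕ → Set
HasCount {A} P k = Σ (List A) λ xs →
  Unique xs × length xs ≡ k × (∀ x → (x L.∈ xs) ⇔ P x)

FreeGraph : ∀ {h} → Mat h → (n m : ℕ) → Mat n → Set
FreeGraph H n m G = IsGraph G × e G ≡ m × Free H G

BadFreeGraph : ∀ {h} → Mat h → (n m dp dq k : ℕ) → Mat n → Set
BadFreeGraph H n m dp dq k G = FreeGraph H n m G × ¬ Partite dp dq k G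

{-# OPTIONS --safe #-}

-- Containers by a decision tree.  The edges of K_n are queried one after the other; the state of the tree
-- consists of the undecided edges and of nested lists of copies of H, the i-th one containing the copies all
-- of whose edges but the first i have been answered yes.  One always queries an edge which is the last
-- remaining edge of many copies in the current list: an answer yes feeds the next list, and as soon as this
-- happened b ~ m/Q times that list is large enough to be used in turn, while the condition
-- m ≥ C n^(2 - 1/m₂) keeps the codegrees small.  When there is no such edge left, a constant proportion of
-- all the edges has been decided.  After boundedly many rounds the undecided edges contain few copies of H;
-- by then at most a small multiple of m answers were yes, which makes the number of leaves harmless.
--
-- At a leaf, a robust form of Füredi's proof of the stability theorem gives an r-colouring, r = χ(H) - 1, with
-- e(U) + mono(U) ≤ (1 - 1/r + o(1)) n²/2 for the undecided graph U.  A graph that is not (δ,r)-partite has many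
-- monochromatic edges, so giving those weight 2 and using 1 + 2z ≤ (1 + z)² bounds the number of bad
-- graphs at the leaf by 2^(-δm) C((1 - 1/r + o(1)) n²/2, m), to be compared with the subgraphs of a
-- balanced complete r-partite graph.  If m is too close to the Turán number for this comparison, then
-- stability applied to the graph itself shows that there are no bad graphs.

module Submission where

open import Defs
open import Data.Nat hiding (_≟_)
open import Data.Nat.Combinatorics using (_C_)
open import Data.Nat.DivMod using (_/_; _%_; m≡m%n+[m/n]*n; m%n<n; m/n*n≤m; m≥n⇒m/n>0)
open import Data.Nat.Properties hiding (_≟_)
open import Data.Nat.Tactic.RingSolver using (solve-∀)
import Data.Integer as ℤ
import Data.Integer.Properties as ℤ
open import Data.Bool using (Bool; true; false; _∧_; _∨_; not; if_then_else_; T?)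
open import Data.Bool.Properties using (T-≡)
open import Data.Fin using (Fin; zero; suc; toℕ)
import Data.Fin as Fin
import Data.Fin.Properties as Fin
import Data.Fin.Subset as Subset
open import Data.List using (List; []; _∷_; _++_; map; length; filterᵇ; allFin; concatMap; cartesianProduct)
import Data.List as List
open import Data.List.Properties using (length-++; length-map; length-tabulate)
open import Data.List.Membership.Propositional using (_∈_)
open import Data.List.Membership.Propositional.Properties using (∈-++⁻; ∈-++⁺ˡ; ∈-++⁺ʳ; ∈-map⁺; ∈-map⁻; ∈-cartesianProduct⁺; ∈-allFin)
open import Data.List.Relation.Unary.Any using (here; there)
open import Data.List.Relation.Unary.All as All using ([]; _∷_)
open import Data.List.Relation.Unary.AllPairs using ([]; _∷_)
open import Data.List.Relation.Unary.Unique.Propositional using (Unique)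
import Data.List.Relation.Unary.Unique.Propositional.Properties as Unique
open import Data.List.Relation.Binary.Sublist.Propositional using (_⊆_; []; _∷_; _∷ʳ_; minimum; ⊆-trans)
open import Data.List.Relation.Binary.Sublist.Propositional.Properties using (filter-⊆)
open import Data.Vec using (Vec; []; _∷_; lookup)
import Data.Vec as Vec
import Data.Vec.Properties as Vec
open import Data.Product using (Σ; _×_; _,_; proj₁; proj₂; ∃-syntax)
import Data.Product.Properties as Product
open import Data.Sum using (_⊎_; inj₁; inj₂)
open import Data.Empty using (⊥; ⊥-elim)
open import Data.Unit using (⊤; tt)
open import Function using (_∘_; id)
open import Function.Bundles using (Equivalence)
open import Relation.Binary.PropositionalEquality hiding (J)
open import Relation.Binary.Definitions using (DecidableEquality)
open import Relation.Nullary using (¬_; Dec; yes; no; does)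

-- The codegree condition is the definition of m₂ in disguise. With δ = b / N, the copies through j
-- + 1 edges that cover v vertices number O(n^(h - v)), and this has to be O(δ^j n^(h - 2)). It
-- amounts to N / b ≤ n^((v - 2) / j), which holds for all subgraphs as soon as N / b ≤ n^(1/m₂).
--
-- The leaves are not counted by themselves. A leaf reached with j yes answers leaves m - j edges to
-- choose, and C(M, m - j) ≤ (Λ m / N)^j C(M, m) provided that M - m is at least N / Λ; this pays
-- for the C(u, j) positions of the answers. The proviso is the origin of the two regimes for m. A
-- yes may also use up a monochromatic edge, which costs a further factor 2.
--
-- Rational exponents are cleared by p-th or τ-th powers. The constants are fixed in the order τ, Λ,
-- D, L, B, a₀, g, Q, c, all from H and δ; η acts on n₀ alone, because one factor 2^(m/τ) of the
-- gain is left over for it.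

private variable
  A A′ : Set

-- Indicators, finite sums and products

𝟙 : Bool → ℕ
𝟙 true  = 1
𝟙 false = 0

𝟙≤1 : ∀ b → 𝟙 b ≤ 1
𝟙≤1 true  = s≤s z≤n
𝟙≤1 false = z≤n

𝟙-∧ : ∀ a b → 𝟙 (a ∧ b) ≡ 𝟙 a * 𝟙 b
𝟙-∧ true  b = sym (+-identityʳ (𝟙 b))
𝟙-∧ false b = refl

𝟙-not : ∀ b → 𝟙 b + 𝟙 (not b) ≡ 1
𝟙-not true  = refl
𝟙-not false = refl

𝟙-mono : ∀ {a b} → (a ≡ true → b ≡ true) → 𝟙 a ≤ 𝟙 b
𝟙-mono {false} f = z≤n
𝟙-mono {true}  f rewrite f refl = ≤-refl

∧-true : ∀ {a b} → a ∧ b ≡ true → a ≡ true × b ≡ true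
∧-true {true} {true} p = refl , refl

∧-intro : ∀ {a b} → a ≡ true → b ≡ true → a ∧ b ≡ true
∧-intro refl refl = refl

true≢false : ∀ {b} → b ≡ true → b ≡ false → ⊥
true≢false refl ()

infixr 4 _⇒ᵇ_
abstract
  _⇒ᵇ_ : Bool → Bool → Bool
  true  ⇒ᵇ b = b
  false ⇒ᵇ b = true

  ⇒ᵇ-elim : ∀ {a b} → (a ⇒ᵇ b) ≡ true → a ≡ true → b ≡ true
  ⇒ᵇ-elim p refl = p

  ⇒ᵇ-intro : ∀ {a b} → (a ≡ true → b ≡ true) → (a ⇒ᵇ b) ≡ true
  ⇒ᵇ-intro {true}  f = f refl
  ⇒ᵇ-intro {false} f = refl

  ⇒ᵇ-cong : ∀ {a b b'} → (a ≡ true → b ≡ b') → (a ⇒ᵇ b) ≡ (a ⇒ᵇ b')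
  ⇒ᵇ-cong {true}  e = e refl
  ⇒ᵇ-cong {false} e = refl

does-true : ∀ {P : Set} (d : Dec P) → P → Dec.does d ≡ true
does-true (yes _) p = refl
does-true (no ¬p) p = ⊥-elim (¬p p)

does-false : ∀ {P : Set} (d : Dec P) → ¬ P → Dec.does d ≡ false
does-false (yes p) ¬p = ⊥-elim (¬p p)
does-false (no _)  ¬p = refl

from-does : ∀ {P : Set} (d : Dec P) → Dec.does d ≡ true → P
from-does (yes p) _ = p

∑ : List A → (A → ℕ) → ℕ
∑ []       f = 0
∑ (x ∷ xs) f = f x + ∑ xs f

∑-mono∈ : ∀ (xs : List A) {f g : A → ℕ} → (∀ x → x ∈ xs → f x ≤ g x) → ∑ xs f ≤ ∑ xs g
∑-mono∈ []       p = z≤n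
∑-mono∈ (x ∷ xs) p = +-mono-≤ (p x (here refl)) (∑-mono∈ xs (λ y y∈ → p y (there y∈)))

∑-mono : ∀ (xs : List A) {f g : A → ℕ} → (∀ x → f x ≤ g x) → ∑ xs f ≤ ∑ xs g
∑-mono xs p = ∑-mono∈ xs (λ x _ → p x)

∑-cong∈ : ∀ (xs : List A) {f g : A → ℕ} → (∀ x → x ∈ xs → f x ≡ g x) → ∑ xs f ≡ ∑ xs g
∑-cong∈ []       p = refl
∑-cong∈ (x ∷ xs) p = cong₂ _+_ (p x (here refl)) (∑-cong∈ xs (λ y y∈ → p y (there y∈)))

∑-cong : ∀ (xs : List A) {f g : A → ℕ} → (∀ x → f x ≡ g x) → ∑ xs f ≡ ∑ xs g
∑-cong xs p = ∑-cong∈ xs (λ x _ → p x)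

interchange : ∀ a b c d → (a + b) + (c + d) ≡ (a + c) + (b + d)
interchange = solve-∀

∑-+ : ∀ (xs : List A) (f g : A → ℕ) → ∑ xs (λ x → f x + g x) ≡ ∑ xs f + ∑ xs g
∑-+ []       f g = refl
∑-+ (x ∷ xs) f g = trans (cong (f x + g x +_) (∑-+ xs f g)) (interchange (f x) (g x) (∑ xs f) (∑ xs g))

∑-*ˡ : ∀ (xs : List A) c (f : A → ℕ) → ∑ xs (λ x → c * f x) ≡ c * ∑ xs f
∑-*ˡ []       c f = sym (*-zeroʳ c)
∑-*ˡ (x ∷ xs) c f = trans (cong (c * f x +_) (∑-*ˡ xs c f)) (sym (*-distribˡ-+ c (f x) (∑ xs f)))

∑-*ʳ : ∀ (xs : List A) c (f : A → ℕ) → ∑ xs (λ x → f x * c) ≡ ∑ xs f * c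
∑-*ʳ xs c f = trans (∑-cong xs (λ x → *-comm (f x) c)) (trans (∑-*ˡ xs c f) (*-comm c (∑ xs f)))

∑-const : ∀ (xs : List A) c → ∑ xs (λ _ → c) ≡ length xs * c
∑-const []       c = refl
∑-const (x ∷ xs) c = cong (c +_) (∑-const xs c)

∑-zero : ∀ (xs : List A) → ∑ xs (λ _ → 0) ≡ 0
∑-zero xs = trans (∑-const xs 0) (*-zeroʳ (length xs))

∑-swap : ∀ (xs : List A) (ys : List A′) (f : A → A′ → ℕ) →
         ∑ xs (λ x → ∑ ys (f x)) ≡ ∑ ys (λ y → ∑ xs (λ x → f x y))
∑-swap []       ys f = sym (∑-zero ys)
∑-swap (x ∷ xs) ys f = trans (cong (∑ ys (f x) +_) (∑-swap xs ys f)) (sym (∑-+ ys (f x) _))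

∑-++ : ∀ (xs ys : List A) (f : A → ℕ) → ∑ (xs ++ ys) f ≡ ∑ xs f + ∑ ys f
∑-++ []       ys f = refl
∑-++ (x ∷ xs) ys f = trans (cong (f x +_) (∑-++ xs ys f)) (sym (+-assoc (f x) (∑ xs f) (∑ ys f)))

∑-map : ∀ (g : A → A′) (xs : List A) (f : A′ → ℕ) → ∑ (map g xs) f ≡ ∑ xs (f ∘ g)
∑-map g []       f = refl
∑-map g (x ∷ xs) f = cong (f (g x) +_) (∑-map g xs f)

∑-concatMap : ∀ (g : A → List A′) (xs : List A) (f : A′ → ℕ) →
              ∑ (concatMap g xs) f ≡ ∑ xs (λ x → ∑ (g x) f)
∑-concatMap g []       f = refl
∑-concatMap g (x ∷ xs) f = trans (∑-++ (g x) (concatMap g xs) f) (cong (∑ (g x) f +_) (∑-concatMap g xs f))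

∑-filter : ∀ (p : A → Bool) (xs : List A) (f : A → ℕ) →
           ∑ (filterᵇ p xs) f ≡ ∑ xs (λ x → 𝟙 (p x) * f x)
∑-filter p []       f = refl
∑-filter p (x ∷ xs) f with p x
... | true  = cong₂ _+_ (sym (+-identityʳ (f x))) (∑-filter p xs f)
... | false = ∑-filter p xs f

∈-filterᵇ⁻ : ∀ (p : A → Bool) (xs : List A) {x} → x ∈ filterᵇ p xs → x ∈ xs × p x ≡ true
∈-filterᵇ⁻ p (y ∷ xs) x∈ with p y in eq
∈-filterᵇ⁻ p (y ∷ xs) (here refl) | true = here refl , eq
∈-filterᵇ⁻ p (y ∷ xs) (there x∈) | true = let a , b = ∈-filterᵇ⁻ p xs x∈ in there a , b
∈-filterᵇ⁻ p (y ∷ xs) x∈ | false = let a , b = ∈-filterᵇ⁻ p xs x∈ in there a , b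

∈-filterᵇ⁺ : ∀ (p : A → Bool) (xs : List A) {x} → x ∈ xs → p x ≡ true → x ∈ filterᵇ p xs
∈-filterᵇ⁺ p (y ∷ xs) (here refl) q rewrite q = here refl
∈-filterᵇ⁺ p (y ∷ xs) (there x∈) q with p y
... | true  = there (∈-filterᵇ⁺ p xs x∈ q)
... | false = ∈-filterᵇ⁺ p xs x∈ q

length-∑ : ∀ (xs : List A) → length xs ≡ ∑ xs (λ _ → 1)
length-∑ xs = sym (trans (∑-const xs 1) (*-identityʳ (length xs)))

length-filterᵇ : ∀ (p : A → Bool) (xs : List A) → length (filterᵇ p xs) ≡ ∑ xs (λ x → 𝟙 (p x))
length-filterᵇ p xs = trans (length-∑ (filterᵇ p xs))
  (trans (∑-filter p xs (λ _ → 1)) (∑-cong xs (λ x → *-identityʳ (𝟙 (p x)))))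

length-split : ∀ (p : A → Bool) (xs : List A) →
               length xs ≡ length (filterᵇ p xs) + length (filterᵇ (not ∘ p) xs)
length-split p xs = sym (trans (cong₂ _+_ (length-filterᵇ p xs) (length-filterᵇ (not ∘ p) xs))
  (trans (sym (∑-+ xs (𝟙 ∘ p) (𝟙 ∘ not ∘ p)))
  (trans (∑-cong xs (λ x → 𝟙-not (p x))) (sym (length-∑ xs)))))

∑-∈-≤ : ∀ {xs : List A} {x} (f : A → ℕ) → x ∈ xs → f x ≤ ∑ xs f
∑-∈-≤ f (here refl)           = m≤m+n _ _
∑-∈-≤ {xs = y ∷ _} f (there p) = ≤-trans (∑-∈-≤ f p) (m≤n+m _ (f y))

∑-pos : ∀ (xs : List A) (f : A → ℕ) → 0 < ∑ xs f → ∃[ x ] (x ∈ xs × 0 < f x)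
∑-pos (x ∷ xs) f p with f x in eq
... | suc k = x , here refl , subst (0 <_) (sym eq) (s≤s z≤n)
... | zero  = let y , y∈ , q = ∑-pos xs f p in y , there y∈ , q

length-pos : ∀ (xs : List A) → 0 < length xs → ∃[ x ] x ∈ xs
length-pos (x ∷ xs) _ = x , here refl

𝟙-pos : ∀ {b} → 0 < 𝟙 b → b ≡ true
𝟙-pos {true} _ = refl

findᵇ : ∀ (p : A → Bool) (xs : List A) →
        (∃[ x ] (x ∈ xs × p x ≡ true)) ⊎ (∀ x → x ∈ xs → p x ≡ false)
findᵇ p [] = inj₂ λ _ ()
findᵇ p (x ∷ xs) with p x in eq | findᵇ p xs
... | true  | _ = inj₁ (x , here refl , eq)
... | false | inj₁ (y , y∈ , q) = inj₁ (y , there y∈ , q)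
... | false | inj₂ none = inj₂ λ { y (here refl) → eq ; y (there y∈) → none y y∈ }

argmax : ∀ (p : A → Bool) (f : A → ℕ) (xs : List A) →
         (∃[ x ] (x ∈ xs × p x ≡ true × (∀ y → y ∈ xs → p y ≡ true → f y ≤ f x)))
         ⊎ (∀ x → x ∈ xs → p x ≡ false)
argmax p f [] = inj₂ λ _ ()
argmax p f (x ∷ xs) with p x in eq | argmax p f xs
... | false | inj₂ none = inj₂ λ { y (here refl) → eq ; y (there y∈) → none y y∈ }
... | false | inj₁ (z , z∈ , pz , best) = inj₁ (z , there z∈ , pz ,
      λ { y (here refl) py → ⊥-elim (true≢false py eq) ; y (there y∈) py → best y y∈ py })
... | true | inj₂ none = inj₁ (x , here refl , eq ,
      λ { y (here refl) py → ≤-refl ; y (there y∈) py → ⊥-elim (true≢false py (none y y∈)) })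
... | true | inj₁ (z , z∈ , pz , best) with ≤-total (f x) (f z)
...   | inj₁ fx≤fz = inj₁ (z , there z∈ , pz ,
      λ { y (here refl) py → fx≤fz ; y (there y∈) py → best y y∈ py })
...   | inj₂ fz≤fx = inj₁ (x , here refl , eq ,
      λ { y (here refl) py → ≤-refl ; y (there y∈) py → ≤-trans (best y y∈ py) fz≤fx })

-- Vectors as independent choices of their coordinates

vecs : List A → (h : ℕ) → List (Vec A h)
vecs xs zero    = [] ∷ []
vecs xs (suc h) = concatMap (λ x → map (x ∷_) (vecs xs h)) xs

∑-vecs : ∀ (xs : List A) h (f : Vec A (suc h) → ℕ) →
         ∑ (vecs xs (suc h)) f ≡ ∑ xs (λ x → ∑ (vecs xs h) (λ v → f (x ∷ v)))
∑-vecs xs h f = trans (∑-concatMap _ xs f) (∑-cong xs (λ x → ∑-map (x ∷_) (vecs xs h) f))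

∏ : ∀ {h} → (Fin h → ℕ) → ℕ
∏ {zero}  g = 1
∏ {suc h} g = g zero * ∏ (g ∘ suc)

∏-mono : ∀ {h} {f g : Fin h → ℕ} → (∀ u → f u ≤ g u) → ∏ f ≤ ∏ g
∏-mono {zero}  p = ≤-refl
∏-mono {suc h} p = *-mono-≤ (p zero) (∏-mono (p ∘ suc))

∏-const : ∀ h c → ∏ {h} (λ _ → c) ≡ c ^ h
∏-const zero    c = refl
∏-const (suc h) c = cong (c *_) (∏-const h c)

∑-∏ : ∀ (xs : List A) h (g : Fin h → A → ℕ) →
      ∑ (vecs xs h) (λ v → ∏ (λ u → g u (lookup v u))) ≡ ∏ (λ u → ∑ xs (g u))
∑-∏ xs zero    g = refl
∑-∏ xs (suc h) g = begin
  ∑ (vecs xs (suc h)) (λ v → ∏ (λ u → g u (lookup v u)))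
    ≡⟨ ∑-vecs xs h _ ⟩
  ∑ xs (λ x → ∑ (vecs xs h) (λ v → g zero x * ∏ (λ u → g (suc u) (lookup v u))))
    ≡⟨ ∑-cong xs (λ x → trans (∑-*ˡ (vecs xs h) (g zero x) _) (cong (g zero x *_) (∑-∏ xs h (g ∘ suc)))) ⟩
  ∑ xs (λ x → g zero x * ∏ (λ u → ∑ xs (g (suc u))))
    ≡⟨ ∑-*ʳ xs _ (g zero) ⟩
  ∑ xs (g zero) * ∏ (λ u → ∑ xs (g (suc u))) ∎
  where open ≡-Reasoning

abstract
  allF : ∀ {h} → (Fin h → Bool) → Bool
  allF {zero}  p = true
  allF {suc h} p = p zero ∧ allF (p ∘ suc)

  allF-elim : ∀ {h} {p : Fin h → Bool} → allF p ≡ true → ∀ u → p u ≡ true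
  allF-elim {suc h} q zero    = proj₁ (∧-true q)
  allF-elim {suc h} {p} q (suc u) = allF-elim {p = p ∘ suc} (proj₂ (∧-true {p zero} q)) u

  allF-intro : ∀ {h} {p : Fin h → Bool} → (∀ u → p u ≡ true) → allF p ≡ true
  allF-intro {zero}  q = refl
  allF-intro {suc h} q = ∧-intro (q zero) (allF-intro (q ∘ suc))

  𝟙-allF : ∀ {h} (p : Fin h → Bool) → 𝟙 (allF p) ≡ ∏ (𝟙 ∘ p)
  𝟙-allF {zero}  p = refl
  𝟙-allF {suc h} p = trans (𝟙-∧ (p zero) (allF (p ∘ suc))) (cong (𝟙 (p zero) *_) (𝟙-allF (p ∘ suc)))

  allF-cong : ∀ {h} {p q : Fin h → Bool} → (∀ u → p u ≡ q u) → allF p ≡ allF q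
  allF-cong {zero}  e = refl
  allF-cong {suc h} e = cong₂ _∧_ (e zero) (allF-cong (e ∘ suc))

length-vecs : ∀ (xs : List A) h → length (vecs xs h) ≡ length xs ^ h
length-vecs xs h = begin
  length (vecs xs h)                       ≡⟨ length-∑ (vecs xs h) ⟩
  ∑ (vecs xs h) (λ _ → 1)                  ≡⟨ ∑-cong (vecs xs h) (λ _ → sym (trans (∏-const h 1) (^-zeroˡ h))) ⟩
  ∑ (vecs xs h) (λ v → ∏ {h} (λ _ → 1))    ≡⟨ ∑-∏ xs h (λ _ _ → 1) ⟩
  ∏ {h} (λ _ → ∑ xs (λ _ → 1))             ≡⟨ ∏-const h _ ⟩
  ∑ xs (λ _ → 1) ^ h                       ≡⟨ cong (_^ h) (sym (length-∑ xs)) ⟩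
  length xs ^ h ∎
  where open ≡-Reasoning

merge : ∀ {h} → (Fin h → Bool) → Vec A h → Vec A h → Vec A h
merge mask []      []      = []
merge mask (x ∷ v) (y ∷ w) = (if mask zero then y else x) ∷ merge (mask ∘ suc) v w

lookup-merge : ∀ {h} (mask : Fin h → Bool) (v w : Vec A h) u →
               lookup (merge mask v w) u ≡ (if mask u then lookup w u else lookup v u)
lookup-merge mask (x ∷ v) (y ∷ w) zero    = refl
lookup-merge mask (x ∷ v) (y ∷ w) (suc u) = lookup-merge (mask ∘ suc) v w u

-- A merged vector forgets the coordinates of `v` under the mask and those of `w` outside it, h
-- coordinates in all; hence every vector arises from |xs|^h pairs.
∑-merge : ∀ (xs : List A) h (mask : Fin h → Bool) (F : Vec A h → ℕ) →
          ∑ (vecs xs h) (λ v → ∑ (vecs xs h) (λ w → F (merge mask v w))) ≡ length xs ^ h * ∑ (vecs xs h) F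
∑-merge xs zero    mask F = trans (+-identityʳ (F [] + 0)) (sym (+-identityʳ (F [] + 0)))
∑-merge xs (suc h) mask F = begin
  ∑ (vecs xs (suc h)) (λ v → ∑ (vecs xs (suc h)) (λ w → F (merge mask v w)))
    ≡⟨ ∑-vecs xs h _ ⟩
  ∑ xs (λ x → ∑ V (λ v → ∑ (vecs xs (suc h)) (λ w → F (merge mask (x ∷ v) w))))
    ≡⟨ ∑-cong xs (λ x → trans (∑-cong V (λ v → ∑-vecs xs h _)) (∑-swap V xs _)) ⟩
  ∑ xs (λ x → ∑ xs (λ y → ∑ V (λ v → ∑ V (λ w → F (pick x y ∷ merge (mask ∘ suc) v w)))))
    ≡⟨ ∑-cong xs (λ x → ∑-cong xs (λ y → ∑-merge xs h (mask ∘ suc) (λ v → F (pick x y ∷ v)))) ⟩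
  ∑ xs (λ x → ∑ xs (λ y → k * G (pick x y)))
    ≡⟨ choose (mask zero) ⟩
  length xs * ∑ xs (λ x → k * G x)
    ≡⟨ cong (length xs *_) (∑-*ˡ xs k G) ⟩
  length xs * (k * ∑ xs G)
    ≡⟨ sym (*-assoc (length xs) k _) ⟩
  length xs * k * ∑ xs G
    ≡⟨ cong (length xs * k *_) (sym (∑-vecs xs h F)) ⟩
  length xs * k * ∑ (vecs xs (suc h)) F ∎
  where
    open ≡-Reasoning
    V = vecs xs h
    k = length xs ^ h
    pick = λ x y → if mask zero then y else x
    G = λ x → ∑ V (λ v → F (x ∷ v))
    choose : ∀ b → ∑ xs (λ x → ∑ xs (λ y → k * G (if b then y else x))) ≡ length xs * ∑ xs (λ x → k * G x)
    choose true  = ∑-const xs _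
    choose false = trans (∑-cong xs (λ x → ∑-const xs (k * G x))) (∑-*ˡ xs (length xs) _)

^-distribʳ-* : ∀ k a b → (a * b) ^ k ≡ a ^ k * b ^ k
^-distribʳ-* zero    a b = refl
^-distribʳ-* (suc k) a b = trans (cong (a * b *_) (^-distribʳ-* k a b)) (lem a b (a ^ k) (b ^ k))
  where lem : ∀ a b x y → a * b * (x * y) ≡ a * x * (b * y)
        lem = solve-∀

-- Stability

<ᵇ-true : ∀ {m n} → (m <ᵇ n) ≡ true → m < n
<ᵇ-true {m} {n} p = <ᵇ⇒< m n (Equivalence.from T-≡ p)

true-<ᵇ : ∀ {m n} → m < n → (m <ᵇ n) ≡ true
true-<ᵇ p = Equivalence.to T-≡ (<⇒<ᵇ p)

≡ᵇ-true : ∀ {m n} → (m ≡ᵇ n) ≡ true → m ≡ n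
≡ᵇ-true {m} {n} p = ≡ᵇ⇒≡ m n (Equivalence.from T-≡ p)

true-≡ᵇ : ∀ {m n} → m ≡ n → (m ≡ᵇ n) ≡ true
true-≡ᵇ {m} {n} p = Equivalence.to T-≡ (≡⇒≡ᵇ m n p)

≤ᵇ-true : ∀ {m n} → (m ≤ᵇ n) ≡ true → m ≤ n
≤ᵇ-true {m} {n} p = ≤ᵇ⇒≤ m n (Equivalence.from T-≡ p)

true-≤ᵇ : ∀ {m n} → m ≤ n → (m ≤ᵇ n) ≡ true
true-≤ᵇ p = Equivalence.to T-≡ (≤⇒≤ᵇ p)

≤ᵇ-false : ∀ {m n} → (m ≤ᵇ n) ≡ false → n < m
≤ᵇ-false p = ≰⇒> (λ q → true≢false (true-≤ᵇ q) p)

<ᵇ-false : ∀ {m n} → (m <ᵇ n) ≡ false → n ≤ m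
<ᵇ-false p = ≮⇒≥ (λ q → true≢false (true-<ᵇ q) p)

length-allFin : ∀ n → length (allFin n) ≡ n
length-allFin n = length-tabulate id

*-leftComm : ∀ a b c → a * (b * c) ≡ b * (a * c)
*-leftComm = solve-∀

-- A substitute for the power mean inequality: a scaled degree `X` is either below the threshold
-- `n`, and the first term suffices, or above it, and its own power dominates.
d-small-or-large : ∀ n h' X → X * n ^ suc h' ≤ n * n ^ suc h' + n * X ^ suc h'
d-small-or-large n h' X with ≤-total X n
... | inj₁ X≤n = ≤-trans (*-monoˡ-≤ (n ^ suc h') X≤n) (m≤m+n _ _)
... | inj₂ n≤X = begin
  X * (n * n ^ h')           ≡⟨ *-leftComm X n (n ^ h') ⟩
  n * (X * n ^ h')           ≤⟨ *-monoʳ-≤ n (*-monoʳ-≤ X (^-monoˡ-≤ h' n≤X)) ⟩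
  n * X ^ suc h'             ≤⟨ m≤n+m _ _ ⟩
  n * n ^ suc h' + n * X ^ suc h' ∎
  where open ≤-Reasoning

2xy≤x²+y² : ∀ x y → 2 * (x * y) ≤ x * x + y * y
2xy≤x²+y² x y with ≤-total x y
... | inj₁ x≤y with m≤n⇒∃[o]m+o≡n x≤y
...   | k , refl = ≤-trans (m≤m+n _ (k * k)) (≤-reflexive (lem x k))
  where lem : ∀ x k → 2 * (x * (x + k)) + k * k ≡ x * x + (x + k) * (x + k)
        lem = solve-∀
2xy≤x²+y² x y | inj₂ y≤x with m≤n⇒∃[o]m+o≡n y≤x
...   | k , refl = ≤-trans (m≤m+n _ (k * k)) (≤-reflexive (lem y k))
  where lem : ∀ x k → 2 * ((x + k) * x) + k * k ≡ (x + k) * (x + k) + x * x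
        lem = solve-∀

-- `U` counts as poor in maps on r colours when `hom r U * blowup h L r ≤ n ^ h`. The initial 2
-- makes this impossible for r = 0 and n > 0, as all n^h maps are then counted; the recursion is the
-- hypothesis of `few-heavy`.
blowup : ℕ → ℕ → ℕ → ℕ
blowup h L zero    = 2
blowup h L (suc r) = (2 * blowup h L r * L) ^ h

-- `c` will be a proper colouring of H. The maps that are counted preserve all edges of the complete
-- multipartite graph on its colour classes, not just those of H: this allows induction on the
-- number of colours, and every such map sends the edges of H to edges.
module Stability (n h' : ℕ) (c : Fin (suc h') → ℕ) (a : Fin n → Fin n → Bool)
                 (a-sym : ∀ x y → a x y ≡ a y x) where

  h : ℕ
  h = suc h'

  verts : List (Fin n)
  verts = allFin n

  Φ : List (Vec (Fin n) h)
  Φ = vecs verts h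

  ∣Φ∣ : length Φ ≡ n ^ h
  ∣Φ∣ = trans (length-vecs verts h) (cong (_^ h) (length-allFin n))

  infix 8 #_
  #_ : (Fin n → Bool) → ℕ
  # U = ∑ verts (𝟙 ∘ U)

  ∣U∣≤n : ∀ U → # U ≤ n
  ∣U∣≤n U = ≤-trans (∑-mono verts (λ x → 𝟙≤1 (U x)))
    (≤-reflexive (trans (sym (length-∑ verts)) (length-allFin n)))

  ∑-const-n : ∀ k → ∑ verts (λ _ → k) ≡ n * k
  ∑-const-n k = trans (∑-const verts k) (cong (_* k) (length-allFin n))

  adjAll : ℕ → Vec (Fin n) h → Fin n → Bool
  adjAll r φ x = allF λ w → (c w <ᵇ r) ⇒ᵇ a (lookup φ w) x

  ok : ℕ → (Fin n → Bool) → Vec (Fin n) h → Fin n → Bool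
  ok r U φ x = U x ∧ adjAll r φ x

  -- Only the coordinates of colour < r are constrained; the others run freely over all vertices,
  -- so that every homomorphism count below is relative to n ^ h.
  good : ℕ → (Fin n → Bool) → Vec (Fin n) h → Bool
  good zero    U φ = true
  good (suc r) U φ = good r U φ ∧ allF λ u → (c u ≡ᵇ r) ⇒ᵇ ok r U φ (lookup φ u)

  hom : ℕ → (Fin n → Bool) → ℕ
  hom r U = ∑ Φ (λ φ → 𝟙 (good r U φ))

  hom-0 : ∀ U → hom 0 U ≡ n ^ h
  hom-0 U = trans (sym (length-∑ Φ)) ∣Φ∣

  hom≤ : ∀ r U → hom r U ≤ n ^ h
  hom≤ r U = ≤-trans (∑-mono Φ (λ φ → 𝟙≤1 (good r U φ))) (≤-reflexive (trans (sym (length-∑ Φ)) ∣Φ∣))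

  nbr : (Fin n → Bool) → Fin n → Fin n → Bool
  nbr U x y = U y ∧ a x y

  good-nbr : ∀ r U x φ → good r (nbr U x) φ ≡ true → good r U φ ≡ true × adjAll r φ x ≡ true
  good-nbr zero    U x φ p = refl , allF-intro (λ w → ⇒ᵇ-intro (λ q → ⊥-elim (n≮0 (<ᵇ-true {c w} q))))
  good-nbr (suc r) U x φ p = ∧-intro (proj₁ IH) here-ok , adj'
    where
      IH = good-nbr r U x φ (proj₁ (∧-true p))
      at : ∀ u → c u ≡ r → nbr U x (lookup φ u) ≡ true × adjAll r φ (lookup φ u) ≡ true
      at u e = ∧-true (⇒ᵇ-elim (allF-elim (proj₂ (∧-true {good r (nbr U x) φ} p)) u) (true-≡ᵇ e))
      here-ok : allF (λ u → (c u ≡ᵇ r) ⇒ᵇ ok r U φ (lookup φ u)) ≡ true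
      here-ok = allF-intro λ u → ⇒ᵇ-intro λ q →
        let s , t = at u (≡ᵇ-true q) in ∧-intro (proj₁ (∧-true {U (lookup φ u)} s)) t
      adj' : adjAll (suc r) φ x ≡ true
      adj' = allF-intro λ w → ⇒ᵇ-intro λ q → case w (m≤n⇒m<n∨m≡n (s≤s⁻¹ (<ᵇ-true {c w} q)))
        where
          case : ∀ w → c w < r ⊎ c w ≡ r → a (lookup φ w) x ≡ true
          case w (inj₁ lt) = ⇒ᵇ-elim (allF-elim (proj₂ IH) w) (true-<ᵇ lt)
          case w (inj₂ e)  = trans (a-sym (lookup φ w) x) (proj₂ (∧-true {U (lookup φ w)} (proj₁ (at w e))))

  good-adj : ∀ r U φ → good r U φ ≡ true → ∀ i j → c i < c j → c j < r → a (lookup φ i) (lookup φ j) ≡ true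
  good-adj (suc r) U φ p i j i<j j<r with m≤n⇒m<n∨m≡n (s≤s⁻¹ j<r)
  ... | inj₁ lt = good-adj r U φ (proj₁ (∧-true {good r U φ} p)) i j i<j lt
  ... | inj₂ eq = ⇒ᵇ-elim (allF-elim (proj₂ (∧-true {U (lookup φ j)}
          (⇒ᵇ-elim (allF-elim (proj₂ (∧-true {good r U φ} p)) j) (true-≡ᵇ eq)))) i) (true-<ᵇ (subst (c i <_) eq i<j))

  deg : ℕ → (Fin n → Bool) → Vec (Fin n) h → ℕ
  deg r U φ = ∑ verts (λ x → 𝟙 (ok r U φ x))

  -- Both sides count pairs of a map and a vertex of `U` adjacent to its whole image. The left side
  -- also asks the map to lie in the neighbourhood, and `good-nbr` gives the inclusion.
  double-count : ∀ r U → ∑ verts (λ x → 𝟙 (U x) * hom r (nbr U x)) ≤ ∑ Φ (λ φ → 𝟙 (good r U φ) * deg r U φ)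
  double-count r U = begin
    ∑ verts (λ x → 𝟙 (U x) * hom r (nbr U x))
      ≡⟨ ∑-cong verts (λ x → sym (∑-*ˡ Φ (𝟙 (U x)) _)) ⟩
    ∑ verts (λ x → ∑ Φ (λ φ → 𝟙 (U x) * 𝟙 (good r (nbr U x) φ)))
      ≡⟨ ∑-swap verts Φ _ ⟩
    ∑ Φ (λ φ → ∑ verts (λ x → 𝟙 (U x) * 𝟙 (good r (nbr U x) φ)))
      ≤⟨ ∑-mono Φ (λ φ → ∑-mono verts (λ x → pointwise φ x)) ⟩
    ∑ Φ (λ φ → ∑ verts (λ x → 𝟙 (good r U φ) * 𝟙 (ok r U φ x)))
      ≡⟨ ∑-cong Φ (λ φ → ∑-*ˡ verts (𝟙 (good r U φ)) _) ⟩
    ∑ Φ (λ φ → 𝟙 (good r U φ) * deg r U φ) ∎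
    where
      open ≤-Reasoning
      pointwise : ∀ φ x → 𝟙 (U x) * 𝟙 (good r (nbr U x) φ) ≤ 𝟙 (good r U φ) * 𝟙 (ok r U φ x)
      pointwise φ x = begin
        𝟙 (U x) * 𝟙 (good r (nbr U x) φ)  ≡⟨ sym (𝟙-∧ (U x) _) ⟩
        𝟙 (U x ∧ good r (nbr U x) φ)      ≤⟨ 𝟙-mono (λ p → let u , g = ∧-true {U x} p ; g' , ad = good-nbr r U x φ g in ∧-intro g' (∧-intro u ad)) ⟩
        𝟙 (good r U φ ∧ ok r U φ x)       ≡⟨ 𝟙-∧ (good r U φ) _ ⟩
        𝟙 (good r U φ) * 𝟙 (ok r U φ x)   ∎

  module _ (ρ : ℕ) where
    mask : Fin h → Bool
    mask u = c u ≡ᵇ ρ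

    merge-keeps : ∀ (φ χ : Vec (Fin n) h) w → c w < ρ → lookup (merge mask φ χ) w ≡ lookup φ w
    merge-keeps φ χ w lt with c w ≡ᵇ ρ in e | lookup-merge mask φ χ w
    ... | true  | _  = ⊥-elim (<-irrefl (≡ᵇ-true {c w} e) lt)
    ... | false | eq = eq

    adjAll-merge : ∀ r φ χ x → r ≤ ρ → adjAll r (merge mask φ χ) x ≡ adjAll r φ x
    adjAll-merge r φ χ x le = allF-cong λ w → ⇒ᵇ-cong λ q →
      cong (λ y → a y x) (merge-keeps φ χ w (<-≤-trans (<ᵇ-true {c w} q) le))

    good-merge : ∀ r U φ χ → r ≤ ρ → good r U (merge mask φ χ) ≡ good r U φ
    good-merge zero    U φ χ le = refl
    good-merge (suc r) U φ χ le = cong₂ _∧_ (good-merge r U φ χ (<⇒≤ le))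
      (allF-cong λ u → ⇒ᵇ-cong λ q →
        let keep = merge-keeps φ χ u (subst (_< ρ) (sym (≡ᵇ-true {c u} q)) le) in
        trans (cong (ok r U (merge mask φ χ)) keep)
              (cong (U (lookup φ u) ∧_) (adjAll-merge r φ χ (lookup φ u) (<⇒≤ le))))

  -- Resampling the coordinates of colour r independently among the common neighbours.
  resample : ∀ r U → ∑ Φ (λ φ → 𝟙 (good r U φ) * deg r U φ ^ h) ≤ n ^ h * hom (suc r) U
  resample r U = begin
    ∑ Φ (λ φ → 𝟙 (good r U φ) * deg r U φ ^ h)
      ≡⟨ ∑-cong Φ (λ φ → cong (𝟙 (good r U φ) *_) (sym (∏-const h (deg r U φ)))) ⟩
    ∑ Φ (λ φ → 𝟙 (good r U φ) * ∏ {h} (λ _ → deg r U φ))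
      -- A coordinate of another colour is unconstrained, so `deg r U φ` is also a lower bound for
      -- the number of its choices. This gives the uniform exponent h instead of the size of the
      -- colour class.
      ≤⟨ ∑-mono Φ (λ φ → *-monoʳ-≤ (𝟙 (good r U φ)) (∏-mono (λ u → ∑-mono verts (λ x → 𝟙-mono {ok r U φ x} (λ p → ⇒ᵇ-intro {c u ≡ᵇ r} (λ _ → p)))))) ⟩
    ∑ Φ (λ φ → 𝟙 (good r U φ) * ∏ (λ u → ∑ verts (g φ u)))
      ≡⟨ ∑-cong Φ (λ φ → trans (cong (𝟙 (good r U φ) *_) (sym (∑-∏ verts h (g φ)))) (sym (∑-*ˡ Φ (𝟙 (good r U φ)) _))) ⟩
    ∑ Φ (λ φ → ∑ Φ (λ χ → 𝟙 (good r U φ) * ∏ (λ u → g φ u (lookup χ u))))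
      ≤⟨ ∑-mono Φ (λ φ → ∑-mono Φ (pointwise φ)) ⟩
    ∑ Φ (λ φ → ∑ Φ (λ χ → 𝟙 (good (suc r) U (merge (mask r) φ χ))))
      ≡⟨ ∑-merge verts h (mask r) (λ φ → 𝟙 (good (suc r) U φ)) ⟩
    length verts ^ h * hom (suc r) U
      ≡⟨ cong (λ k → k ^ h * hom (suc r) U) (length-allFin n) ⟩
    n ^ h * hom (suc r) U ∎
    where
      open ≤-Reasoning
      g : Vec (Fin n) h → Fin h → Fin n → ℕ
      g φ u x = 𝟙 ((c u ≡ᵇ r) ⇒ᵇ ok r U φ x)
      pointwise : ∀ φ χ → 𝟙 (good r U φ) * ∏ (λ u → g φ u (lookup χ u)) ≤ 𝟙 (good (suc r) U (merge (mask r) φ χ))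
      pointwise φ χ = begin
        𝟙 (good r U φ) * ∏ (λ u → g φ u (lookup χ u))
          ≡⟨ cong (𝟙 (good r U φ) *_) (sym (𝟙-allF _)) ⟩
        𝟙 (good r U φ) * 𝟙 (allF (λ u → (c u ≡ᵇ r) ⇒ᵇ ok r U φ (lookup χ u)))
          ≡⟨ sym (𝟙-∧ (good r U φ) _) ⟩
        𝟙 (good r U φ ∧ allF (λ u → (c u ≡ᵇ r) ⇒ᵇ ok r U φ (lookup χ u)))
          ≤⟨ 𝟙-mono (λ p → let s , t = ∧-true {good r U φ} p in ∧-intro (trans (good-merge r r U φ χ ≤-refl) s)
               (allF-intro (λ u → ⇒ᵇ-intro (λ q → extend u q (⇒ᵇ-elim (allF-elim t u) q))))) ⟩
        𝟙 (good (suc r) U (merge (mask r) φ χ)) ∎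
        where
          extend : ∀ u → (c u ≡ᵇ r) ≡ true → ok r U φ (lookup χ u) ≡ true →
                   ok r U (merge (mask r) φ χ) (lookup (merge (mask r) φ χ) u) ≡ true
          extend u q t rewrite trans (lookup-merge (mask r) φ χ u) (cong (λ b → if b then lookup χ u else lookup φ u) q)
                             | adjAll-merge r r φ χ (lookup χ u) ≤-refl = t

  light : ℕ → ℕ → (Fin n → Bool) → Fin n → Bool
  light B r U x = hom r (nbr U x) * B ≤ᵇ n ^ h

  heavy : ℕ → ℕ → (Fin n → Bool) → Fin n → Bool
  heavy B r U x = U x ∧ not (light B r U x)

  -- With more than n / L heavy vertices, double counting would give the good maps a total degree
  -- above 2 n n^h / D. Degrees below n / D account for at most half of it, and by `resample` the
  -- other half would force more than n^h / D^h good maps on one more colour.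
  few-heavy : ∀ B L r U → hom (suc r) U * (2 * B * L) ^ h ≤ n ^ h → # (heavy B r U) * L ≤ n
  few-heavy B L r U few with # (heavy B r U) * L ≤? n
  ... | yes p = p
  ... | no ¬p = ⊥-elim (<-irrefl refl (<-≤-trans many few))
    where
      open ≤-Reasoning
      D = 2 * B * L
      S = ∑ Φ (λ φ → 𝟙 (good r U φ) * deg r U φ)
      S^ = ∑ Φ (λ φ → 𝟙 (good r U φ) * deg r U φ ^ h)
      heavy-hom : ∀ x → 𝟙 (heavy B r U x) * n ^ h ≤ 𝟙 (U x) * hom r (nbr U x) * B
      heavy-hom x with U x | light B r U x in eq
      ... | false | _     = z≤n
      ... | true  | true  = z≤n
      ... | true  | false = begin
        n ^ h + 0                   ≡⟨ +-identityʳ _ ⟩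
        n ^ h                       ≤⟨ <⇒≤ (≤ᵇ-false eq) ⟩
        hom r (nbr U x) * B         ≡⟨ cong (_* B) (sym (+-identityʳ (hom r (nbr U x)))) ⟩
        (hom r (nbr U x) + 0) * B   ∎
      step₁ : # (heavy B r U) * n ^ h ≤ S * B
      step₁ = begin
        # (heavy B r U) * n ^ h                          ≡⟨ sym (∑-*ʳ verts (n ^ h) _) ⟩
        ∑ verts (λ x → 𝟙 (heavy B r U x) * n ^ h)        ≤⟨ ∑-mono verts heavy-hom ⟩
        ∑ verts (λ x → 𝟙 (U x) * hom r (nbr U x) * B)    ≡⟨ ∑-*ʳ verts B _ ⟩
        ∑ verts (λ x → 𝟙 (U x) * hom r (nbr U x)) * B    ≤⟨ *-monoˡ-≤ B (double-count r U) ⟩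
        S * B ∎
      step₂ : S * D * n ^ h ≤ n * (n ^ h * n ^ h) + n * (D ^ h * (n ^ h * hom (suc r) U))
      step₂ = begin
        S * D * n ^ h
          ≡⟨ *-assoc S D _ ⟩
        S * (D * n ^ h)
          ≡⟨ sym (∑-*ʳ Φ (D * n ^ h) _) ⟩
        ∑ Φ (λ φ → 𝟙 (good r U φ) * deg r U φ * (D * n ^ h))
          ≤⟨ ∑-mono Φ pointwise ⟩
        ∑ Φ (λ φ → 𝟙 (good r U φ) * (n * n ^ h) + 𝟙 (good r U φ) * deg r U φ ^ h * (n * D ^ h))
          ≡⟨ ∑-+ Φ _ _ ⟩
        ∑ Φ (λ φ → 𝟙 (good r U φ) * (n * n ^ h)) + ∑ Φ (λ φ → 𝟙 (good r U φ) * deg r U φ ^ h * (n * D ^ h))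
          ≡⟨ cong₂ _+_ (∑-*ʳ Φ _ _) (∑-*ʳ Φ _ _) ⟩
        hom r U * (n * n ^ h) + S^ * (n * D ^ h)
          ≤⟨ +-mono-≤ (*-monoˡ-≤ _ (hom≤ r U)) (*-monoˡ-≤ _ (resample r U)) ⟩
        n ^ h * (n * n ^ h) + n ^ h * hom (suc r) U * (n * D ^ h)
          ≡⟨ rearrange (n ^ h) n (hom (suc r) U) (D ^ h) ⟩
        n * (n ^ h * n ^ h) + n * (D ^ h * (n ^ h * hom (suc r) U)) ∎
        where
          rearrange : ∀ p n t d → p * (n * p) + p * t * (n * d) ≡ n * (p * p) + n * (d * (p * t))
          rearrange = solve-∀
          lem₁ : ∀ g d D N → g * d * (D * N) ≡ g * (d * D * N)
          lem₁ = solve-∀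
          lem₂ : ∀ g d D N n → g * (n * N + n * (d * D)) ≡ g * (n * N) + g * d * (n * D)
          lem₂ = solve-∀
          pointwise : ∀ φ → 𝟙 (good r U φ) * deg r U φ * (D * n ^ h)
                          ≤ 𝟙 (good r U φ) * (n * n ^ h) + 𝟙 (good r U φ) * deg r U φ ^ h * (n * D ^ h)
          pointwise φ = begin
            𝟙 (good r U φ) * d * (D * n ^ h)
              ≡⟨ lem₁ (𝟙 (good r U φ)) d D (n ^ h) ⟩
            𝟙 (good r U φ) * (d * D * n ^ h)
              ≤⟨ *-monoʳ-≤ (𝟙 (good r U φ)) (d-small-or-large n h' (d * D)) ⟩
            𝟙 (good r U φ) * (n * n ^ h + n * (d * D) ^ h)
              ≡⟨ cong (λ k → 𝟙 (good r U φ) * (n * n ^ h + n * k)) (^-distribʳ-* h d D) ⟩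
            𝟙 (good r U φ) * (n * n ^ h + n * (d ^ h * D ^ h))
              ≡⟨ lem₂ (𝟙 (good r U φ)) (d ^ h) (D ^ h) (n ^ h) n ⟩
            𝟙 (good r U φ) * (n * n ^ h) + 𝟙 (good r U φ) * d ^ h * (n * D ^ h) ∎
            where d = deg r U φ
      n>0 : 0 < n
      n>0 with 0 <? n
      ... | yes p = p
      ... | no q  = ⊥-elim (¬p (≤-trans (≤-reflexive (cong (_* L) (n≤0⇒n≡0 (≤-trans (∣U∣≤n _) (≮⇒≥ q))))) z≤n))
      instance
        n≢0 : NonZero n
        n≢0 = >-nonZero n>0
        n^≢0 : NonZero (n ^ h)
        n^≢0 = m^n≢0 n h
        nn^≢0 : NonZero (n * n ^ h)
        nn^≢0 = m*n≢0 n (n ^ h)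
      step₃ : n * (n ^ h * n ^ h) + n * (n ^ h * n ^ h) < S * D * n ^ h
      step₃ = begin-strict
        n * (n ^ h * n ^ h) + n * (n ^ h * n ^ h)       ≡⟨ lem n (n ^ h) ⟩
        n * (2 * (n ^ h * n ^ h))                       <⟨ *-monoˡ-< (2 * (n ^ h * n ^ h)) {{m*n≢0 2 (n ^ h * n ^ h) {{_}} {{m*n≢0 (n ^ h) (n ^ h)}}}} (≰⇒> ¬p) ⟩
        # (heavy B r U) * L * (2 * (n ^ h * n ^ h))     ≡⟨ lem' (# (heavy B r U)) L (n ^ h) ⟩
        # (heavy B r U) * n ^ h * (2 * L * n ^ h)       ≤⟨ *-monoˡ-≤ _ step₁ ⟩
        S * B * (2 * L * n ^ h)                         ≡⟨ lem'' S B L (n ^ h) ⟩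
        S * D * n ^ h ∎
        where
          lem : ∀ n p → n * (p * p) + n * (p * p) ≡ n * (2 * (p * p))
          lem = solve-∀
          lem' : ∀ v l p → v * l * (2 * (p * p)) ≡ v * p * (2 * l * p)
          lem' = solve-∀
          lem'' : ∀ s b l p → s * b * (2 * l * p) ≡ s * (2 * b * l) * p
          lem'' = solve-∀
      many : n ^ h < hom (suc r) U * D ^ h
      many = *-cancelˡ-< (n * n ^ h) _ _ (begin-strict
        n * n ^ h * n ^ h                              ≡⟨ *-assoc n _ _ ⟩
        n * (n ^ h * n ^ h)                            <⟨ +-cancelˡ-< (n * (n ^ h * n ^ h)) _ _ (<-≤-trans step₃ step₂) ⟩
        n * (D ^ h * (n ^ h * hom (suc r) U))          ≡⟨ lem n (D ^ h) (n ^ h) (hom (suc r) U) ⟩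
        n * n ^ h * (hom (suc r) U * D ^ h) ∎)
        where
          lem : ∀ n d p t → n * (d * (p * t)) ≡ n * p * (t * d)
          lem = solve-∀

  -- Monochromatic edges count twice. As `total` runs over ordered pairs, for a loopless graph it is
  -- twice e(U) + mono(U), the quantity that Füredi's argument bounds directly.
  weight : (Fin n → ℕ) → Fin n → Fin n → ℕ
  weight col y z = 𝟙 (a y z) * (1 + 𝟙 (col y ≡ᵇ col z))

  total : (Fin n → ℕ) → (Fin n → Bool) → ℕ
  total col U = ∑ verts λ y → ∑ verts λ z → 𝟙 (U y) * 𝟙 (U z) * weight col y z

  good-mono : ∀ r {U W : Fin n → Bool} → (∀ x → W x ≡ true → U x ≡ true) → ∀ φ → good r W φ ≡ true → good r U φ ≡ true
  good-mono zero    sub φ p = refl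
  good-mono (suc r) {U} {W} sub φ p = let s , t = ∧-true {good r W φ} p in
    ∧-intro (good-mono r sub φ s) (allF-intro λ u → ⇒ᵇ-intro λ q →
      let x , y = ∧-true {W (lookup φ u)} (⇒ᵇ-elim (allF-elim t u) q) in ∧-intro (sub _ x) y)

  hom-mono : ∀ r {U W : Fin n → Bool} → (∀ x → W x ≡ true → U x ≡ true) → hom r W ≤ hom r U
  hom-mono r sub = ∑-mono Φ (λ φ → 𝟙-mono (good-mono r sub φ))

  -- With no colour to place every map is good, so every vertex of `U` is heavy and `few-heavy`
  -- bounds all of `U`.
  small-vertex-set : ∀ L U → hom 1 U * blowup h L 1 ≤ n ^ h → # U * L ≤ n
  small-vertex-set L U p = ≤-trans (*-monoˡ-≤ L (∑-mono verts λ x → 𝟙-mono (all-heavy x))) (few-heavy 2 L 0 U p)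
    where
      all-heavy : ∀ x → U x ≡ true → heavy 2 0 U x ≡ true
      all-heavy x u with light 2 0 U x in eq
      ... | false = ∧-intro u refl
      ... | true  = ⊥-elim (<-irrefl refl (begin-strict
        n ^ h           <⟨ m<m*n (n ^ h) 2 {{m^n≢0 n h {{>-nonZero (≤-<-trans z≤n (Fin.toℕ<n x))}}}} (s≤s (s≤s z≤n)) ⟩
        n ^ h * 2       ≡⟨ cong (_* 2) (sym (hom-0 (nbr U x))) ⟩
        hom 0 (nbr U x) * 2 ≤⟨ ≤ᵇ-true eq ⟩
        n ^ h ∎))
        where open ≤-Reasoning

  -- Füredi's count for a single pair; `u`, `l`, `r` stand for membership in U, lightness and
  -- membership in R. A pair with a heavy endpoint is charged 2. An edge between R and the light
  -- vertices outside R has weight 1 and is charged to its end outside R; an edge outside R has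
  -- weight 2 and is charged to both ends.
  split-bound : ∀ (u l r u' l' r' a e e' : Bool) →
    (r ≡ true → u ∧ l ≡ true) → (r' ≡ true → u' ∧ l' ≡ true) →
    (r ≡ true → r' ≡ false → e ≡ false) → (r ≡ false → r' ≡ true → e ≡ false) → (r ≡ true → r' ≡ true → e ≡ e') →
    𝟙 u * 𝟙 u' * (𝟙 a * (1 + 𝟙 e)) ≤
      2 * 𝟙 (u ∧ not l) + (2 * 𝟙 (u' ∧ not l') + (𝟙 ((u ∧ l) ∧ not r) * 𝟙 ((u' ∧ l') ∧ a) +
      (𝟙 ((u' ∧ l') ∧ not r') * 𝟙 ((u ∧ l) ∧ a) + 𝟙 r * 𝟙 r' * (𝟙 a * (1 + 𝟙 e')))))
  split-bound false _ _ _ _ _ _ _ _ _ _ _ _ _ = z≤n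
  split-bound true _ _ false _ _ _ _ _ _ _ _ _ _ = z≤n
  split-bound true _ _ true _ _ false _ _ _ _ _ _ _ = z≤n
  split-bound true false _ true _ _ true true  _ _ _ _ _ _ = s≤s (s≤s z≤n)
  split-bound true false _ true _ _ true false _ _ _ _ _ _ = s≤s z≤n
  split-bound true true _ true false _ true true  _ _ _ _ _ _ = s≤s (s≤s z≤n)
  split-bound true true _ true false _ true false _ _ _ _ _ _ = s≤s z≤n
  split-bound true true true true true true true e e' _ _ _ _ p rewrite p refl refl = ≤-refl
  split-bound true true true true true false true e e' _ _ p _ _ rewrite p refl refl = s≤s z≤n
  split-bound true true false true true true true e e' _ _ _ p _ rewrite p refl refl = s≤s z≤n
  split-bound true true false true true false true true  e' _ _ _ _ _ = s≤s (s≤s z≤n)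
  split-bound true true false true true false true false e' _ _ _ _ _ = s≤s z≤n

  module _ (L : ℕ) where

    -- A light vertex has a neighbourhood poor in maps on one colour, thus of size at most n / L;
    -- the heavy vertices number at most n / L. Each kind contributes at most n² / L adjacent
    -- ordered pairs, of weight 2.
    stable-edgeless : ∀ U → hom 2 U * blowup h L 2 ≤ n ^ h → L * total (λ _ → 0) U ≤ 4 * (n * n)
    stable-edgeless U p = begin
      L * total (λ _ → 0) U
        ≡⟨ trans (sym (∑-*ˡ verts L _)) (∑-cong verts (λ y → sym (∑-*ˡ verts L _))) ⟩
      ∑ verts (λ y → ∑ verts (λ z → L * (𝟙 (U y) * 𝟙 (U z) * weight (λ _ → 0) y z)))
        ≡⟨ ∑-cong verts (λ y → trans (∑-cong verts (rearrange y)) (∑-*ˡ verts (2 * (𝟙 (U y) * L)) (λ z → 𝟙 (nbr U y z)))) ⟩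
      ∑ verts (λ y → 2 * (𝟙 (U y) * L) * # (nbr U y))
        ≤⟨ ∑-mono verts pointwise ⟩
      ∑ verts (λ y → 2 * (𝟙 (heavy B 1 U y) * (L * n) + n))
        ≡⟨ ∑-*ˡ verts 2 _ ⟩
      2 * ∑ verts (λ y → 𝟙 (heavy B 1 U y) * (L * n) + n)
        ≡⟨ cong (2 *_) (trans (∑-+ verts _ _) (cong₂ _+_ (∑-*ʳ verts (L * n) _) (∑-const-n n))) ⟩
      2 * (# (heavy B 1 U) * (L * n) + n * n)
        ≡⟨ cong (λ k → 2 * (k + n * n)) (sym (*-assoc (# (heavy B 1 U)) L n)) ⟩
      2 * (# (heavy B 1 U) * L * n + n * n)
        ≤⟨ *-monoʳ-≤ 2 (+-monoˡ-≤ (n * n) (*-monoˡ-≤ n (few-heavy B L 1 U p))) ⟩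
      2 * (n * n + n * n)
        ≡⟨ lem (n * n) ⟩
      4 * (n * n) ∎
      where
        open ≤-Reasoning
        B = blowup h L 1
        lem : ∀ k → 2 * (k + k) ≡ 4 * k
        lem = solve-∀
        rearrange : ∀ y z → L * (𝟙 (U y) * 𝟙 (U z) * weight (λ _ → 0) y z) ≡ 2 * (𝟙 (U y) * L) * 𝟙 (nbr U y z)
        rearrange y z rewrite 𝟙-∧ (U z) (a y z) = lem' L (𝟙 (U y)) (𝟙 (U z)) (𝟙 (a y z))
          where lem' : ∀ l y z a → l * (y * z * (a * 2)) ≡ 2 * (y * l) * (z * a)
                lem' = solve-∀
        pointwise : ∀ y → 2 * (𝟙 (U y) * L) * # (nbr U y) ≤ 2 * (𝟙 (heavy B 1 U y) * (L * n) + n)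
        pointwise y with U y | light B 1 U y in eq
        ... | false | _ = z≤n
        ... | true | false = begin
          2 * (1 * L) * # (nbr U y)    ≤⟨ *-monoʳ-≤ (2 * (1 * L)) (∣U∣≤n (nbr U y)) ⟩
          2 * (1 * L) * n              ≡⟨ lem₁ L n ⟩
          2 * (1 * (L * n))            ≤⟨ *-monoʳ-≤ 2 (m≤m+n (1 * (L * n)) n) ⟩
          2 * (1 * (L * n) + n)        ∎
          where lem₁ : ∀ l n → 2 * (1 * l) * n ≡ 2 * (1 * (l * n))
                lem₁ = solve-∀
        ... | true | true = begin
          2 * (1 * L) * # (nbr U y)    ≡⟨ lem₁ L (# (nbr U y)) ⟩
          2 * (# (nbr U y) * L)        ≤⟨ *-monoʳ-≤ 2 (small-vertex-set L (nbr U y) (≤ᵇ-true eq)) ⟩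
          2 * n                        ∎
          where lem₁ : ∀ l n → 2 * (1 * l) * n ≡ 2 * (n * l)
                lem₁ = solve-∀

    -- The right side exceeds the left by the square of (1 + ρ) v - w, so equality holds when the
    -- new class has its fair share of the vertices.
    quadratic : ∀ ρ v w → (2 + ρ) * (2 * (1 + ρ) * (v * w) + ρ * (w * w)) ≤ (1 + ρ) * (1 + ρ) * ((v + w) * (v + w))
    quadratic ρ v w = +-cancelʳ-≤ (2 * ((1 + ρ) * v * w)) _ _ (begin
      (2 + ρ) * (2 * (1 + ρ) * (v * w) + ρ * (w * w)) + 2 * ((1 + ρ) * v * w)
        ≤⟨ +-monoʳ-≤ ((2 + ρ) * (2 * (1 + ρ) * (v * w) + ρ * (w * w))) (2xy≤x²+y² ((1 + ρ) * v) w) ⟩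
      (2 + ρ) * (2 * (1 + ρ) * (v * w) + ρ * (w * w)) + ((1 + ρ) * v * ((1 + ρ) * v) + w * w)
        ≡⟨ lem ρ v w ⟩
      (1 + ρ) * (1 + ρ) * ((v + w) * (v + w)) + 2 * ((1 + ρ) * v * w) ∎)
      where
        open ≤-Reasoning
        lem : ∀ ρ v w → (2 + ρ) * (2 * (1 + ρ) * (v * w) + ρ * (w * w)) + ((1 + ρ) * v * ((1 + ρ) * v) + w * w)
                      ≡ (1 + ρ) * (1 + ρ) * ((v + w) * (v + w)) + 2 * ((1 + ρ) * v * w)
        lem = solve-∀

    -- The error coefficient is the one that the recursion reproduces: 4 (1 + ρ)(2 + ρ) from the
    -- heavy vertices and 4 (2 + ρ)(1 + ρ)² from the hypothesis add up to (1 + ρ) times 4 (2 + ρ)².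
    stable-step : ∀ ρ e e' v w t u → v + w ≤ u → t * L ≤ n →
      e ≤ 4 * (n * t) + (2 * (v * w) + e') →
      (1 + ρ) * L * e' ≤ ρ * L * (w * w) + 4 * ((1 + ρ) * (1 + ρ)) * (n * n) →
      (2 + ρ) * L * e ≤ (1 + ρ) * L * (u * u) + 4 * ((2 + ρ) * (2 + ρ)) * (n * n)
    stable-step ρ e e' v w t u v+w≤u tL≤n e≤ IH = *-cancelˡ-≤ (1 + ρ) (begin
      (1 + ρ) * ((2 + ρ) * L * e)
        ≤⟨ *-monoʳ-≤ (1 + ρ) (*-monoʳ-≤ ((2 + ρ) * L) e≤) ⟩
      (1 + ρ) * ((2 + ρ) * L * (4 * (n * t) + (2 * (v * w) + e')))
        ≡⟨ lem₁ ρ L n t (v * w) e' ⟩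
      4 * ((1 + ρ) * (2 + ρ) * n) * (t * L) + (2 + ρ) * (2 * (1 + ρ) * L * (v * w)) + (2 + ρ) * ((1 + ρ) * L * e')
        ≤⟨ +-mono-≤ (+-monoˡ-≤ _ (*-monoʳ-≤ (4 * ((1 + ρ) * (2 + ρ) * n)) tL≤n)) (*-monoʳ-≤ (2 + ρ) IH) ⟩
      4 * ((1 + ρ) * (2 + ρ) * n) * n + (2 + ρ) * (2 * (1 + ρ) * L * (v * w)) + (2 + ρ) * (ρ * L * (w * w) + 4 * ((1 + ρ) * (1 + ρ)) * (n * n))
        ≡⟨ lem₂ ρ L n (v * w) (w * w) ⟩
      L * ((2 + ρ) * (2 * (1 + ρ) * (v * w) + ρ * (w * w))) + 4 * ((1 + ρ) * ((2 + ρ) * (2 + ρ))) * (n * n)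
        ≤⟨ +-monoˡ-≤ _ (*-monoʳ-≤ L (≤-trans (quadratic ρ v w) (*-monoʳ-≤ ((1 + ρ) * (1 + ρ)) (*-mono-≤ v+w≤u v+w≤u)))) ⟩
      L * ((1 + ρ) * (1 + ρ) * (u * u)) + 4 * ((1 + ρ) * ((2 + ρ) * (2 + ρ))) * (n * n)
        ≡⟨ lem₃ ρ L (u * u) (n * n) ⟩
      (1 + ρ) * ((1 + ρ) * L * (u * u) + 4 * ((2 + ρ) * (2 + ρ)) * (n * n)) ∎)
      where
        open ≤-Reasoning
        lem₁ : ∀ ρ L n t x e → (1 + ρ) * ((2 + ρ) * L * (4 * (n * t) + (2 * x + e)))
             ≡ 4 * ((1 + ρ) * (2 + ρ) * n) * (t * L) + (2 + ρ) * (2 * (1 + ρ) * L * x) + (2 + ρ) * ((1 + ρ) * L * e)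
        lem₁ = solve-∀
        lem₂ : ∀ ρ L n x y → 4 * ((1 + ρ) * (2 + ρ) * n) * n + (2 + ρ) * (2 * (1 + ρ) * L * x) + (2 + ρ) * (ρ * L * y + 4 * ((1 + ρ) * (1 + ρ)) * (n * n))
             ≡ L * ((2 + ρ) * (2 * (1 + ρ) * x + ρ * y)) + 4 * ((1 + ρ) * ((2 + ρ) * (2 + ρ))) * (n * n)
        lem₂ = solve-∀
        lem₃ : ∀ ρ L x y → L * ((1 + ρ) * (1 + ρ) * x) + 4 * ((1 + ρ) * ((2 + ρ) * (2 + ρ))) * y
             ≡ (1 + ρ) * ((1 + ρ) * L * x + 4 * ((2 + ρ) * (2 + ρ)) * y)
        lem₃ = solve-∀

    -- Among the light vertices take one with the most light neighbours and let R be these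
    -- neighbours. By lightness R is poor in maps on one colour less and is coloured recursively;
    -- the other light vertices form a new class, in which each vertex has at most |R| light
    -- neighbours.
    stable : ∀ ρ U → hom (2 + ρ) U * blowup h L (2 + ρ) ≤ n ^ h →
      ∃[ col ] ((∀ x → col x < 1 + ρ) ×
        (1 + ρ) * L * total col U ≤ ρ * L * (# U * # U) + 4 * ((1 + ρ) * (1 + ρ)) * (n * n))
    stable zero U p = (λ _ → 0) , (λ _ → s≤s z≤n) ,
      subst (λ k → k * total (λ _ → 0) U ≤ 4 * (n * n)) (sym (*-identityˡ L)) (stable-edgeless U p)
    stable (suc ρ) U p = conclude (argmax U' (λ x → # (nbr U' x)) verts)
      where
        open ≤-Reasoning
        B = blowup h L (2 + ρ)
        U' = λ x → U x ∧ light B (2 + ρ) U x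
        T₀ = heavy B (2 + ρ) U
        Goal = ∃[ col ] ((∀ x → col x < 2 + ρ) ×
          (2 + ρ) * L * total col U ≤ (1 + ρ) * L * (# U * # U) + 4 * ((2 + ρ) * (2 + ρ)) * (n * n))
        finish : ∀ (R : Fin n → Bool) col' → (∀ x → R x ≡ true → U' x ≡ true) → (∀ x → col' x < 1 + ρ) →
          (∀ y → U' y ≡ true → # (nbr U' y) ≤ # R) →
          (1 + ρ) * L * total col' R ≤ ρ * L * (# R * # R) + 4 * ((1 + ρ) * (1 + ρ)) * (n * n) → Goal
        finish R col' R⊆U' col'< maxdeg IH = col , col< ,
          stable-step ρ (total col U) (total col' R) (# V₁) (# R) (# T₀) (# U) disjoint (few-heavy B L (2 + ρ) U p) total≤ IH
          where
            -- The heavy vertices receive the new colour as well; they are few enough to be charged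
            -- n edges each.
            col = λ x → if R x then col' x else 1 + ρ
            V₁ = λ x → U' x ∧ not (R x)
            col< : ∀ x → col x < 2 + ρ
            col< x with R x
            ... | true  = m<n⇒m<1+n (col'< x)
            ... | false = ≤-refl
            disjoint : # V₁ + # R ≤ # U
            disjoint = ≤-trans (≤-reflexive (sym (∑-+ verts _ _))) (∑-mono verts λ x → d (U x) (light B (2 + ρ) U x) (R x) (R⊆U' x))
              where
                d : ∀ u l r → (r ≡ true → u ∧ l ≡ true) → 𝟙 ((u ∧ l) ∧ not r) + 𝟙 r ≤ 𝟙 u
                d u l true q rewrite proj₁ (∧-true {u} (q refl)) | proj₂ (∧-true {u} (q refl)) = ≤-refl
                d false l false q = z≤n
                d true false false q = z≤n
                d true true false q = ≤-refl
            col-R : ∀ {x} → R x ≡ true → col x ≡ col' x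
            col-R e rewrite e = refl
            col-V : ∀ {x} → R x ≡ false → col x ≡ 1 + ρ
            col-V e rewrite e = refl
            differ : ∀ {i j} → i < j → (i ≡ᵇ j) ≡ false
            differ {i} {j} lt with i ≡ᵇ j in e
            ... | true  = ⊥-elim (<-irrefl (≡ᵇ-true {i} e) lt)
            ... | false = refl
            differ' : ∀ {i j} → j < i → (i ≡ᵇ j) ≡ false
            differ' {i} {j} lt with i ≡ᵇ j in e
            ... | true  = ⊥-elim (<-irrefl (sym (≡ᵇ-true {i} e)) lt)
            ... | false = refl
            pointwise : ∀ y z → 𝟙 (U y) * 𝟙 (U z) * weight col y z ≤
              2 * 𝟙 (T₀ y) + (2 * 𝟙 (T₀ z) + (𝟙 (V₁ y) * 𝟙 (nbr U' y z) + (𝟙 (V₁ z) * 𝟙 (nbr U' z y) + 𝟙 (R y) * 𝟙 (R z) * weight col' y z)))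
            pointwise y z rewrite a-sym z y =
              split-bound (U y) (light B (2 + ρ) U y) (R y) (U z) (light B (2 + ρ) U z) (R z) (a y z) (col y ≡ᵇ col z) (col' y ≡ᵇ col' z)
                (R⊆U' y) (R⊆U' z)
                (λ p q → trans (cong₂ _≡ᵇ_ (col-R p) (col-V q)) (differ (col'< y)))
                (λ p q → trans (cong₂ _≡ᵇ_ (col-V p) (col-R q)) (differ' (col'< z)))
                (λ p q → cong₂ _≡ᵇ_ (col-R p) (col-R q))
            half : ∑ verts (λ y → ∑ verts (λ z → 𝟙 (V₁ y) * 𝟙 (nbr U' y z))) ≤ # V₁ * # R
            half = begin
              ∑ verts (λ y → ∑ verts (λ z → 𝟙 (V₁ y) * 𝟙 (nbr U' y z)))
                ≡⟨ ∑-cong verts (λ y → ∑-*ˡ verts (𝟙 (V₁ y)) _) ⟩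
              ∑ verts (λ y → 𝟙 (V₁ y) * # (nbr U' y))
                ≤⟨ ∑-mono verts bound ⟩
              ∑ verts (λ y → 𝟙 (V₁ y) * # R)
                ≡⟨ ∑-*ʳ verts (# R) _ ⟩
              # V₁ * # R ∎
              where
                bound : ∀ y → 𝟙 (V₁ y) * # (nbr U' y) ≤ 𝟙 (V₁ y) * # R
                bound y with V₁ y in e
                ... | false = z≤n
                ... | true  = *-monoʳ-≤ 1 (maxdeg y (proj₁ (∧-true {U' y} e)))
            total≤ : total col U ≤ 4 * (n * # T₀) + (2 * (# V₁ * # R) + total col' R)
            total≤ = begin
              total col U
                ≤⟨ ∑-mono verts (λ y → ∑-mono verts (pointwise y)) ⟩
              ∑ verts (λ y → ∑ verts (λ z → 2 * 𝟙 (T₀ y) + (2 * 𝟙 (T₀ z) + (𝟙 (V₁ y) * 𝟙 (nbr U' y z) + (𝟙 (V₁ z) * 𝟙 (nbr U' z y) + 𝟙 (R y) * 𝟙 (R z) * weight col' y z)))))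
                ≡⟨ ∑∑-+ _ _ ⟩
              ∑ verts (λ y → ∑ verts (λ z → 2 * 𝟙 (T₀ y))) + ∑ verts (λ y → ∑ verts (λ z → 2 * 𝟙 (T₀ z) + (𝟙 (V₁ y) * 𝟙 (nbr U' y z) + (𝟙 (V₁ z) * 𝟙 (nbr U' z y) + 𝟙 (R y) * 𝟙 (R z) * weight col' y z))))
                ≡⟨ cong₂ _+_ (trans (∑-cong verts (λ y → ∑-const-n (2 * 𝟙 (T₀ y)))) (trans (∑-*ˡ verts n _) (cong (n *_) (∑-*ˡ verts 2 _))))
                     (trans (∑∑-+ _ _) (cong₂ _+_ (trans (∑-const-n _) (cong (n *_) (∑-*ˡ verts 2 _))) (trans (∑∑-+ _ _) (cong₂ _+_ refl (∑∑-+ _ _))))) ⟩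
              n * (2 * # T₀) + (n * (2 * # T₀) + (∑ verts (λ y → ∑ verts (λ z → 𝟙 (V₁ y) * 𝟙 (nbr U' y z))) + (∑ verts (λ y → ∑ verts (λ z → 𝟙 (V₁ z) * 𝟙 (nbr U' z y))) + total col' R)))
                ≤⟨ +-monoʳ-≤ (n * (2 * # T₀)) (+-monoʳ-≤ (n * (2 * # T₀)) (+-mono-≤ half (+-monoˡ-≤ (total col' R) (≤-trans (≤-reflexive (∑-swap verts verts _)) half)))) ⟩
              n * (2 * # T₀) + (n * (2 * # T₀) + (# V₁ * # R + (# V₁ * # R + total col' R)))
                ≡⟨ lem n (# T₀) (# V₁ * # R) (total col' R) ⟩
              4 * (n * # T₀) + (2 * (# V₁ * # R) + total col' R) ∎
              where
                lem : ∀ n t x e → n * (2 * t) + (n * (2 * t) + (x + (x + e))) ≡ 4 * (n * t) + (2 * x + e)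
                lem = solve-∀
                ∑∑-+ : ∀ (f g : Fin n → Fin n → ℕ) → ∑ verts (λ y → ∑ verts (λ z → f y z + g y z)) ≡ ∑ verts (λ y → ∑ verts (f y)) + ∑ verts (λ y → ∑ verts (g y))
                ∑∑-+ f g = trans (∑-cong verts (λ y → ∑-+ verts (f y) (g y))) (∑-+ verts _ _)
        conclude : ∃[ x ] (x ∈ verts × U' x ≡ true × (∀ y → y ∈ verts → U' y ≡ true → # (nbr U' y) ≤ # (nbr U' x)))
                   ⊎ (∀ x → x ∈ verts → U' x ≡ false) → Goal
        conclude (inj₂ none) = finish (λ _ → false) (λ _ → 0) (λ _ ()) (λ _ → s≤s z≤n)
          (λ y q → ⊥-elim (true≢false q (none y (∈-allFin y))))
          (≤-trans (≤-reflexive (trans (cong ((1 + ρ) * L *_) (trans (∑-cong verts (λ _ → ∑-zero verts)) (∑-zero verts)))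
            (*-zeroʳ ((1 + ρ) * L)))) z≤n)
        conclude (inj₁ (x , _ , U'x , best)) =
          let col' , col'< , IH = stable ρ (nbr U' x) (≤-trans (*-monoˡ-≤ B (hom-mono (2 + ρ) nbr⊆)) (≤ᵇ-true (proj₂ (∧-true {U x} U'x))))
          in finish (nbr U' x) col' (λ y q → proj₁ (∧-true {U' y} q)) col'< (λ y → best y (∈-allFin y)) IH
          where
            nbr⊆ : ∀ y → nbr U' x y ≡ true → nbr U x y ≡ true
            nbr⊆ y q = let s , t = ∧-true {U' y} q in ∧-intro (proj₁ (∧-true {U y} s)) t

-- Decision trees

-- Binomial coefficients by Pascal's rule, since this is how a query splits a count: a yes lowers
-- both arguments, a no only the first.
bin : ℕ → ℕ → ℕ
bin n       zero    = 1
bin zero    (suc k) = 0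
bin (suc n) (suc k) = bin n k + bin n (suc k)

bin-step : ∀ n k → bin n k ≤ bin (suc n) k
bin-step n zero    = ≤-refl
bin-step n (suc k) = m≤n+m _ _

bin-mono : ∀ {n n'} k → n ≤ n' → bin n k ≤ bin n' k
bin-mono {n} {n'} k le with m≤n⇒∃[o]m+o≡n le
... | o , refl = go o
  where go : ∀ o → bin n k ≤ bin (n + o) k
        go zero    = ≤-reflexive (cong (λ x → bin x k) (sym (+-identityʳ n)))
        go (suc o) = ≤-trans (go o) (≤-trans (bin-step (n + o) k) (≤-reflexive (cong (λ x → bin x k) (sym (+-suc n o)))))

filterᵇ-unique : ∀ (p : A → Bool) {xs : List A} → Unique xs → Unique (filterᵇ p xs)
filterᵇ-unique p = Unique.filter⁺ (T? ∘ p)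

all-equal : ∀ {xs : List A} → Unique xs → (∀ {x y} → x ∈ xs → y ∈ xs → x ≡ y) → length xs ≤ 1
all-equal {xs = []} _ _ = z≤n
all-equal {xs = x ∷ []} _ _ = ≤-refl
all-equal {xs = x ∷ y ∷ xs} ((x≢y ∷ _) ∷ _) eq = ⊥-elim (x≢y (eq (here refl) (there (here refl))))

none-in : ∀ (xs : List A) → (∀ {x} → x ∈ xs → ⊥) → length xs ≡ 0
none-in []      _ = refl
none-in (x ∷ _) f = ⊥-elim (f (here refl))

module Remove {V : Set} (_≟_ : DecidableEquality V) where

  remove : (V → Bool) → V → V → Bool
  remove u v w = u w ∧ not (does (w ≟ v))

  remove-false : ∀ u v w → remove u v w ≡ false → w ≡ v ⊎ u w ≡ false
  remove-false u v w e with w ≟ v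
  ... | yes p = inj₁ p
  ... | no _ with u w
  ...   | false = inj₂ refl

  remove-self : ∀ u v → remove u v v ≡ false
  remove-self u v rewrite does-true (v ≟ v) refl with u v
  ... | true  = refl
  ... | false = refl

  remove-other : ∀ u v w → w ≢ v → remove u v w ≡ u w
  remove-other u v w w≢v rewrite does-false (w ≟ v) w≢v with u w
  ... | true  = refl
  ... | false = refl

  remove-⊆ : ∀ u v w → remove u v w ≡ true → u w ≡ true
  remove-⊆ u v w e = proj₁ (∧-true {u w} e)

  ∑-remove : ∀ (u : V → Bool) {v} (f : V → ℕ) (Ed : List V) → Unique Ed → v ∈ Ed → u v ≡ true →
             ∑ Ed (λ w → 𝟙 (u w) * f w) ≡ f v + ∑ Ed (λ w → 𝟙 (remove u v w) * f w)
  ∑-remove u {v} f (x ∷ Ed) (x≢ ∷ _) (here refl) uv rewrite uv | does-true (v ≟ v) refl =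
    cong₂ _+_ (+-identityʳ (f v)) (∑-cong∈ Ed λ w w∈ →
      cong (λ b → 𝟙 b * f w) (sym (remove-other u v w (λ e → All.lookup x≢ w∈ (sym e)))))
  ∑-remove u {v} f (x ∷ Ed) (x≢ ∷ uq) (there v∈) uv =
    trans (cong₂ _+_ (cong (λ b → 𝟙 b * f x) (sym (remove-other u v x (All.lookup x≢ v∈)))) (∑-remove u f Ed uq v∈ uv))
          (lem (𝟙 (remove u v x) * f x) (f v) _)
    where lem : ∀ a b c → a + (b + c) ≡ b + (a + c)
          lem = solve-∀

module Counting {V : Set} (_≟_ : DecidableEquality V) (Ed : List V) (Ed-unique : Unique Ed)
                {Γ : Set} (on : Γ → V → Bool) where
  open Remove _≟_ public

  size : (V → Bool) → ℕ
  size u = ∑ Ed (λ v → 𝟙 (u v))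

  size-remove : ∀ u {v} → v ∈ Ed → u v ≡ true → size u ≡ suc (size (remove u v))
  size-remove u v∈ uv = trans (∑-cong Ed (λ w → sym (*-identityʳ _)))
    (trans (∑-remove u (λ _ → 1) Ed Ed-unique v∈ uv) (cong suc (∑-cong Ed (λ w → *-identityʳ _))))

  -- The state of a decision tree on the edges: xs is a list of graphs that agree on the decided edges
  -- (those with u = false); each of them has m undecided edges, at least d of which are monochromatic.
  record State {Col : Set} (mono : Col → V → Bool) (xs : List Γ) (u : V → Bool) (m d : ℕ) : Set where
    field
      unique : Unique xs
      ext    : ∀ {G G'} → G ∈ xs → G' ∈ xs → (∀ v → v ∈ Ed → on G v ≡ on G' v) → G ≡ G'
      agree  : ∀ {G G'} → G ∈ xs → G' ∈ xs → ∀ v → v ∈ Ed → u v ≡ false → on G v ≡ on G' v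
      edges  : ∀ {G} → G ∈ xs → ∑ Ed (λ v → 𝟙 (u v) * 𝟙 (on G v)) ≡ m
      monos  : ∀ {G} → G ∈ xs → ∀ c → d ≤ ∑ Ed (λ v → 𝟙 (u v) * (𝟙 (on G v) * 𝟙 (mono c v)))
  open State public

  yeses noes : V → List Γ → List Γ
  yeses v xs = filterᵇ (λ G → on G v) xs
  noes  v xs = filterᵇ (λ G → not (on G v)) xs

  length-yeses-noes : ∀ v xs → length xs ≡ length (yeses v xs) + length (noes v xs)
  length-yeses-noes v xs = length-split (λ G → on G v) xs

  not-true : ∀ {b} → not b ≡ true → b ≡ false
  not-true {false} _ = refl

  module _ {Col : Set} {mono : Col → V → Bool} {xs : List Γ} {u : V → Bool} {m d : ℕ}
           {v : V} (v∈ : v ∈ Ed) (uv : u v ≡ true) where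

    yes∈ : ∀ {G} → G ∈ yeses v xs → G ∈ xs × on G v ≡ true
    yes∈ = ∈-filterᵇ⁻ (λ G → on G v) xs

    no∈ : ∀ {G} → G ∈ noes v xs → G ∈ xs × on G v ≡ false
    no∈ G∈ = let a , b = ∈-filterᵇ⁻ (λ G → not (on G v)) xs G∈ in a , not-true b

    private
      agree' : ∀ {b G G'} → State mono xs u m d → G ∈ xs × on G v ≡ b → G' ∈ xs × on G' v ≡ b →
               ∀ w → w ∈ Ed → remove u v w ≡ false → on G w ≡ on G' w
      agree' st (G∈ , p) (G'∈ , p') w w∈ e with remove-false u v w e
      ... | inj₁ refl = trans p (sym p')
      ... | inj₂ uw   = agree st G∈ G'∈ w w∈ uw

    answer-no : State mono xs u m d → State mono (noes v xs) (remove u v) m d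
    answer-no st = record
      { unique = filterᵇ-unique _ (unique st)
      ; ext    = λ p q → ext st (proj₁ (no∈ p)) (proj₁ (no∈ q))
      ; agree  = λ p q → agree' st (no∈ p) (no∈ q)
      ; edges  = λ {G} p → trans (sym (trans (∑-remove u (λ w → 𝟙 (on G w)) Ed Ed-unique v∈ uv)
                   (cong (λ b → 𝟙 b + ∑ Ed (λ w → 𝟙 (remove u v w) * 𝟙 (on G w))) (proj₂ (no∈ p))))) (edges st (proj₁ (no∈ p)))
      ; monos  = λ {G} p c → ≤-trans (monos st (proj₁ (no∈ p)) c)
                   (≤-reflexive (trans (∑-remove u (λ w → 𝟙 (on G w) * 𝟙 (mono c w)) Ed Ed-unique v∈ uv)
                   (cong (λ b → 𝟙 b * 𝟙 (mono c v) + ∑ Ed (λ w → 𝟙 (remove u v w) * (𝟙 (on G w) * 𝟙 (mono c w)))) (proj₂ (no∈ p)))))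
      }

    yes-edges : State mono xs u m d → ∀ {G} → G ∈ yeses v xs → suc (∑ Ed (λ w → 𝟙 (remove u v w) * 𝟙 (on G w))) ≡ m
    yes-edges st {G} p = trans (sym (trans (∑-remove u (λ w → 𝟙 (on G w)) Ed Ed-unique v∈ uv)
                   (cong (λ b → 𝟙 b + ∑ Ed (λ w → 𝟙 (remove u v w) * 𝟙 (on G w))) (proj₂ (yes∈ p))))) (edges st (proj₁ (yes∈ p)))

    no-yeses : State mono xs u m d → m ≡ 0 → length (yeses v xs) ≡ 0
    no-yeses st m≡0 = none-in (yeses v xs) λ p → 1+n≢0 (trans (yes-edges st p) m≡0)

    answer-yes : ∀ {m' d'} → m ≡ suc m' → (∀ c → d' ≤ d ∸ 𝟙 (mono c v)) → State mono xs u m d →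
                 State mono (yeses v xs) (remove u v) m' d'
    answer-yes {m'} {d'} eq d≤ st = record
      { unique = filterᵇ-unique _ (unique st)
      ; ext    = λ p q → ext st (proj₁ (yes∈ p)) (proj₁ (yes∈ q))
      ; agree  = λ p q → agree' st (yes∈ p) (yes∈ q)
      ; edges  = λ p → suc-injective (trans (yes-edges st p) eq)
      ; monos  = λ {G} p c → ≤-trans (d≤ c) (m≤n+o⇒m∸n≤o d (𝟙 (mono c v)) (≤-trans (monos st (proj₁ (yes∈ p)) c)
                   (≤-reflexive (trans (∑-remove u (λ w → 𝟙 (on G w) * 𝟙 (mono c w)) Ed Ed-unique v∈ uv)
                   (cong (_+ ∑ Ed (λ w → 𝟙 (remove u v w) * (𝟙 (on G w) * 𝟙 (mono c w))))
                     (trans (cong (λ b → 𝟙 b * 𝟙 (mono c v)) (proj₂ (yes∈ p))) (+-identityʳ _)))))))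
      }

  weightSum : (V → Bool) → (V → Bool) → ℕ
  weightSum mono u = ∑ Ed (λ v → 𝟙 (u v) * (1 + 𝟙 (mono v)))

  weightSum-remove : ∀ mono u {v} → v ∈ Ed → u v ≡ true → weightSum mono u ≡ suc (𝟙 (mono v) + weightSum mono (remove u v))
  weightSum-remove mono u v∈ uv = ∑-remove u (λ v → 1 + 𝟙 (mono v)) Ed Ed-unique v∈ uv

  double : ∀ y d → y * 2 ^ d ≤ 2 * (y * 2 ^ (d ∸ 1))
  double y zero    = m≤m+n _ _
  double y (suc d) = ≤-reflexive (lem y (2 ^ d))
    where lem : ∀ y p → y * (2 * p) ≡ 2 * (y * p)
          lem = solve-∀

  private
    empty-yes : ∀ y n d {x w} → x ≡ y + n → y ≡ 0 → n * 2 ^ d ≤ bin w 0 → x * 2 ^ d ≤ 1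
    empty-yes y n d refl refl p = p

  -- Each monochromatic edge of G contributes a factor 2, and 1 + 2z ≤ (1 + z)² coefficientwise: so a colour
  -- class edge counts as two ordinary ones.
  few-graphs : ∀ k {mono : V → Bool} {xs u m d} → size u ≡ k → State {⊤} (λ _ → mono) xs u m d →
               length xs * 2 ^ d ≤ bin (weightSum mono u) m
  few-graphs k {mono} {xs} {u} {m} {d} sz st with findᵇ u Ed
  ... | inj₂ none = base xs refl
    where
      zero-sum : ∀ (f : V → ℕ) → ∑ Ed (λ v → 𝟙 (u v) * f v) ≡ 0
      zero-sum f = trans (∑-cong∈ Ed (λ v v∈ → cong (λ b → 𝟙 b * f v) (none v v∈))) (∑-zero Ed)
      ≤1 : length xs ≤ 1
      ≤1 = all-equal (unique st) λ p q → ext st p q (λ v v∈ → agree st p q v v∈ (none v v∈))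
      base : ∀ ys → ys ≡ xs → length ys * 2 ^ d ≤ bin (weightSum mono u) m
      base []       _    = z≤n
      base (G ∷ ys) refl = ≤-trans (*-mono-≤ ≤1 (^-monoʳ-≤ 2 (≤-trans (monos st (here refl) tt) (≤-reflexive (zero-sum _)))))
        (≤-reflexive (cong (bin (weightSum mono u)) (trans (sym (zero-sum (λ v → 𝟙 (on G v)))) (edges st (here refl)))))
  few-graphs zero {u = u} sz st | inj₁ (v , v∈ , uv) = ⊥-elim (1+n≢0 (trans (sym (size-remove u v∈ uv)) sz))
  few-graphs (suc k) {mono} {xs} {u} {m} {d} sz st | inj₁ (v , v∈ , uv) = answer m refl (mono v) refl
    where
      open ≤-Reasoning
      W' = weightSum mono (remove u v)
      sz' : size (remove u v) ≡ k
      sz' = suc-injective (trans (sym (size-remove u v∈ uv)) sz)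
      W≡ : ∀ {b} → mono v ≡ b → weightSum mono u ≡ suc (𝟙 b + W')
      W≡ e = trans (weightSum-remove mono u v∈ uv) (cong (λ b → suc (𝟙 b + W')) e)
      answer : ∀ m' → m ≡ m' → ∀ b → mono v ≡ b → length xs * 2 ^ d ≤ bin (weightSum mono u) m
      answer zero refl b _ = empty-yes (length (yeses v xs)) (length (noes v xs)) d {w = W'} (length-yeses-noes v xs) (no-yeses v∈ uv st refl)
        (few-graphs k sz' (answer-no v∈ uv st))
      answer (suc m') refl false e = begin
        length xs * 2 ^ d
          ≡⟨ trans (cong (_* 2 ^ d) (length-yeses-noes v xs)) (*-distribʳ-+ (2 ^ d) (length (yeses v xs)) (length (noes v xs))) ⟩
        length (yeses v xs) * 2 ^ d + length (noes v xs) * 2 ^ d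
          ≤⟨ +-mono-≤ (few-graphs k sz' (answer-yes v∈ uv refl (λ _ → ≤-reflexive (cong (λ b → d ∸ 𝟙 b) (sym e))) st)) (few-graphs k sz' (answer-no v∈ uv st)) ⟩
        bin W' m' + bin W' (suc m')
          ≡⟨ cong (λ w → bin w (suc m')) (sym (W≡ e)) ⟩
        bin (weightSum mono u) (suc m') ∎
      answer (suc m') refl true e = begin
        length xs * 2 ^ d
          ≡⟨ trans (cong (_* 2 ^ d) (length-yeses-noes v xs)) (*-distribʳ-+ (2 ^ d) (length (yeses v xs)) (length (noes v xs))) ⟩
        length (yeses v xs) * 2 ^ d + length (noes v xs) * 2 ^ d
          ≤⟨ +-monoˡ-≤ _ (double (length (yeses v xs)) d) ⟩
        2 * (length (yeses v xs) * 2 ^ (d ∸ 1)) + length (noes v xs) * 2 ^ d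
          ≤⟨ +-mono-≤ (*-monoʳ-≤ 2 (few-graphs k sz' (answer-yes v∈ uv refl (λ _ → ≤-reflexive (cong (λ b → d ∸ 𝟙 b) (sym e))) st))) (few-graphs k sz' (answer-no v∈ uv st)) ⟩
        2 * bin W' m' + bin W' (suc m')
          ≡⟨ lem (bin W' m') (bin W' (suc m')) ⟩
        bin W' m' + (bin W' m' + bin W' (suc m'))
          ≤⟨ +-monoˡ-≤ _ (bin-step W' m') ⟩
        bin (suc W') m' + bin (suc W') (suc m')
          ≡⟨ cong (λ w → bin w (suc m')) (sym (W≡ e)) ⟩
        bin (weightSum mono u) (suc m') ∎
        where lem : ∀ a b → 2 * a + b ≡ a + (a + b)
              lem = solve-∀

  -- The decision tree as a lower bound: every completion of the decided part `σ` with `m` undecided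
  -- edges occurs in `ys`, and this property passes to both answers of a query.
  many-graphs : ∀ k (ys : List Γ) (σ u : V → Bool) m → size u ≡ k →
    (∀ (τ : V → Bool) → (∀ v → v ∈ Ed → u v ≡ false → τ v ≡ σ v) → ∑ Ed (λ v → 𝟙 (u v) * 𝟙 (τ v)) ≡ m →
           ∃[ G ] (G ∈ ys × (∀ v → v ∈ Ed → on G v ≡ τ v))) →
    bin k m ≤ length ys
  many-graphs zero ys σ u (suc m) sz build = z≤n
  many-graphs zero ys σ u zero sz build with build σ (λ _ _ _ → refl) (n≤0⇒n≡0 (≤-trans (∑-mono Ed (λ v →
      ≤-trans (*-monoʳ-≤ (𝟙 (u v)) (𝟙≤1 (σ v))) (≤-reflexive (*-identityʳ _)))) (≤-reflexive sz)))
  ... | G , here _  , _ = s≤s z≤n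
  ... | G , there _ , _ = s≤s z≤n
  many-graphs (suc k) ys σ u m sz build with findᵇ u Ed
  ... | inj₂ none = ⊥-elim (1+n≢0 (trans (sym sz) (trans (∑-cong∈ Ed (λ v v∈ → cong 𝟙 (none v v∈))) (∑-zero Ed))))
  ... | inj₁ (v , v∈ , uv) = answer m refl
    where
      open ≤-Reasoning
      u' = remove u v
      sz' : size u' ≡ k
      sz' = suc-injective (trans (sym (size-remove u v∈ uv)) sz)
      set : Bool → V → Bool
      set b w = if does (w ≟ v) then b else σ w
      set-self : ∀ b → set b v ≡ b
      set-self b rewrite does-true (v ≟ v) refl = refl
      set-other : ∀ b w → w ≢ v → set b w ≡ σ w
      set-other b w w≢v rewrite does-false (w ≟ v) w≢v = refl
      module _ (b : Bool) (τ : V → Bool) (agrees : ∀ w → w ∈ Ed → u' w ≡ false → τ w ≡ set b w) where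
        τv : τ v ≡ b
        τv = trans (agrees v v∈ (remove-self u v)) (set-self b)
        agrees-σ : ∀ w → w ∈ Ed → u w ≡ false → τ w ≡ σ w
        agrees-σ w w∈ uw = trans (agrees w w∈ (trans (remove-other u v w w≢v) uw)) (set-other b w w≢v)
          where w≢v : w ≢ v
                w≢v refl = true≢false uv uw
        count : ∑ Ed (λ w → 𝟙 (u w) * 𝟙 (τ w)) ≡ 𝟙 b + ∑ Ed (λ w → 𝟙 (u' w) * 𝟙 (τ w))
        count = trans (∑-remove u (𝟙 ∘ τ) Ed Ed-unique v∈ uv) (cong (λ b → 𝟙 b + _) τv)
      noes-build : ∀ (τ : V → Bool) → (∀ w → w ∈ Ed → u' w ≡ false → τ w ≡ set false w) → ∑ Ed (λ w → 𝟙 (u' w) * 𝟙 (τ w)) ≡ m →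
                   ∃[ G ] (G ∈ noes v ys × (∀ w → w ∈ Ed → on G w ≡ τ w))
      noes-build τ ag sum≡ = let G , G∈ , eq = build τ (agrees-σ false τ ag) (trans (count false τ ag) sum≡) in
        G , ∈-filterᵇ⁺ _ ys G∈ (cong not (trans (eq v v∈) (τv false τ ag))) , eq
      answer : ∀ m' → m ≡ m' → bin (suc k) m ≤ length ys
      answer zero refl = begin
        bin k 0                  ≤⟨ many-graphs k (noes v ys) (set false) u' 0 sz' noes-build ⟩
        length (noes v ys)       ≤⟨ m≤n+m _ _ ⟩
        length (yeses v ys) + length (noes v ys) ≡⟨ sym (length-yeses-noes v ys) ⟩
        length ys ∎
      answer (suc m') refl = begin
        bin k m' + bin k (suc m') ≤⟨ +-mono-≤ (many-graphs k (yeses v ys) (set true) u' m' sz' yeses-build)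
                                              (many-graphs k (noes v ys) (set false) u' (suc m') sz' noes-build) ⟩
        length (yeses v ys) + length (noes v ys) ≡⟨ sym (length-yeses-noes v ys) ⟩
        length ys ∎
        where
          yeses-build : ∀ (τ : V → Bool) → (∀ w → w ∈ Ed → u' w ≡ false → τ w ≡ set true w) → ∑ Ed (λ w → 𝟙 (u' w) * 𝟙 (τ w)) ≡ m' →
                        ∃[ G ] (G ∈ yeses v ys × (∀ w → w ∈ Ed → on G w ≡ τ w))
          yeses-build τ ag sum≡ = let G , G∈ , eq = build τ (agrees-σ true τ ag) (trans (count true τ ag) (cong suc sum≡)) in
            G , ∈-filterᵇ⁺ _ ys G∈ (trans (eq v v∈) (τv true τ ag)) , eq

-- Containers

subs : List A → List (List A)
subs []       = [] ∷ []
subs (x ∷ xs) = subs xs ++ map (x ∷_) (subs xs)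

⊆⇒∈-subs : ∀ {xs ys : List A} → xs ⊆ ys → xs ∈ subs ys
⊆⇒∈-subs []       = here refl
⊆⇒∈-subs (y ∷ʳ p) = ∈-++⁺ˡ (⊆⇒∈-subs p)
⊆⇒∈-subs {ys = y ∷ ys} (refl ∷ p) = ∈-++⁺ʳ (subs ys) (∈-map⁺ (y ∷_) (⊆⇒∈-subs p))

∈-subs⇒⊆ : ∀ {xs : List A} ys → xs ∈ subs ys → xs ⊆ ys
∈-subs⇒⊆ [] (here refl) = []
∈-subs⇒⊆ (y ∷ ys) p with ∈-++⁻ (subs ys) p
... | inj₁ q = y ∷ʳ ∈-subs⇒⊆ ys q
... | inj₂ q with ∈-map⁻ (y ∷_) q
...   | zs , zs∈ , refl = refl ∷ ∈-subs⇒⊆ ys zs∈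

length-subs : ∀ (xs : List A) → length (subs xs) ≡ 2 ^ length xs
length-subs []       = refl
length-subs (x ∷ xs) = trans (length-++ (subs xs)) (cong₂ _+_ (length-subs xs)
  (trans (length-map (x ∷_) (subs xs)) (trans (length-subs xs) (sym (+-identityʳ _)))))

-- budget M u s m = Σ_{j ≤ s} C(u,j) 2^j C(M,m-j): at most s of the u undecided edges are answered yes
-- before the leaf, where C(M,-) bounds the number of remaining graphs.
budget : ℕ → ℕ → ℕ → ℕ → ℕ
budget M zero    s       m       = bin M m
budget M (suc u) zero    m       = bin M m
budget M (suc u) (suc s) zero    = budget M u (suc s) zero
budget M (suc u) (suc s) (suc m) = budget M u (suc s) (suc m) + 2 * budget M u s m

bin≤budget : ∀ M u s m → bin M m ≤ budget M u s m
bin≤budget M zero    s       m       = ≤-refl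
bin≤budget M (suc u) zero    m       = ≤-refl
bin≤budget M (suc u) (suc s) zero    = bin≤budget M u (suc s) zero
bin≤budget M (suc u) (suc s) (suc m) = ≤-trans (bin≤budget M u (suc s) (suc m)) (m≤m+n _ _)

budget-suc : ∀ M u s m → budget M u s m ≤ budget M u (suc s) m
budget-suc M zero    s       m       = ≤-refl
budget-suc M (suc u) zero    zero    = bin≤budget M u 1 zero
budget-suc M (suc u) zero    (suc m) = ≤-trans (bin≤budget M u 1 (suc m)) (m≤m+n _ _)
budget-suc M (suc u) (suc s) zero    = budget-suc M u (suc s) zero
budget-suc M (suc u) (suc s) (suc m) = +-mono-≤ (budget-suc M u (suc s) (suc m)) (*-monoʳ-≤ 2 (budget-suc M u s m))

budget-mono : ∀ M u m {s s'} → s ≤ s' → budget M u s m ≤ budget M u s' m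
budget-mono M u m {s} le with m≤n⇒∃[o]m+o≡n le
... | o , refl = go o
  where go : ∀ o → budget M u s m ≤ budget M u (s + o) m
        go zero    = ≤-reflexive (cong (λ s → budget M u s m) (sym (+-identityʳ s)))
        go (suc o) = ≤-trans (go o) (≤-trans (budget-suc M u (s + o) m)
          (≤-reflexive (cong (λ s → budget M u s m) (sym (+-suc s o)))))

-- The hyperedges are the `x : X`, with `coord e x` as the vertex at position `e`. Labelled
-- positions make the hypergraph ℓ-partite, so that linking always strips the first remaining label.
-- `N` will be n², `b` limits the yes answers per linking step, and `N * P` is the scale for the
-- number of hyperedges.
module Container {V : Set} (_≟_ : DecidableEquality V) (Ed : List V) (Ed-unique : Unique Ed)
                 {Γ : Set} (on : Γ → V → Bool) {Col : Set} (mono : Col → V → Bool)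
                 {X Lab : Set} (coord : Lab → X → V)
                 (M b N K P ℓ a₀ : ℕ) {{b≢0 : NonZero b}} {{_ : NonZero N}} {{_ : NonZero K}} {{_ : NonZero P}}
                 {{a₀≢0 : NonZero a₀}} (Ed≤N : length Ed ≤ N) where
  open Counting _≟_ Ed Ed-unique on public

  match : List Lab → X → X → Bool
  match []      x y = true
  match (e ∷ J) x y = does (coord e x ≟ coord e y) ∧ match J x y

  match-elim : ∀ J {x y} → match J x y ≡ true → ∀ e → e ∈ J → coord e x ≡ coord e y
  match-elim (e ∷ J) {x} {y} p .e (here refl) = from-does (coord e x ≟ coord e y) (proj₁ (∧-true {does (coord e x ≟ coord e y)} p))
  match-elim (e ∷ J) {x} {y} p e' (there e'∈) = match-elim J (proj₂ (∧-true {does (coord e x ≟ coord e y)} p)) e' e'∈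

  match-sym : ∀ J {x y} → match J x y ≡ true → match J y x ≡ true
  match-sym []      p = refl
  match-sym (e ∷ J) {x} {y} p = let q , r = ∧-true {does (coord e x ≟ coord e y)} p in
    ∧-intro (does-true (coord e y ≟ coord e x) (sym (from-does (coord e x ≟ coord e y) q))) (match-sym J r)

  match-trans : ∀ J {x y z} → match J x y ≡ true → match J y z ≡ true → match J x z ≡ true
  match-trans []      p p' = refl
  match-trans (e ∷ J) {x} {y} {z} p p' =
    let q , r = ∧-true {does (coord e x ≟ coord e y)} p ; q' , r' = ∧-true {does (coord e y ≟ coord e z)} p' in
    ∧-intro (does-true (coord e x ≟ coord e z) (trans (from-does (coord e x ≟ coord e y) q) (from-does (coord e y ≟ coord e z) q')))
            (match-trans J r r')

  degree : List Lab → List X → X → ℕ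
  degree J A y = ∑ A (λ x → 𝟙 (match J x y))

  degree-cong : ∀ J A {x y} → match J x y ≡ true → degree J A y ≤ degree J A x
  degree-cong J A p = ∑-mono A (λ z → 𝟙-mono (λ q → match-trans J q (match-sym J p)))

  cap : ℕ → ℕ → ℕ
  cap c j = 2 ^ c * K * b ^ (j + c) * P

  -- The hypergraph after c linking steps: with δ = b / N, codegrees of j-sets are at most
  -- 2^c K δ^(j-1+c) P, and the number of hyperedges is at least δ^c N P / a c.
  Spread : ℕ → List Lab → List X → Set
  Spread c es A = ∀ t J y → (t ∷ J) ⊆ es → degree (t ∷ J) A y * N ^ (length J + c) ≤ cap c (length J)

  -- The size lost in one linking step. At most 2^ℓ codegrees can be saturated, and with this `R`
  -- the hyperedges discarded on their account are at most a quarter.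
  R : ℕ
  R = 4 * 2 ^ ℓ

  a : ℕ → ℕ
  a c = a₀ * R ^ c

  instance
    R≢0 : NonZero R
    R≢0 = m*n≢0 4 (2 ^ ℓ) {{_}} {{m^n≢0 2 ℓ}}

    a≢0 : ∀ {c} → NonZero (a c)
    a≢0 {c} = m*n≢0 a₀ (R ^ c) {{a₀≢0}} {{m^n≢0 R c}}

  Large : ℕ → List X → Set
  Large c A = b ^ c * N * P ≤ length A * N ^ c * a c

  Independent : List Lab → List X → List Γ → Set
  Independent es A xs = ∀ {x G} → x ∈ A → G ∈ xs → (∀ e → e ∈ es → on G (coord e x) ≡ true) → ⊥

  -- A round that runs out of heavy edges has decided at least N / `gain` edges.
  gain : ℕ
  gain = 2 ^ ℓ * K * (4 * a ℓ)

  module Level (c : ℕ) (e : Lab) (es : List Lab) (A : List X) (c<ℓ : suc (length es) + c ≡ ℓ)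
               (spread : Spread c (e ∷ es) A) (large : Large c A) where

    -- The bound `cap c (suc j)` is half of `cap (suc c) j`. A codegree in `B` below it can absorb
    -- one more link, which adds at most the other half.
    unsaturated : List Lab → List X → X → Bool
    unsaturated []      B x = true
    unsaturated (t ∷ J) B x = degree (t ∷ J) B x * N ^ (suc (length J) + c) <ᵇ cap c (suc (length J))

    free : List X → X → Bool
    free B x = ∑ (subs es) (λ J → 𝟙 (not (unsaturated J B x))) ≡ᵇ 0

    free-elim : ∀ B x → free B x ≡ true → ∀ {J} → J ⊆ es → unsaturated J B x ≡ true
    free-elim B x p {J} J⊆ with unsaturated J B x in eq
    ... | true  = refl
    ... | false = ⊥-elim (<-irrefl refl (≤-trans (≤-reflexive (cong (λ b → 𝟙 (not b)) (sym eq)))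
          (≤-trans (∑-∈-≤ (λ J → 𝟙 (not (unsaturated J B x))) (⊆⇒∈-subs J⊆)) (≤-reflexive (≡ᵇ-true p)))))

    not-free : ∀ B x → 𝟙 (not (free B x)) ≤ ∑ (subs es) (λ J → 𝟙 (not (unsaturated J B x)))
    not-free B x with ∑ (subs es) (λ J → 𝟙 (not (unsaturated J B x)))
    ... | zero  = z≤n
    ... | suc _ = s≤s z≤n

    -- Count the pairs in A × B that agree on `t ∷ J`. After scaling, a saturated `x` lies in at
    -- least `cap c (suc j)` of them and each member of `B` in at most `N * cap c j`; the two caps
    -- differ by the factor b.
    few-saturated : ∀ B J → J ⊆ es → ∑ A (λ x → 𝟙 (not (unsaturated J B x))) * b ≤ N * length B
    few-saturated B []      _  = ≤-trans (≤-reflexive (cong (_* b) (∑-zero A))) z≤n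
    few-saturated B (t ∷ J) J⊆ = *-cancelʳ-≤ _ _ (cap c j) {{cap≢0}} (begin
      S * b * cap c j
        ≡⟨ lem₁ S b (2 ^ c * K) (b ^ (j + c)) P ⟩
      S * cap c (suc j)
        ≡⟨ sym (∑-*ʳ A (cap c (suc j)) (λ x → 𝟙 (not (unsaturated (t ∷ J) B x)))) ⟩
      ∑ A (λ x → 𝟙 (not (unsaturated (t ∷ J) B x)) * cap c (suc j))
        ≤⟨ ∑-mono A pointwise ⟩
      ∑ A (λ x → degree (t ∷ J) B x * N ^ (suc j + c))
        ≡⟨ ∑-*ʳ A (N ^ (suc j + c)) _ ⟩
      ∑ A (λ x → degree (t ∷ J) B x) * N ^ (suc j + c)
        ≤⟨ *-monoˡ-≤ (N ^ (suc j + c)) (≤-trans (≤-reflexive (∑-swap A B _))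
             (∑-mono B (λ y → ∑-mono A (λ x → 𝟙-mono (match-sym (t ∷ J)))))) ⟩
      ∑ B (λ y → degree (t ∷ J) A y) * N ^ (suc j + c)
        ≡⟨ lem₂ (∑ B (degree (t ∷ J) A)) N (N ^ (j + c)) ⟩
      N * (∑ B (λ y → degree (t ∷ J) A y) * N ^ (j + c))
        ≡⟨ cong (N *_) (sym (∑-*ʳ B (N ^ (j + c)) _)) ⟩
      N * ∑ B (λ y → degree (t ∷ J) A y * N ^ (j + c))
        ≤⟨ *-monoʳ-≤ N (∑-mono B (λ y → spread t J y (e ∷ʳ J⊆))) ⟩
      N * ∑ B (λ y → cap c j)
        ≡⟨ trans (cong (N *_) (∑-const B (cap c j))) (sym (*-assoc N (length B) (cap c j))) ⟩
      N * length B * cap c j ∎)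
      where
        open ≤-Reasoning
        j = length J
        S = ∑ A (λ x → 𝟙 (not (unsaturated (t ∷ J) B x)))
        lem₁ : ∀ s b k p q → s * b * (k * p * q) ≡ s * (k * (b * p) * q)
        lem₁ = solve-∀
        lem₂ : ∀ s n p → s * (n * p) ≡ n * (s * p)
        lem₂ = solve-∀
        cap≢0 : NonZero (cap c j)
        cap≢0 = m*n≢0 (2 ^ c * K * b ^ (j + c)) P
          {{m*n≢0 (2 ^ c * K) (b ^ (j + c)) {{m*n≢0 (2 ^ c) K {{m^n≢0 2 c}}}} {{m^n≢0 b (j + c)}}}}
        pointwise : ∀ x → 𝟙 (not (unsaturated (t ∷ J) B x)) * cap c (suc j) ≤ degree (t ∷ J) B x * N ^ (suc j + c)
        pointwise x with unsaturated (t ∷ J) B x in eq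
        ... | true  = z≤n
        ... | false = ≤-trans (≤-reflexive (+-identityʳ _)) (<ᵇ-false {degree (t ∷ J) B x * N ^ (suc j + c)} eq)

    few-deleted : ∀ B → ∑ A (λ x → 𝟙 (not (free B x))) * b ≤ 2 ^ length es * (N * length B)
    few-deleted B = begin
      ∑ A (λ x → 𝟙 (not (free B x))) * b
        ≤⟨ *-monoˡ-≤ b (≤-trans (∑-mono A (not-free B)) (≤-reflexive (∑-swap A (subs es) _))) ⟩
      ∑ (subs es) (λ J → ∑ A (λ x → 𝟙 (not (unsaturated J B x)))) * b
        ≡⟨ sym (∑-*ʳ (subs es) b _) ⟩
      ∑ (subs es) (λ J → ∑ A (λ x → 𝟙 (not (unsaturated J B x))) * b)
        ≤⟨ ∑-mono∈ (subs es) (λ J J∈ → few-saturated B J (∈-subs⇒⊆ es J∈)) ⟩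
      ∑ (subs es) (λ J → N * length B)
        ≡⟨ trans (∑-const (subs es) _) (cong (_* (N * length B)) (length-subs es)) ⟩
      2 ^ length es * (N * length B) ∎
      where open ≤-Reasoning

    link : List X → V → List X
    link B v = filterᵇ (λ x → free B x ∧ does (coord e x ≟ v)) A

    link∈ : ∀ B v {x} → x ∈ link B v → x ∈ A × free B x ≡ true × coord e x ≡ v
    link∈ B v {x} x∈ = let x∈A , p = ∈-filterᵇ⁻ (λ x → free B x ∧ does (coord e x ≟ v)) A x∈ ; q , r = ∧-true {free B x} p in
      x∈A , q , from-does (coord e x ≟ v) r

    link-cap : ∀ B v → length (link B v) * N ^ c ≤ cap c 0
    link-cap B v with 0 <? length (link B v)
    ... | no ¬p = ≤-trans (≤-reflexive (cong (_* N ^ c) (n≤0⇒n≡0 (≮⇒≥ ¬p)))) z≤n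
    ... | yes p with length-pos (link B v) p
    ...   | y , y∈ with link∈ B v y∈
    ...     | _ , _ , refl = ≤-trans (*-monoˡ-≤ (N ^ c) (≤-trans (≤-reflexive (length-filterᵇ (λ x → free B x ∧ does (coord e x ≟ v)) A))
              (∑-mono A (λ x → 𝟙-mono (λ q → ∧-intro (proj₂ (∧-true {free B x} q)) refl)))))
              (spread e [] y (refl ∷ minimum es))

    -- The threshold is a quarter of the average degree of an edge that `Large` guarantees.
    heavy : List X → V → Bool
    heavy B v = b ^ c * P <ᵇ length (link B v) * N ^ c * (4 * a c)

    target : List X → Bool
    target B = b ^ suc c * N * P ≤ᵇ length B * N ^ suc c * a (suc c)

    4≤R : 4 ≤ R
    4≤R = ≤-trans (≤-reflexive (sym (*-identityʳ 4))) (*-monoʳ-≤ 4 (m^n>0 2 ℓ))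

    -- Below its target, `B` has fewer than b |A| / (N R) members, while each member of `B`
    -- saturates at most 2^ℓ N / b members of `A`.
    deleted≤quarter : ∀ B → target B ≡ false → ∑ A (λ x → 𝟙 (not (free B x))) * 4 ≤ length A
    deleted≤quarter B ¬t = *-cancelˡ-≤ (2 ^ length es) {{m^n≢0 2 (length es)}} (begin
      2 ^ length es * (D * 4)
        ≤⟨ *-monoˡ-≤ (D * 4) (^-monoʳ-≤ 2 es≤ℓ) ⟩
      2 ^ ℓ * (D * 4)
        ≡⟨ lem₀ (2 ^ ℓ) D ⟩
      D * R
        ≤⟨ *-cancelʳ-≤ _ _ (b * (N ^ c * a c)) {{m*n≢0 b (N ^ c * a c) {{b≢0}} {{m*n≢0 (N ^ c) (a c) {{m^n≢0 N c}} {{a≢0 {c}}}}}}} main ⟩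
      2 ^ length es * length A ∎)
      where
        open ≤-Reasoning
        D = ∑ A (λ x → 𝟙 (not (free B x)))
        E = 2 ^ length es
        es≤ℓ : length es ≤ ℓ
        es≤ℓ = ≤-trans (n≤1+n _) (≤-trans (m≤m+n _ c) (≤-reflexive c<ℓ))
        lem₀ : ∀ p d → p * (d * 4) ≡ d * (4 * p)
        lem₀ = solve-∀
        lem₁ : ∀ d r b p a → d * r * (b * (p * (a))) ≡ d * b * (p * (a * r))
        lem₁ = solve-∀
        lem₂ : ∀ e n l p a₀ r q → e * (n * l) * (p * (a₀ * q * r)) ≡ e * (l * (n * p) * (a₀ * (r * q)))
        lem₂ = solve-∀
        lem₃ : ∀ e b bc n p → e * (b * bc * n * p) ≡ e * b * (bc * n * p)
        lem₃ = solve-∀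
        lem₄ : ∀ e b l p a → e * b * (l * p * a) ≡ e * l * (b * (p * a))
        lem₄ = solve-∀
        main : D * R * (b * (N ^ c * a c)) ≤ E * length A * (b * (N ^ c * a c))
        main = begin
          D * R * (b * (N ^ c * a c))                    ≡⟨ lem₁ D R b (N ^ c) (a c) ⟩
          D * b * (N ^ c * (a c * R))                    ≤⟨ *-monoˡ-≤ (N ^ c * (a c * R)) (few-deleted B) ⟩
          E * (N * length B) * (N ^ c * (a c * R))       ≡⟨ lem₂ E N (length B) (N ^ c) a₀ R (R ^ c) ⟩
          E * (length B * N ^ suc c * a (suc c))         ≤⟨ *-monoʳ-≤ E (<⇒≤ (≤ᵇ-false ¬t)) ⟩
          E * (b ^ suc c * N * P)                        ≡⟨ lem₃ E b (b ^ c) N P ⟩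
          E * b * (b ^ c * N * P)                        ≤⟨ *-monoʳ-≤ (E * b) large ⟩
          E * b * (length A * N ^ c * a c)               ≡⟨ lem₄ E b (length A) (N ^ c) (a c) ⟩
          E * length A * (b * (N ^ c * a c))             ∎

    -- Let G be the size guaranteed by `Large`. At least half of `A` is free, so the links contain G
    -- / 2 hyperedges; edges that are not heavy carry at most G / 4 of them, and a heavy one at most
    -- `cap c 0` up to scaling.
    many-heavy : (∀ x → x ∈ A → coord e x ∈ Ed) → ∀ B → target B ≡ false → N ≤ ∑ Ed (λ v → 𝟙 (heavy B v)) * (2 ^ c * K * (4 * a c))
    many-heavy A⊆ B ¬t = *-cancelʳ-≤ _ _ (b ^ c * P) {{m*n≢0 (b ^ c) P {{m^n≢0 b c}}}} (+-cancelʳ-≤ (N * (b ^ c * P)) _ _ (begin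
      N * (b ^ c * P) + N * (b ^ c * P)
        ≡⟨ lem₁ N (b ^ c) P ⟩
      2 * (b ^ c * N * P)
        ≤⟨ *-monoʳ-≤ 2 large ⟩
      2 * (length A * N ^ c * a c)
        ≡⟨ lem₂ (length A) (N ^ c) (a c) ⟩
      length A * (2 * (N ^ c * a c))
        ≤⟨ *-monoˡ-≤ (2 * (N ^ c * a c)) A≤2S ⟩
      2 * S * (2 * (N ^ c * a c))
        ≡⟨ lem₃ S (N ^ c) (a c) ⟩
      S * (N ^ c * (4 * a c))
        ≡⟨ sym (∑-*ʳ Ed (N ^ c * (4 * a c)) _) ⟩
      ∑ Ed (λ v → length (link B v) * (N ^ c * (4 * a c)))
        ≤⟨ ∑-mono Ed pointwise ⟩
      ∑ Ed (λ v → 𝟙 (heavy B v) * (cap c 0 * (4 * a c)) + b ^ c * P)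
        ≡⟨ trans (∑-+ Ed _ _) (cong₂ _+_ (∑-*ʳ Ed _ _) (∑-const Ed _)) ⟩
      H * (cap c 0 * (4 * a c)) + length Ed * (b ^ c * P)
        ≤⟨ +-monoʳ-≤ (H * (cap c 0 * (4 * a c))) (*-monoˡ-≤ (b ^ c * P) Ed≤N) ⟩
      H * (2 ^ c * K * b ^ c * P * (4 * a c)) + N * (b ^ c * P)
        ≡⟨ cong (_+ N * (b ^ c * P)) (lem₄ H (2 ^ c * K) (b ^ c) P (4 * a c)) ⟩
      H * (2 ^ c * K * (4 * a c)) * (b ^ c * P) + N * (b ^ c * P) ∎))
      where
        open ≤-Reasoning
        H = ∑ Ed (λ v → 𝟙 (heavy B v))
        S = ∑ Ed (λ v → length (link B v))
        D = ∑ A (λ x → 𝟙 (not (free B x)))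
        lem₁ : ∀ n b p → n * (b * p) + n * (b * p) ≡ 2 * (b * n * p)
        lem₁ = solve-∀
        lem₂ : ∀ l n a → 2 * (l * n * a) ≡ l * (2 * (n * a))
        lem₂ = solve-∀
        lem₃ : ∀ s n a → 2 * s * (2 * (n * a)) ≡ s * (n * (4 * a))
        lem₃ = solve-∀
        lem₄ : ∀ h k b p a → h * (k * b * p * a) ≡ h * (k * a) * (b * p)
        lem₄ = solve-∀
        kept≤S : ∑ A (λ x → 𝟙 (free B x)) ≤ S
        kept≤S = begin
          ∑ A (λ x → 𝟙 (free B x))
            ≤⟨ ∑-mono∈ A (λ x x∈ → ≤-trans (𝟙-mono {free B x} (λ p → ∧-intro p (does-true (coord e x ≟ coord e x) refl)))
                 (∑-∈-≤ (λ v → 𝟙 (free B x ∧ does (coord e x ≟ v))) (A⊆ x x∈))) ⟩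
          ∑ A (λ x → ∑ Ed (λ v → 𝟙 (free B x ∧ does (coord e x ≟ v))))
            ≡⟨ ∑-swap A Ed _ ⟩
          ∑ Ed (λ v → ∑ A (λ x → 𝟙 (free B x ∧ does (coord e x ≟ v))))
            ≡⟨ ∑-cong Ed (λ v → sym (length-filterᵇ _ A)) ⟩
          S ∎
        A≡ : length A ≡ ∑ A (λ x → 𝟙 (free B x)) + D
        A≡ = trans (length-∑ A) (trans (∑-cong A (λ x → sym (𝟙-not (free B x)))) (∑-+ A _ _))
        A≤2S : length A ≤ 2 * S
        A≤2S = *-cancelˡ-≤ 2 (+-cancelʳ-≤ (length A + length A) _ _ (begin
          2 * length A + (length A + length A)   ≡⟨ lem (length A) ⟩
          4 * length A                           ≤⟨ *-monoʳ-≤ 4 (≤-trans (≤-reflexive A≡) (+-monoˡ-≤ D kept≤S)) ⟩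
          4 * (S + D)                            ≡⟨ lem' S D ⟩
          2 * (2 * S) + D * 4                    ≤⟨ +-monoʳ-≤ (2 * (2 * S)) (≤-trans (deleted≤quarter B ¬t) (m≤m+n _ _)) ⟩
          2 * (2 * S) + (length A + length A)    ∎))
          where lem : ∀ x → 2 * x + (x + x) ≡ 4 * x
                lem = solve-∀
                lem' : ∀ s d → 4 * (s + d) ≡ 2 * (2 * s) + d * 4
                lem' = solve-∀
        pointwise : ∀ v → length (link B v) * (N ^ c * (4 * a c)) ≤ 𝟙 (heavy B v) * (cap c 0 * (4 * a c)) + b ^ c * P
        pointwise v with heavy B v in eq
        ... | false = ≤-trans (≤-reflexive (sym (*-assoc (length (link B v)) (N ^ c) (4 * a c)))) (<ᵇ-false {b ^ c * P} eq)
        ... | true  = begin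
          length (link B v) * (N ^ c * (4 * a c))   ≡⟨ sym (*-assoc (length (link B v)) (N ^ c) (4 * a c)) ⟩
          length (link B v) * N ^ c * (4 * a c)     ≤⟨ *-monoˡ-≤ (4 * a c) (link-cap B v) ⟩
          cap c 0 * (4 * a c)                       ≤⟨ ≤-trans (m≤m+n _ _) (m≤m+n _ _) ⟩
          1 * (cap c 0 * (4 * a c)) + b ^ c * P     ∎

    -- A codegree grows only if some `x` in the link realises it. That `x` is free, so the codegree
    -- in `B` was below half of the new cap; the increase is at most the codegree in `A` with the
    -- edge at `e` adjoined, which `spread` bounds by the other half.
    spread-link : ∀ B v → Spread (suc c) es B → Spread (suc c) es (link B v ++ B)
    spread-link B v spreadB t J y J⊆ with findᵇ (λ x → match (t ∷ J) x y) (link B v)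
    ... | inj₂ none = ≤-trans (*-monoˡ-≤ (N ^ (length J + suc c)) (≤-reflexive (trans (∑-++ (link B v) B _)
          (cong (_+ degree (t ∷ J) B y) (trans (∑-cong∈ (link B v) (λ x x∈ → cong 𝟙 (none x x∈))) (∑-zero (link B v))))))) (spreadB t J y J⊆)
    ... | inj₁ (x , x∈ , x~y) with link∈ B v x∈
    ...   | x∈A , fr , refl = begin
      degree (t ∷ J) (link B v ++ B) y * N ^ (length J + suc c)
        ≡⟨ cong₂ _*_ (∑-++ (link B v) B _) (cong (N ^_) (+-suc (length J) c)) ⟩
      (degree (t ∷ J) (link B v) y + degree (t ∷ J) B y) * N ^ (suc (length J) + c)
        ≤⟨ *-monoˡ-≤ (N ^ (suc (length J) + c)) (+-mono-≤ linked (degree-cong (t ∷ J) B x~y)) ⟩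
      (degree (e ∷ t ∷ J) A x + degree (t ∷ J) B x) * N ^ (suc (length J) + c)
        ≡⟨ *-distribʳ-+ (N ^ (suc (length J) + c)) (degree (e ∷ t ∷ J) A x) _ ⟩
      degree (e ∷ t ∷ J) A x * N ^ (suc (length J) + c) + degree (t ∷ J) B x * N ^ (suc (length J) + c)
        ≤⟨ +-mono-≤ (spread e (t ∷ J) x (refl ∷ J⊆)) (<⇒≤ (<ᵇ-true (free-elim B x fr J⊆))) ⟩
      cap c (suc (length J)) + cap c (suc (length J))
        ≡⟨ lem (2 ^ c) K (b ^ (suc (length J) + c)) P ⟩
      2 ^ suc c * K * b ^ (suc (length J) + c) * P
        ≡⟨ cong (λ k → 2 ^ suc c * K * b ^ k * P) (sym (+-suc (length J) c)) ⟩
      cap (suc c) (length J) ∎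
      where
        open ≤-Reasoning
        lem : ∀ p k q r → p * k * q * r + p * k * q * r ≡ 2 * p * k * q * r
        lem = solve-∀
        linked : degree (t ∷ J) (link B v) y ≤ degree (e ∷ t ∷ J) A x
        linked = ≤-trans (≤-reflexive (∑-filter _ A _)) (∑-mono A (λ z → ≤-trans (≤-reflexive (sym (𝟙-∧ (free B z ∧ does (coord e z ≟ v)) _)))
          (𝟙-mono (λ p → let q , r = ∧-true {free B z ∧ does (coord e z ≟ v)} p in
            ∧-intro (proj₂ (∧-true {free B z} q)) (match-trans (t ∷ J) r (match-sym (t ∷ J) x~y))))))

  -- `u₀` holds the edges undecided at the start of the round. `continue` takes over when the round
  -- gets stuck, with `s` yes answers reserved for all later rounds.
  module Round (xs₀ : List Γ) (u₀ : V → Bool) (s : ℕ)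
               (continue : ∀ {xs u m d} → State mono xs u m d → (∀ {G} → G ∈ xs → G ∈ xs₀) →
                           N + gain * size u ≤ gain * size u₀ → length xs * 2 ^ d ≤ budget M (size u) s m) where

    Supported : List Lab → List X → Set
    Supported es A = ∀ {x} → x ∈ A → ∀ e → e ∈ es → coord e x ∈ Ed × u₀ (coord e x) ≡ true

    Bounded : List Lab → List X → Set
    Bounded es A = ∀ {xs u m d} → State mono xs u m d → (∀ {G} → G ∈ xs → G ∈ xs₀) → (∀ v → u v ≡ true → u₀ v ≡ true) →
      Independent es A xs → length xs * 2 ^ d ≤ budget M (size u) (length es * b + s) m

    module Step (c : ℕ) (e : Lab) (es : List Lab) (A : List X) (c<ℓ : suc (length es) + c ≡ ℓ)
                (supported : Supported (e ∷ es) A) (spread : Spread c (e ∷ es) A) (large : Large c A)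
                (next : ∀ B → Supported es B → Spread (suc c) es B → Large (suc c) B → Bounded es B) where
      open Level c e es A c<ℓ spread large

      S : ℕ
      S = length es * b + s

      -- Every heavy edge was undecided when the round began, as it occurs in a hyperedge of `A`,
      -- and none is undecided now. By `many-heavy` the round has decided enough edges.
      stuck : ∀ {xs u m d} k B → size u ≡ k → State mono xs u m d → (∀ {G} → G ∈ xs → G ∈ xs₀) → (∀ v → u v ≡ true → u₀ v ≡ true) →
              target B ≡ false → (∀ v → v ∈ Ed → u v ∧ heavy B v ≡ false) → length xs * 2 ^ d ≤ budget M k s m
      stuck {u = u} k B refl st sub u≤ ¬t none = continue st sub (begin
        N + gain * size u
          ≤⟨ +-monoˡ-≤ (gain * size u) (many-heavy (λ x x∈ → proj₁ (supported x∈ e (here refl))) B ¬t) ⟩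
        H * (2 ^ c * K * (4 * a c)) + gain * size u
          ≤⟨ +-monoˡ-≤ (gain * size u) (*-monoʳ-≤ H (*-mono-≤ (*-monoˡ-≤ K (^-monoʳ-≤ 2 c≤ℓ)) (*-monoʳ-≤ 4 (*-monoʳ-≤ a₀ (^-monoʳ-≤ R c≤ℓ))))) ⟩
        H * gain + gain * size u
          ≡⟨ trans (cong (_+ gain * size u) (*-comm H gain)) (sym (*-distribˡ-+ gain H (size u))) ⟩
        gain * (H + size u)
          ≤⟨ *-monoʳ-≤ gain (≤-trans (≤-reflexive (sym (∑-+ Ed _ _))) (∑-mono∈ Ed (λ v v∈ → decided v (none v v∈)))) ⟩
        gain * size u₀ ∎)
        where
          open ≤-Reasoning
          H = ∑ Ed (λ v → 𝟙 (heavy B v))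
          c≤ℓ : c ≤ ℓ
          c≤ℓ = ≤-trans (m≤n+m c (suc (length es))) (≤-reflexive c<ℓ)
          heavy⊆u₀ : ∀ v → heavy B v ≡ true → u₀ v ≡ true
          heavy⊆u₀ v hv with 0 <? length (link B v)
          ... | no ¬p = ⊥-elim (n≮0 (subst (b ^ c * P <_) (cong (λ l → l * N ^ c * (4 * a c)) (n≤0⇒n≡0 (≮⇒≥ ¬p))) (<ᵇ-true {b ^ c * P} hv)))
          ... | yes p with length-pos (link B v) p
          ...   | y , y∈ with link∈ B v y∈
          ...     | y∈A , _ , refl = proj₂ (supported y∈A e (here refl))
          decided : ∀ v → u v ∧ heavy B v ≡ false → 𝟙 (heavy B v) + 𝟙 (u v) ≤ 𝟙 (u₀ v)
          decided v p with heavy B v in hv | u v in uv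
          ... | true  | false = ≤-reflexive (cong 𝟙 (sym (heavy⊆u₀ v hv)))
          ... | false | false = z≤n
          ... | false | true  = ≤-reflexive (cong 𝟙 (sym (u≤ v uv)))

      -- Each yes adds the threshold degree of a heavy edge to `B`; since R ≥ 4, b of them reach the
      -- target. Hence no step uses more than b yes answers.
      few-yeses : ∀ B → target B ≡ false → b * (b ^ c * P) ≤ length B * N ^ c * (4 * a c) → ⊥
      few-yeses B ¬t p = <-irrefl refl (begin-strict
        b ^ suc c * N * P                                ≡⟨ lem₁ b (b ^ c) N P ⟩
        b * (b ^ c * P) * N                              ≤⟨ *-monoˡ-≤ N p ⟩
        length B * N ^ c * (4 * a c) * N                 ≤⟨ *-monoˡ-≤ N (*-monoʳ-≤ (length B * N ^ c) (*-monoˡ-≤ (a c) 4≤R)) ⟩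
        length B * N ^ c * (R * a c) * N                 ≡⟨ lem₂ (length B) (N ^ c) R a₀ (R ^ c) N ⟩
        length B * N ^ suc c * a (suc c)                 <⟨ ≤ᵇ-false ¬t ⟩
        b ^ suc c * N * P                                ∎)
        where
          open ≤-Reasoning
          lem₁ : ∀ b q n p → b * q * n * p ≡ b * (q * p) * n
          lem₁ = solve-∀
          lem₂ : ∀ l q r a p n → l * q * (r * (a * p)) * n ≡ l * (n * q) * (a * (r * p))
          lem₂ = solve-∀

      count-yes : ∀ {ny} B v → heavy B v ≡ true → ny * (b ^ c * P) ≤ length B * N ^ c * (4 * a c) →
                  suc ny * (b ^ c * P) ≤ length (link B v ++ B) * N ^ c * (4 * a c)
      count-yes {ny} B v hv p = begin
        b ^ c * P + ny * (b ^ c * P)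
          ≤⟨ +-mono-≤ (<⇒≤ (<ᵇ-true {b ^ c * P} hv)) p ⟩
        length (link B v) * N ^ c * (4 * a c) + length B * N ^ c * (4 * a c)
          ≡⟨ lem (length (link B v)) (length B) (N ^ c) (4 * a c) ⟩
        (length (link B v) + length B) * N ^ c * (4 * a c)
          ≡⟨ cong (λ l → l * N ^ c * (4 * a c)) (sym (length-++ (link B v))) ⟩
        length (link B v ++ B) * N ^ c * (4 * a c) ∎
        where
          open ≤-Reasoning
          lem : ∀ x y p q → x * p * q + y * p * q ≡ (x + y) * p * q
          lem = solve-∀

      -- `ny` yes answers were given at this level and `yl` remain. `B` collects the links of the
      -- edges answered yes. It stays independent: a hyperedge of a link with its remaining edges
      -- all on would, with the edge just answered yes, be fully on in `A`.
      run : ∀ k yl ny B {xs u m d} → size u ≡ k → ny + yl ≡ b → ny * (b ^ c * P) ≤ length B * N ^ c * (4 * a c) →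
            (∀ {x} → x ∈ B → x ∈ A) → Spread (suc c) es B →
            State mono xs u m d → (∀ {G} → G ∈ xs → G ∈ xs₀) → (∀ v → u v ≡ true → u₀ v ≡ true) →
            Independent (e ∷ es) A xs → Independent es B xs → length xs * 2 ^ d ≤ budget M k (yl + S) m
      run k yl ny B {xs} {u} {m} {d} sz ny+yl yes≤ B⊆A spreadB st sub u≤ indA indB with target B in t
      ... | true = ≤-trans (next B (λ x∈ e' e'∈ → supported (B⊆A x∈) e' (there e'∈)) spreadB (≤ᵇ-true t) st sub u≤ indB)
                     (≤-trans (budget-mono M (size u) m (m≤n+m S yl)) (≤-reflexive (cong (λ k → budget M k (yl + S) m) sz)))
      ... | false with findᵇ (λ v → u v ∧ heavy B v) Ed
      ...   | inj₂ none = ≤-trans (stuck k B sz st sub u≤ t none) (budget-mono M k m (≤-trans (m≤n+m s (length es * b)) (m≤n+m S yl)))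
      run k zero ny B sz ny+yl yes≤ B⊆A spreadB st sub u≤ indA indB
          | false | inj₁ _ = ⊥-elim (few-yeses B t (subst (λ k → k * (b ^ c * P) ≤ _) (trans (sym (+-identityʳ ny)) ny+yl) yes≤))
      run zero (suc yl) ny B {u = u} sz ny+yl yes≤ B⊆A spreadB st sub u≤ indA indB
          | false | inj₁ (v , v∈ , p) = ⊥-elim (1+n≢0 (trans (sym (size-remove u v∈ (proj₁ (∧-true {u v} p)))) sz))
      run (suc k) (suc yl) ny B {xs} {u} {m} {d} sz ny+yl yes≤ B⊆A spreadB st sub u≤ indA indB
          | false | inj₁ (v , v∈ , p) = answer m refl
        where
          open ≤-Reasoning
          uv = proj₁ (∧-true {u v} p)
          hv = proj₂ (∧-true {u v} p)
          sz' : size (remove u v) ≡ k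
          sz' = suc-injective (trans (sym (size-remove u v∈ uv)) sz)
          u≤' : ∀ w → remove u v w ≡ true → u₀ w ≡ true
          u≤' w q = u≤ w (remove-⊆ u v w q)
          yes∈' : ∀ {G} → G ∈ yeses v xs → G ∈ xs × on G v ≡ true
          yes∈' = ∈-filterᵇ⁻ (λ G → on G v) xs
          no∈' : ∀ {G} → G ∈ noes v xs → G ∈ xs
          no∈' G∈ = proj₁ (∈-filterᵇ⁻ (λ G → not (on G v)) xs G∈)
          noes-bound : length (noes v xs) * 2 ^ d ≤ budget M k (suc yl + S) m
          noes-bound = run k (suc yl) ny B sz' ny+yl yes≤ B⊆A spreadB (answer-no v∈ uv st)
            (λ G∈ → sub (no∈' G∈)) u≤' (λ x∈ G∈ → indA x∈ (no∈' G∈)) (λ x∈ G∈ → indB x∈ (no∈' G∈))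
          indB' : Independent es (link B v ++ B) (yeses v xs)
          indB' x∈ G∈ all-on with ∈-++⁻ (link B v) x∈
          ... | inj₂ x∈B = indB x∈B (proj₁ (yes∈' G∈)) all-on
          ... | inj₁ x∈L with link∈ B v x∈L
          ...   | x∈A , _ , refl = indA x∈A (proj₁ (yes∈' G∈)) λ { e' (here refl) → proj₂ (yes∈' G∈) ; e' (there e'∈) → all-on e' e'∈ }
          B'⊆A : ∀ {x} → x ∈ link B v ++ B → x ∈ A
          B'⊆A x∈ with ∈-++⁻ (link B v) x∈
          ... | inj₁ x∈L = proj₁ (link∈ B v x∈L)
          ... | inj₂ x∈B = B⊆A x∈B
          yeses-bound : ∀ m' → m ≡ suc m' → length (yeses v xs) * 2 ^ (d ∸ 1) ≤ budget M k (yl + S) m'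
          yeses-bound m' eq = run k yl (suc ny) (link B v ++ B) sz' (trans (sym (+-suc ny yl)) ny+yl) (count-yes {ny} B v hv yes≤)
            B'⊆A (spread-link B v spreadB) (answer-yes v∈ uv eq (λ col → ∸-monoʳ-≤ d (𝟙≤1 (mono col v))) st)
            (λ G∈ → sub (proj₁ (yes∈' G∈))) u≤' (λ x∈ G∈ → indA x∈ (proj₁ (yes∈' G∈))) indB'
          answer : ∀ m' → m ≡ m' → length xs * 2 ^ d ≤ budget M (suc k) (suc yl + S) m
          answer zero refl = begin
            length xs * 2 ^ d                                      ≡⟨ cong (_* 2 ^ d) (length-yeses-noes v xs) ⟩
            (length (yeses v xs) + length (noes v xs)) * 2 ^ d     ≡⟨ cong (λ y → (y + length (noes v xs)) * 2 ^ d) (no-yeses v∈ uv st refl) ⟩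
            length (noes v xs) * 2 ^ d                             ≤⟨ noes-bound ⟩
            budget M k (suc yl + S) zero                           ∎
          answer (suc m') refl = begin
            length xs * 2 ^ d
              ≡⟨ trans (cong (_* 2 ^ d) (length-yeses-noes v xs)) (*-distribʳ-+ (2 ^ d) (length (yeses v xs)) (length (noes v xs))) ⟩
            length (yeses v xs) * 2 ^ d + length (noes v xs) * 2 ^ d
              ≡⟨ +-comm (length (yeses v xs) * 2 ^ d) _ ⟩
            length (noes v xs) * 2 ^ d + length (yeses v xs) * 2 ^ d
              ≤⟨ +-mono-≤ noes-bound (≤-trans (double (length (yeses v xs)) d) (*-monoʳ-≤ 2 (yeses-bound m' refl))) ⟩
            budget M k (suc yl + S) (suc m') + 2 * budget M k (yl + S) m' ∎

    -- Once no label remains, every edge of a listed hyperedge has been answered yes. `Large` makes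
    -- the list nonempty, so no independent graph is left to count.
    level : ∀ c es A → length es + c ≡ ℓ → Supported es A → Spread c es A → Large c A → Bounded es A
    level c [] A _ _ _ large {xs} {u} {m} {d} st sub u≤ ind = ≤-trans (≤-reflexive (cong (_* 2 ^ d) (none-in xs (λ G∈ → ind (proj₂ nonempty) G∈ (λ _ ()))))) z≤n
      where
        nonempty : ∃[ x ] x ∈ A
        nonempty with 0 <? length A
        ... | yes p = length-pos A p
        ... | no ¬p = ⊥-elim (<-irrefl refl (<-≤-trans (>-nonZero⁻¹ (b ^ c * N * P) {{m*n≢0 (b ^ c * N) P {{m*n≢0 (b ^ c) N {{m^n≢0 b c}}}}}})
                        (≤-trans large (≤-reflexive (cong (λ l → l * N ^ c * a c) (n≤0⇒n≡0 (≮⇒≥ ¬p)))))))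
    level c (e ∷ es) A c<ℓ sup spr large {xs} {u} {m} {d} st sub u≤ ind =
      ≤-trans (Step.run c e es A c<ℓ sup spr large (λ B → level (suc c) es B (trans (+-suc (length es) c) c<ℓ))
                 (size u) b 0 [] refl refl z≤n (λ ()) (λ _ _ _ _ → z≤n) st sub u≤ ind (λ ()))
              (≤-reflexive (cong (λ k → budget M (size u) k m) (sym (+-assoc b (length es * b) s))))

-- Repeating the rounds until few copies are undecided

module Rounds {V : Set} (_≟_ : DecidableEquality V) (Ed : List V) (Ed-unique : Unique Ed)
              {Γ : Set} (on : Γ → V → Bool) {Col : Set} (mono : Col → V → Bool)
              {X Lab : Set} (coord : Lab → X → V) (labels : List Lab) (Xs : List X)
              (M b N K P a₀ : ℕ) {{b≢0 : NonZero b}} {{N≢0 : NonZero N}} {{K≢0 : NonZero K}} {{P≢0 : NonZero P}}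
              {{a₀≢0 : NonZero a₀}} (Ed≤N : length Ed ≤ N) where
  ℓ : ℕ
  ℓ = length labels

  open Container _≟_ Ed Ed-unique on mono coord M b N K P ℓ a₀ Ed≤N public

  inside : (V → Bool) → X → Bool
  inside u x = ∑ labels (λ e → 𝟙 (not (u (coord e x)))) ≡ᵇ 0

  inside-elim : ∀ u x → inside u x ≡ true → ∀ e → e ∈ labels → u (coord e x) ≡ true
  inside-elim u x p e e∈ with u (coord e x) in eq
  ... | true  = refl
  ... | false = ⊥-elim (<-irrefl refl (≤-trans (≤-reflexive (cong (λ b → 𝟙 (not b)) (sym eq)))
        (≤-trans (∑-∈-≤ (λ e → 𝟙 (not (u (coord e x)))) e∈) (≤-reflexive (≡ᵇ-true p)))))

  inside-intro : ∀ u x → (∀ e → e ∈ labels → u (coord e x) ≡ true) → inside u x ≡ true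
  inside-intro u x p = true-≡ᵇ (trans (∑-cong∈ labels (λ e e∈ → cong (λ b → 𝟙 (not b)) (p e e∈))) (∑-zero labels))

  copies : (V → Bool) → List X
  copies u = filterᵇ (inside u) Xs

  -- Each round starts afresh from the copies with all edges undecided and spends at most b yes
  -- answers on each of the ℓ labels. A stuck round lowers `gain * size u` by at least N, hence the
  -- fuel by one; with no fuel left a round cannot get stuck, but it may still take place, whence
  -- `suc f` in the budget.
  rounds : (∀ {x} → x ∈ Xs → ∀ e → e ∈ labels → coord e x ∈ Ed) → Spread 0 labels Xs →
    (∀ {xs u m d} → State mono xs u m d → length (copies u) * a₀ < N * P → length xs * 2 ^ d ≤ bin M m) →
    ∀ f {xs u m d} → gain * size u ≤ f * N → State mono xs u m d → Independent labels Xs xs →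
    length xs * 2 ^ d ≤ budget M (size u) (suc f * (ℓ * b)) m
  rounds Xs⊆ spread leaf f {xs} {u} {m} {d} fuel st ind with length (copies u) * a₀ <ᵇ N * P in few
  ... | true  = ≤-trans (leaf st (<ᵇ-true few)) (bin≤budget M (size u) (suc f * (ℓ * b)) m)
  ... | false = Round.level xs u (f * (ℓ * b)) (continue f fuel) 0 labels (copies u) (+-identityʳ ℓ)
                  (λ x∈ e e∈ → let x∈Xs , ins = ∈-filterᵇ⁻ (inside u) Xs x∈ in Xs⊆ x∈Xs e e∈ , inside-elim u _ ins e e∈)
                  (λ t J y p → ≤-trans (*-monoˡ-≤ (N ^ (length J + 0)) (fewer t J y)) (spread t J y p))
                  (≤-trans (≤-reflexive (cong (_* P) (*-identityˡ N)))
                    (≤-trans (<ᵇ-false {length (copies u) * a₀} few)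
                      (≤-reflexive (cong₂ _*_ (sym (*-identityʳ (length (copies u)))) (sym (*-identityʳ a₀))))))
                  st (λ G∈ → G∈) (λ v uv → uv) (λ x∈ → ind (proj₁ (∈-filterᵇ⁻ (inside u) Xs x∈)))
    where
      fewer : ∀ t J y → degree (t ∷ J) (copies u) y ≤ degree (t ∷ J) Xs y
      fewer t J y = ≤-trans (≤-reflexive (∑-filter (inside u) Xs _))
        (∑-mono Xs (λ x → ≤-trans (*-monoˡ-≤ _ (𝟙≤1 (inside u x))) (≤-reflexive (+-identityʳ _))))
      continue : ∀ f → gain * size u ≤ f * N → ∀ {xs' u' m' d'} → State mono xs' u' m' d' → (∀ {G} → G ∈ xs' → G ∈ xs) →
        N + gain * size u' ≤ gain * size u → length xs' * 2 ^ d' ≤ budget M (size u') (f * (ℓ * b)) m'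
      continue zero    fuel st' sub shrink = ⊥-elim (<-irrefl refl (<-≤-trans (>-nonZero⁻¹ N) (≤-trans (m≤m+n N _) (≤-trans shrink fuel))))
      continue (suc f) fuel st' sub shrink = rounds Xs⊆ spread leaf f (+-cancelˡ-≤ N _ _ (≤-trans shrink fuel)) st'
        (λ x∈ G∈ → ind x∈ (sub G∈))

-- Graphs as adjacency matrices

∑-cartesianProduct : ∀ (xs : List A) (ys : List A′) (f : A × A′ → ℕ) →
                     ∑ (cartesianProduct xs ys) f ≡ ∑ xs (λ x → ∑ ys (λ y → f (x , y)))
∑-cartesianProduct []       ys f = refl
∑-cartesianProduct (x ∷ xs) ys f = trans (∑-++ (map (x ,_) ys) (cartesianProduct xs ys) f)
  (cong₂ _+_ (∑-map (x ,_) ys f) (∑-cartesianProduct xs ys f))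

∑-tabulate : ∀ {n} (g : Fin n → A) (f : A → ℕ) → ∑ (List.tabulate g) f ≡ ∑ (allFin n) (f ∘ g)
∑-tabulate {n = zero}  g f = refl
∑-tabulate {n = suc n} g f = cong (f (g zero) +_) (trans (∑-tabulate (g ∘ suc) f) (sym (∑-tabulate suc (f ∘ g))))

∑-allFin-suc : ∀ {n} (f : Fin (suc n) → ℕ) → ∑ (allFin (suc n)) f ≡ f zero + ∑ (allFin n) (f ∘ suc)
∑-allFin-suc f = cong (f zero +_) (∑-tabulate suc f)

sum-tabulate : ∀ {n} (f : Fin n → ℕ) → Vec.sum (Vec.tabulate f) ≡ ∑ (allFin n) f
sum-tabulate {zero}  f = refl
sum-tabulate {suc n} f = trans (cong (f zero +_) (sum-tabulate (f ∘ suc))) (sym (∑-allFin-suc f))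

eqᵇ : ∀ {n} → Fin n → Fin n → Bool
eqᵇ i j = does (i Fin.≟ j)

eqᵇ-refl : ∀ {n} (i : Fin n) → eqᵇ i i ≡ true
eqᵇ-refl i = does-true (i Fin.≟ i) refl

eqᵇ-true : ∀ {n} {i j : Fin n} → eqᵇ i j ≡ true → i ≡ j
eqᵇ-true {i = i} {j} = from-does (i Fin.≟ j)

eqᵇ-false : ∀ {n} {i j : Fin n} → i ≢ j → eqᵇ i j ≡ false
eqᵇ-false {i = i} {j} = does-false (i Fin.≟ j)

eqᵇ-sym : ∀ {n} (i j : Fin n) → eqᵇ i j ≡ eqᵇ j i
eqᵇ-sym i j with i Fin.≟ j
... | yes refl = sym (eqᵇ-refl i)
... | no  i≢j  = sym (eqᵇ-false (i≢j ∘ sym))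

∑-eqᵇ : ∀ {n} (i : Fin n) (f : Fin n → ℕ) → ∑ (allFin n) (λ j → 𝟙 (eqᵇ i j) * f j) ≡ f i
∑-eqᵇ {suc n} zero f = trans (∑-allFin-suc (λ j → 𝟙 (eqᵇ zero j) * f j))
  (trans (cong (f zero + 0 +_) (∑-zero (allFin n))) (trans (+-identityʳ _) (+-identityʳ _)))
∑-eqᵇ {suc n} (suc i) f = trans (∑-allFin-suc (λ j → 𝟙 (eqᵇ (suc i) j) * f j)) (∑-eqᵇ i (f ∘ suc))

Edge : ℕ → Set
Edge n = Fin n × Fin n

infix 4 _≟ᴱ_
_≟ᴱ_ : ∀ {n} → DecidableEquality (Edge n)
_≟ᴱ_ = Product.≡-dec Fin._≟_ Fin._≟_

ltᵇ : ∀ {n} → Fin n → Fin n → Bool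
ltᵇ i j = toℕ i <ᵇ toℕ j

abstract
  Ed : ∀ n → List (Edge n)
  Ed n = filterᵇ (λ (i , j) → ltᵇ i j) (cartesianProduct (allFin n) (allFin n))

  Ed-unique : ∀ n → Unique (Ed n)
  Ed-unique n = filterᵇ-unique _ (Unique.cartesianProduct⁺ (Unique.allFin⁺ n) (Unique.allFin⁺ n))

  ∑-Ed : ∀ {n} (f : Edge n → ℕ) → ∑ (Ed n) f ≡ ∑ (allFin n) (λ i → ∑ (allFin n) (λ j → 𝟙 (ltᵇ i j) * f (i , j)))
  ∑-Ed {n} f = trans (∑-filter _ (cartesianProduct (allFin n) (allFin n)) f) (∑-cartesianProduct (allFin n) (allFin n) _)

  ∈Ed⁻ : ∀ {n} {i j : Fin n} → (i , j) ∈ Ed n → toℕ i < toℕ j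
  ∈Ed⁻ {n} p = <ᵇ-true (proj₂ (∈-filterᵇ⁻ _ (cartesianProduct (allFin n) (allFin n)) p))

  ∈Ed⁺ : ∀ {n} {i j : Fin n} → toℕ i < toℕ j → (i , j) ∈ Ed n
  ∈Ed⁺ {n} {i} {j} lt = ∈-filterᵇ⁺ _ (cartesianProduct (allFin n) (allFin n)) (∈-cartesianProduct⁺ (∈-allFin i) (∈-allFin j)) (true-<ᵇ lt)

Ed≤n² : ∀ n → length (Ed n) ≤ n * n
Ed≤n² n = begin
  length (Ed n)                                       ≡⟨ trans (length-∑ (Ed n)) (∑-Ed {n} (λ _ → 1)) ⟩
  ∑ (allFin n) (λ i → ∑ (allFin n) (λ j → 𝟙 (ltᵇ i j) * 1)) ≤⟨ ∑-mono (allFin n) (λ i → ∑-mono (allFin n) (λ j → *-monoˡ-≤ 1 (𝟙≤1 (ltᵇ i j)))) ⟩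
  ∑ (allFin n) (λ i → ∑ (allFin n) (λ j → 1))         ≡⟨ ∑-cong (allFin n) (λ _ → trans (sym (length-∑ (allFin n))) (length-allFin n)) ⟩
  ∑ (allFin n) (λ i → n)                              ≡⟨ trans (∑-const (allFin n) n) (cong (_* n) (length-allFin n)) ⟩
  n * n                                               ∎
  where open ≤-Reasoning

ltᵇ-asym : ∀ {n} {i j : Fin n} → toℕ i < toℕ j → ltᵇ j i ≡ false
ltᵇ-asym {i = i} {j} lt with ltᵇ j i in q
... | false = refl
... | true  = ⊥-elim (<-asym lt (<ᵇ-true {toℕ j} q))

≢⇒<⊎> : ∀ {n} {i j : Fin n} → i ≢ j → toℕ i < toℕ j ⊎ toℕ j < toℕ i
≢⇒<⊎> {i = i} {j} i≢j = ≤⇒<∨ (≤-total (toℕ i) (toℕ j))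
  where
    ≤⇒<∨ : toℕ i ≤ toℕ j ⊎ toℕ j ≤ toℕ i → toℕ i < toℕ j ⊎ toℕ j < toℕ i
    ≤⇒<∨ (inj₁ p) = inj₁ (≤∧≢⇒< p (i≢j ∘ Fin.toℕ-injective))
    ≤⇒<∨ (inj₂ p) = inj₂ (≤∧≢⇒< p (i≢j ∘ sym ∘ Fin.toℕ-injective))

<⇒≢ᶠ : ∀ {n} {i j : Fin n} → toℕ i < toℕ j → i ≢ j
<⇒≢ᶠ lt refl = <-irrefl refl lt

ltᵇ-irrefl : ∀ {n} (i : Fin n) → ltᵇ i i ≡ false
ltᵇ-irrefl i with ltᵇ i i in q
... | false = refl
... | true  = ⊥-elim (<-irrefl refl (<ᵇ-true {toℕ i} q))

trichotomy : ∀ {n} (i j : Fin n) → 𝟙 (ltᵇ i j) + (𝟙 (ltᵇ j i) + 𝟙 (eqᵇ i j)) ≡ 1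
trichotomy i j with i Fin.≟ j
... | yes refl rewrite ltᵇ-irrefl i = refl
... | no i≢j with ≢⇒<⊎> i≢j
...   | inj₁ lt rewrite true-<ᵇ lt | ltᵇ-asym {i = i} {j} lt = refl
...   | inj₂ gt rewrite true-<ᵇ gt | ltᵇ-asym {i = j} {i} gt = refl

∑∑-symmetric : ∀ {n} (f : Fin n → Fin n → ℕ) → (∀ i j → f i j ≡ f j i) →
  ∑ (allFin n) (λ i → ∑ (allFin n) (f i)) ≡ 2 * ∑ (Ed n) (λ (i , j) → f i j) + ∑ (allFin n) (λ i → f i i)
∑∑-symmetric {n} f f-sym = begin
  ∑ V (λ i → ∑ V (f i))
    ≡⟨ ∑-cong V (λ i → trans (∑-cong V (λ j → split i j)) (trans (∑-+ V _ _) (cong (∑ V (λ j → 𝟙 (ltᵇ i j) * f i j) +_) (∑-+ V _ _)))) ⟩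
  ∑ V (λ i → ∑ V (λ j → 𝟙 (ltᵇ i j) * f i j) + (∑ V (λ j → 𝟙 (ltᵇ j i) * f j i) + ∑ V (λ j → 𝟙 (eqᵇ i j) * f i j)))
    ≡⟨ trans (∑-+ V _ _) (cong (∑ V (λ i → ∑ V (λ j → 𝟙 (ltᵇ i j) * f i j)) +_) (∑-+ V _ _)) ⟩
  ∑ V (λ i → ∑ V (λ j → 𝟙 (ltᵇ i j) * f i j)) + (∑ V (λ i → ∑ V (λ j → 𝟙 (ltᵇ j i) * f j i)) + ∑ V (λ i → ∑ V (λ j → 𝟙 (eqᵇ i j) * f i j)))
    ≡⟨ cong₂ _+_ (sym (∑-Ed _)) (cong₂ _+_ (trans (∑-swap V V _) (sym (∑-Ed _))) (∑-cong V (λ i → ∑-eqᵇ i (f i)))) ⟩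
  E + (E + ∑ V (λ i → f i i))
    ≡⟨ lem E _ ⟩
  2 * E + ∑ V (λ i → f i i) ∎
  where
    open ≡-Reasoning
    V = allFin n
    E = ∑ (Ed n) (λ (i , j) → f i j)
    lem : ∀ x d → x + (x + d) ≡ 2 * x + d
    lem = solve-∀
    split : ∀ i j → f i j ≡ 𝟙 (ltᵇ i j) * f i j + (𝟙 (ltᵇ j i) * f j i + 𝟙 (eqᵇ i j) * f i j)
    split i j = begin
      f i j
        ≡⟨ sym (*-identityˡ (f i j)) ⟩
      1 * f i j
        ≡⟨ cong (_* f i j) (sym (trichotomy i j)) ⟩
      (𝟙 (ltᵇ i j) + (𝟙 (ltᵇ j i) + 𝟙 (eqᵇ i j))) * f i j
        ≡⟨ dist (𝟙 (ltᵇ i j)) (𝟙 (ltᵇ j i)) (𝟙 (eqᵇ i j)) (f i j) ⟩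
      𝟙 (ltᵇ i j) * f i j + (𝟙 (ltᵇ j i) * f i j + 𝟙 (eqᵇ i j) * f i j)
        ≡⟨ cong (λ k → 𝟙 (ltᵇ i j) * f i j + (𝟙 (ltᵇ j i) * k + 𝟙 (eqᵇ i j) * f i j)) (f-sym i j) ⟩
      𝟙 (ltᵇ i j) * f i j + (𝟙 (ltᵇ j i) * f j i + 𝟙 (eqᵇ i j) * f i j) ∎
      where dist : ∀ a b c k → (a + (b + c)) * k ≡ a * k + (b * k + c * k)
            dist = solve-∀

norm : ∀ {n} → Fin n → Fin n → Edge n
norm i j = if ltᵇ i j then (i , j) else (j , i)

norm-< : ∀ {n} {i j : Fin n} → toℕ i < toℕ j → norm i j ≡ (i , j)
norm-< lt rewrite true-<ᵇ lt = refl

norm-> : ∀ {n} {i j : Fin n} → toℕ j < toℕ i → norm i j ≡ (j , i)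
norm-> {i = i} {j} gt rewrite ltᵇ-asym {i = j} {i} gt = refl

norm-sym : ∀ {n} (i j : Fin n) → norm i j ≡ norm j i
norm-sym i j with i Fin.≟ j
... | yes refl = refl
... | no i≢j with ≢⇒<⊎> i≢j
...   | inj₁ lt = trans (norm-< lt) (sym (norm-> lt))
...   | inj₂ gt = trans (norm-> gt) (sym (norm-< gt))

norm∈Ed : ∀ {n} {i j : Fin n} → i ≢ j → norm i j ∈ Ed n
norm∈Ed {n} {i} {j} i≢j with ≢⇒<⊎> i≢j
... | inj₁ lt rewrite norm-< lt = ∈Ed⁺ lt
... | inj₂ gt rewrite norm-> {i = i} {j} gt = ∈Ed⁺ gt

norm-cases : ∀ {n} (i j : Fin n) → norm i j ≡ (i , j) ⊎ norm i j ≡ (j , i)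
norm-cases i j with ltᵇ i j
... | true  = inj₁ refl
... | false = inj₂ refl

norm-injective : ∀ {n} {i j k l : Fin n} → norm i j ≡ norm k l → (i ≡ k × j ≡ l) ⊎ (i ≡ l × j ≡ k)
norm-injective {i = i} {j} {k} {l} p with norm-cases i j | norm-cases k l
... | inj₁ q | inj₁ r with trans (sym q) (trans p r)
...   | refl = inj₁ (refl , refl)
norm-injective p | inj₁ q | inj₂ r with trans (sym q) (trans p r)
...   | refl = inj₂ (refl , refl)
norm-injective p | inj₂ q | inj₁ r with trans (sym q) (trans p r)
...   | refl = inj₂ (refl , refl)
norm-injective p | inj₂ q | inj₂ r with trans (sym q) (trans p r)
...   | refl = inj₁ (refl , refl)

on : ∀ {n} → Mat n → Edge n → Bool
on G (i , j) = adj G i j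

on-norm : ∀ {n} {G : Mat n} → IsGraph G → ∀ i j → on G (norm i j) ≡ adj G i j
on-norm {G = G} isG i j with norm-cases i j
... | inj₁ p rewrite p = refl
... | inj₂ p rewrite p = proj₂ isG j i

fromAdj : ∀ {n} → (Fin n → Fin n → Bool) → Mat n
fromAdj a = Vec.tabulate (λ i → Vec.tabulate (a i))

adj-fromAdj : ∀ {n} (a : Fin n → Fin n → Bool) i j → adj (fromAdj a) i j ≡ a i j
adj-fromAdj a i j = trans (cong (λ r → lookup r j) (Vec.lookup∘tabulate (λ i → Vec.tabulate (a i)) i)) (Vec.lookup∘tabulate (a i) j)

vec-ext : ∀ {n} {v w : Vec A n} → (∀ i → lookup v i ≡ lookup w i) → v ≡ w
vec-ext {v = v} {w} p = trans (sym (Vec.tabulate∘lookup v)) (trans (Vec.tabulate-cong p) (Vec.tabulate∘lookup w))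

graph-ext : ∀ {n} {G G' : Mat n} → IsGraph G → IsGraph G' → (∀ v → v ∈ Ed n → on G v ≡ on G' v) → G ≡ G'
graph-ext {G = G} {G'} g g' p = vec-ext λ i → vec-ext λ j → same i j
  where
    same : ∀ i j → adj G i j ≡ adj G' i j
    same i j with i Fin.≟ j
    ... | yes refl = trans (proj₁ g i) (sym (proj₁ g' i))
    ... | no i≢j   = trans (sym (on-norm {G = G} g i j)) (trans (p _ (norm∈Ed i≢j)) (on-norm {G = G'} g' i j))

e-∑ : ∀ {n} (G : Mat n) → e G ≡ ∑ (Ed n) (λ v → 𝟙 (on G v))
e-∑ {n} G = trans (sum-tabulate (λ i → Vec.sum (Vec.tabulate (entry i))))
  (trans (∑-cong (allFin n) (λ i → trans (sum-tabulate (entry i)) (∑-cong (allFin n) (λ j → ite (ltᵇ i j) (adj G i j)))))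
  (sym (∑-Ed (λ v → 𝟙 (on G v)))))
  where ite : ∀ a b → (if a ∧ b then 1 else 0) ≡ 𝟙 a * 𝟙 b
        ite true true   = refl
        ite true false  = refl
        ite false b     = refl
        entry : Fin n → Fin n → ℕ
        entry i j = if ltᵇ i j ∧ adj G i j then 1 else 0

adjOf : ∀ {n} → (Edge n → Bool) → Fin n → Fin n → Bool
adjOf u i j = not (eqᵇ i j) ∧ u (norm i j)

adjOf-sym : ∀ {n} (u : Edge n → Bool) i j → adjOf u i j ≡ adjOf u j i
adjOf-sym u i j = cong₂ _∧_ (cong not (eqᵇ-sym i j)) (cong u (norm-sym i j))

adjOf-irrefl : ∀ {n} (u : Edge n → Bool) i → adjOf u i i ≡ false
adjOf-irrefl u i rewrite eqᵇ-refl i = refl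

adjOf-< : ∀ {n} (u : Edge n → Bool) {i j} → toℕ i < toℕ j → adjOf u i j ≡ u (i , j)
adjOf-< u {i} {j} lt rewrite eqᵇ-false (<⇒≢ᶠ {i = i} {j} lt) | true-<ᵇ lt = refl

fromAdj-isGraph : ∀ {n} {a : Fin n → Fin n → Bool} → (∀ i → a i i ≡ false) → (∀ i j → a i j ≡ a j i) → IsGraph (fromAdj a)
fromAdj-isGraph {a = a} irr s = (λ i → trans (adj-fromAdj a i i) (irr i)) ,
  (λ i j → trans (adj-fromAdj a i j) (trans (s i j) (sym (adj-fromAdj a j i))))

monochromatic : ∀ {n} → (Fin n → ℕ) → Edge n → Bool
monochromatic col (i , j) = col i ≡ᵇ col j

≡ᵇ-sym : ∀ i j → (i ≡ᵇ j) ≡ (j ≡ᵇ i)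
≡ᵇ-sym zero zero = refl
≡ᵇ-sym zero (suc j) = refl
≡ᵇ-sym (suc i) zero = refl
≡ᵇ-sym (suc i) (suc j) = ≡ᵇ-sym i j

-- Deleting the monochromatic edges of `col` leaves an r-partite graph, so badness says that there
-- are too many of them for every colouring at once.
not-partite : ∀ {n dp dq r} {G : Mat n} → IsGraph G → ¬ Partite dp dq r G →
  ∀ (col : Fin n → ℕ) → (∀ x → col x < r) → dp * e G < ∑ (Ed n) (λ v → 𝟙 (on G v) * 𝟙 (monochromatic col v)) * dq
not-partite {n} {dp} {dq} {r} {G} isG bad col col< = ≰⇒> λ le → bad (G' , isG' , ⊆G , (c , proper) ,
    subst (λ k → k * dq ≤ dp * e G) (sym removed) le)
  where
    a : Fin n → Fin n → Bool
    a i j = adj G i j ∧ not (col i ≡ᵇ col j)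
    G' : Mat n
    G' = fromAdj a
    isG' : IsGraph G'
    isG' = fromAdj-isGraph (λ i → cong (_∧ not (col i ≡ᵇ col i)) (proj₁ isG i))
      (λ i j → cong₂ _∧_ (proj₂ isG i j) (cong not (≡ᵇ-sym (col i) (col j))))
    ⊆G : G' ⊆E G
    ⊆G i j p = proj₁ (∧-true {adj G i j} (trans (sym (adj-fromAdj a i j)) p))
    c : Fin n → Fin r
    c x = Fin.fromℕ< (col< x)
    proper : ProperColouring G' r c
    proper i j p q = true≢false (proj₂ (∧-true {adj G i j} (trans (sym (adj-fromAdj a i j)) p)))
      (cong not (true-≡ᵇ (trans (sym (Fin.toℕ-fromℕ< (col< i))) (trans (cong toℕ q) (Fin.toℕ-fromℕ< (col< j))))))
    mono = ∑ (Ed n) (λ v → 𝟙 (on G v) * 𝟙 (monochromatic col v))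
    removed : e G ∸ e G' ≡ mono
    removed = begin
      e G ∸ e G'
        ≡⟨ cong₂ _∸_ (e-∑ G) (e-∑ G') ⟩
      ∑ (Ed n) (λ v → 𝟙 (on G v)) ∸ ∑ (Ed n) (λ v → 𝟙 (on G' v))
        ≡⟨ cong (_∸ ∑ (Ed n) (λ v → 𝟙 (on G' v))) (trans (∑-cong (Ed n) split) (∑-+ (Ed n) _ _)) ⟩
      mono + ∑ (Ed n) (λ v → 𝟙 (on G' v)) ∸ ∑ (Ed n) (λ v → 𝟙 (on G' v))
        ≡⟨ m+n∸n≡m mono (∑ (Ed n) (λ v → 𝟙 (on G' v))) ⟩
      mono ∎
      where
        open ≡-Reasoning
        b-split : ∀ x y → 𝟙 x ≡ 𝟙 x * 𝟙 y + 𝟙 (x ∧ not y)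
        b-split false y = refl
        b-split true true = refl
        b-split true false = refl
        split : ∀ v → 𝟙 (on G v) ≡ 𝟙 (on G v) * 𝟙 (monochromatic col v) + 𝟙 (on G' v)
        split (i , j) = trans (b-split (adj G i j) (col i ≡ᵇ col j))
          (cong (λ b → 𝟙 (adj G i j) * 𝟙 (col i ≡ᵇ col j) + 𝟙 b) (sym (adj-fromAdj a i j)))

𝟙-∨ : ∀ a b → 𝟙 (a ∨ b) ≤ 𝟙 a + 𝟙 b
𝟙-∨ true  b = s≤s z≤n
𝟙-∨ false b = ≤-refl

∨-true : ∀ {a b} → a ∨ b ≡ true → a ≡ true ⊎ b ≡ true
∨-true {true}  p = inj₁ refl
∨-true {false} p = inj₂ p

∨-introˡ : ∀ {a b} → a ≡ true → a ∨ b ≡ true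
∨-introˡ refl = refl

∨-introʳ : ∀ {a b} → b ≡ true → a ∨ b ≡ true
∨-introʳ {true}  p = refl
∨-introʳ {false} p = p

∨-falseˡ : ∀ {a b} → a ∨ b ≡ false → a ≡ false × b ≡ false
∨-falseˡ {false} p = refl , p

∑-allFin-const : ∀ n k → ∑ (allFin n) (λ _ → k) ≡ n * k
∑-allFin-const n k = trans (∑-const (allFin n) k) (cong (_* k) (length-allFin n))

∑-eqᵇ-1 : ∀ {n} (i : Fin n) → ∑ (allFin n) (λ j → 𝟙 (eqᵇ i j)) ≡ 1
∑-eqᵇ-1 i = trans (∑-cong (allFin _) (λ j → sym (*-identityʳ (𝟙 (eqᵇ i j))))) (∑-eqᵇ i (λ _ → 1))

-- Balanced colourings

module _ (r : ℕ) {{r≢0 : NonZero r}} where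

  small-class : ∀ {n} (col : Fin n → Fin r) → ∃[ t ] r * ∑ (allFin n) (λ i → 𝟙 (eqᵇ t (col i))) ≤ n
  small-class {n} col with findᵇ (λ t → r * ∑ (allFin n) (λ i → 𝟙 (eqᵇ t (col i))) ≤ᵇ n) (allFin r)
  ... | inj₁ (t , _ , p) = t , ≤ᵇ-true p
  ... | inj₂ none = ⊥-elim (<-irrefl refl (*-cancelˡ-≤ r (begin
    r * suc n                                                        ≡⟨ sym (∑-allFin-const r (suc n)) ⟩
    ∑ (allFin r) (λ _ → suc n)                                       ≤⟨ ∑-mono (allFin r) (λ t → ≤ᵇ-false (none t (∈-allFin t))) ⟩
    ∑ (allFin r) (λ t → r * ∑ (allFin n) (λ i → 𝟙 (eqᵇ t (col i))))  ≡⟨ ∑-*ˡ (allFin r) r (λ t → ∑ (allFin n) (λ i → 𝟙 (eqᵇ t (col i)))) ⟩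
    r * ∑ (allFin r) (λ t → ∑ (allFin n) (λ i → 𝟙 (eqᵇ t (col i))))  ≡⟨ cong (r *_) (∑-swap (allFin r) (allFin n) _) ⟩
    r * ∑ (allFin n) (λ i → ∑ (allFin r) (λ t → 𝟙 (eqᵇ t (col i))))  ≡⟨ cong (r *_) (∑-cong (allFin n) (λ i →
                                                                          trans (∑-cong (allFin r) (λ t → cong 𝟙 (eqᵇ-sym t (col i)))) (∑-eqᵇ-1 (col i)))) ⟩
    r * ∑ (allFin n) (λ i → 1)                                       ≡⟨ cong (r *_) (trans (∑-allFin-const n 1) (*-identityʳ n)) ⟩
    r * n                                                            ∎)))
    where open ≤-Reasoning

  -- Greedily, each new vertex joins a class with at most n / r members, which adds at most 1 + 2 n
  -- / r monochromatic ordered pairs.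
  balanced : ∀ n → ∃[ col ] r * ∑ (allFin n) (λ i → ∑ (allFin n) (λ j → 𝟙 (eqᵇ {r} (col i) (col j)))) ≤ n * n + r * n
  balanced zero    = (λ ()) , ≤-reflexive (trans (*-zeroʳ r) (sym (*-zeroʳ r)))
  balanced (suc n) with balanced n
  ... | col , IH with small-class col
  ...   | t , small = col' , (begin
    r * ∑ (allFin (suc n)) (λ i → ∑ (allFin (suc n)) (same i))
      ≡⟨ cong (r *_) (trans (∑-allFin-suc (λ i → ∑ (allFin (suc n)) (same i)))
           (cong₂ _+_ (∑-allFin-suc (same zero)) (trans (∑-cong (allFin n) (λ i → ∑-allFin-suc (same (suc i)))) (∑-+ (allFin n) _ _)))) ⟩
    r * (𝟙 (eqᵇ t t) + s + (∑ (allFin n) (λ i → 𝟙 (eqᵇ (col i) t)) + old))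
      ≡⟨ cong₂ (λ x y → r * (𝟙 x + s + (y + old))) (eqᵇ-refl t) (∑-cong (allFin n) (λ i → cong 𝟙 (eqᵇ-sym (col i) t))) ⟩
    r * (1 + s + (s + old))
      ≡⟨ lem₁ r s old ⟩
    r + (r * s + r * s) + r * old
      ≤⟨ +-mono-≤ (+-monoʳ-≤ r (+-mono-≤ small small)) IH ⟩
    r + (n + n) + (n * n + r * n)
      ≤⟨ n≤1+n _ ⟩
    1 + (r + (n + n) + (n * n + r * n))
      ≡⟨ lem₂ r n ⟩
    suc n * suc n + r * suc n ∎)
    where
      open ≤-Reasoning
      col' : Fin (suc n) → Fin r
      col' zero    = t
      col' (suc i) = col i
      same : Fin (suc n) → Fin (suc n) → ℕ
      same i j = 𝟙 (eqᵇ (col' i) (col' j))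
      s = ∑ (allFin n) (λ i → 𝟙 (eqᵇ t (col i)))
      old = ∑ (allFin n) (λ i → ∑ (allFin n) (λ j → 𝟙 (eqᵇ (col i) (col j))))
      lem₁ : ∀ r s o → r * (1 + s + (s + o)) ≡ r + (r * s + r * s) + r * o
      lem₁ = solve-∀
      lem₂ : ∀ r n → 1 + (r + (n + n) + (n * n + r * n)) ≡ suc n * suc n + r * suc n
      lem₂ = solve-∀

crossing : ∀ {n r} → (Fin n → Fin r) → Edge n → Bool
crossing col (i , j) = not (eqᵇ (col i) (col j))

many-crossing : ∀ ρ n (col : Fin n → Fin (1 + ρ)) →
  (1 + ρ) * ∑ (allFin n) (λ i → ∑ (allFin n) (λ j → 𝟙 (eqᵇ (col i) (col j)))) ≤ n * n + (1 + ρ) * n →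
  ρ * (n * n) ≤ 2 * (1 + ρ) * ∑ (Ed n) (λ v → 𝟙 (crossing col v)) + (1 + ρ) * n
many-crossing ρ n col bal = +-cancelˡ-≤ (n * n) _ _ (begin
  n * n + ρ * (n * n)
    ≡⟨ cong ((1 + ρ) *_) (sym all-pairs) ⟩
  (1 + ρ) * (same + 2 * C)
    ≡⟨ *-distribˡ-+ (1 + ρ) same (2 * C) ⟩
  (1 + ρ) * same + (1 + ρ) * (2 * C)
    ≤⟨ +-monoˡ-≤ _ bal ⟩
  n * n + (1 + ρ) * n + (1 + ρ) * (2 * C)
    ≡⟨ lem (n * n) ((1 + ρ)) n C ⟩
  n * n + (2 * (1 + ρ) * C + (1 + ρ) * n) ∎)
  where
    open ≤-Reasoning
    V = allFin n
    C = ∑ (Ed n) (λ v → 𝟙 (crossing col v))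
    same = ∑ V (λ i → ∑ V (λ j → 𝟙 (eqᵇ (col i) (col j))))
    lem : ∀ a r n c → a + r * n + r * (2 * c) ≡ a + (2 * r * c + r * n)
    lem = solve-∀
    crossings : ∑ V (λ i → ∑ V (λ j → 𝟙 (not (eqᵇ (col i) (col j))))) ≡ 2 * C
    crossings = trans (∑∑-symmetric (λ i j → 𝟙 (not (eqᵇ (col i) (col j)))) (λ i j → cong (λ b → 𝟙 (not b)) (eqᵇ-sym (col i) (col j))))
      (trans (cong (2 * C +_) (trans (∑-cong V (λ i → cong (λ b → 𝟙 (not b)) (eqᵇ-refl (col i)))) (∑-zero V))) (+-identityʳ _))
    all-pairs : same + 2 * C ≡ n * n
    all-pairs = trans (cong (same +_) (sym crossings)) (trans (sym (∑-+ V _ _))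
      (trans (∑-cong V (λ i → trans (sym (∑-+ V _ _)) (trans (∑-cong V (λ j → 𝟙-not (eqᵇ (col i) (col j)))) (trans (∑-allFin-const n 1) (*-identityʳ n)))))
      (∑-allFin-const n n)))

-- Non-injective maps

elem : ∀ {n h} → Fin n → Vec (Fin n) h → Bool
elem x []      = false
elem x (y ∷ v) = eqᵇ y x ∨ elem x v

elem-lookup : ∀ {n h} (v : Vec (Fin n) h) u → elem (lookup v u) v ≡ true
elem-lookup (y ∷ v) zero    = ∨-introˡ (eqᵇ-refl y)
elem-lookup (y ∷ v) (suc u) = ∨-introʳ {eqᵇ y (lookup v u)} (elem-lookup v u)

∑-elem : ∀ {n h} (v : Vec (Fin n) h) → ∑ (allFin n) (λ x → 𝟙 (elem x v)) ≤ h
∑-elem {n} []      = ≤-reflexive (∑-zero (allFin n))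
∑-elem {n} (y ∷ v) = ≤-trans (∑-mono (allFin n) (λ x → 𝟙-∨ (eqᵇ y x) (elem x v)))
  (≤-trans (≤-reflexive (∑-+ (allFin n) _ _)) (+-mono-≤ (≤-reflexive (∑-eqᵇ-1 y)) (∑-elem v)))

dup : ∀ {n h} → Vec (Fin n) h → Bool
dup []      = false
dup (x ∷ v) = elem x v ∨ dup v

dup-injective : ∀ {n h} (v : Vec (Fin n) h) → dup v ≡ false → ∀ i j → lookup v i ≡ lookup v j → i ≡ j
dup-injective (x ∷ v) p zero    zero    q = refl
dup-injective (x ∷ v) p zero    (suc j) q = ⊥-elim (true≢false (elem-lookup v j) (trans (cong (λ y → elem y v) (sym q)) (proj₁ (∨-falseˡ p))))
dup-injective (x ∷ v) p (suc i) zero    q = ⊥-elim (true≢false (elem-lookup v i) (trans (cong (λ y → elem y v) q) (proj₁ (∨-falseˡ p))))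
dup-injective (x ∷ v) p (suc i) (suc j) q = cong suc (dup-injective v (proj₂ (∨-falseˡ {elem x v} p)) i j q)

∑-vecs-1 : ∀ n h → ∑ (vecs (allFin n) h) (λ _ → 1) ≡ n ^ h
∑-vecs-1 n h = trans (sym (length-∑ (vecs (allFin n) h))) (trans (length-vecs (allFin n) h) (cong (_^ h) (length-allFin n)))

few-dup : ∀ n h → ∑ (vecs (allFin n) h) (λ v → 𝟙 (dup v)) * n ≤ h * h * n ^ h
few-dup n zero    = z≤n
few-dup n (suc h) = begin
  ∑ (vecs (allFin n) (suc h)) (λ v → 𝟙 (dup v)) * n
    ≡⟨ cong (_* n) (∑-vecs (allFin n) h (λ v → 𝟙 (dup v))) ⟩
  ∑ (allFin n) (λ x → ∑ Φ (λ v → 𝟙 (elem x v ∨ dup v))) * n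
    ≤⟨ *-monoˡ-≤ n (∑-mono (allFin n) (λ x → ≤-trans (∑-mono Φ (λ v → 𝟙-∨ (elem x v) (dup v))) (≤-reflexive (∑-+ Φ _ _)))) ⟩
  ∑ (allFin n) (λ x → ∑ Φ (λ v → 𝟙 (elem x v)) + D) * n
    ≡⟨ cong (_* n) (trans (∑-+ (allFin n) _ _) (cong₂ _+_ (∑-swap (allFin n) Φ _) (∑-allFin-const n D))) ⟩
  (∑ Φ (λ v → ∑ (allFin n) (λ x → 𝟙 (elem x v))) + n * D) * n
    ≤⟨ *-monoˡ-≤ n (+-monoˡ-≤ (n * D) (≤-trans (∑-mono Φ (λ v → ≤-trans (∑-elem v) (≤-reflexive (sym (*-identityʳ h)))))
         (≤-reflexive (trans (∑-*ˡ Φ h (λ _ → 1)) (cong (h *_) (∑-vecs-1 n h)))))) ⟩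
  (h * n ^ h + n * D) * n
    ≡⟨ lem₁ h (n ^ h) n D ⟩
  h * (n * n ^ h) + n * (D * n)
    ≤⟨ +-monoʳ-≤ _ (*-monoʳ-≤ n (few-dup n h)) ⟩
  h * (n * n ^ h) + n * (h * h * n ^ h)
    ≤⟨ m≤m+n _ ((1 + h) * (n * n ^ h)) ⟩
  h * (n * n ^ h) + n * (h * h * n ^ h) + (1 + h) * (n * n ^ h)
    ≡⟨ lem₂ h n (n ^ h) ⟩
  suc h * suc h * (n * n ^ h) ∎
  where
    open ≤-Reasoning
    Φ = vecs (allFin n) h
    D = ∑ Φ (λ v → 𝟙 (dup v))
    lem₁ : ∀ h p n d → (h * p + n * d) * n ≡ h * (n * p) + n * (d * n)
    lem₁ = solve-∀
    lem₂ : ∀ h n p → h * (n * p) + n * (h * h * p) + (1 + h) * (n * p) ≡ suc h * suc h * (n * p)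
    lem₂ = solve-∀

-- Codegrees

covers : ∀ {h} → List (Edge h) → Fin h → Bool
covers []            u = false
covers ((i , j) ∷ J) u = (eqᵇ i u ∨ eqᵇ j u) ∨ covers J u

covers-elim : ∀ {h} (J : List (Edge h)) u → covers J u ≡ true → ∃[ i ] ∃[ j ] ((i , j) ∈ J × (i ≡ u ⊎ j ≡ u))
covers-elim ((i , j) ∷ J) u p with ∨-true {eqᵇ i u ∨ eqᵇ j u} p
... | inj₂ q = let i' , j' , ∈J , eq = covers-elim J u q in i' , j' , there ∈J , eq
... | inj₁ q with ∨-true {eqᵇ i u} q
...   | inj₁ r = i , j , here refl , inj₁ (eqᵇ-true r)
...   | inj₂ r = i , j , here refl , inj₂ (eqᵇ-true r)

covers-intro : ∀ {h} {J : List (Edge h)} {i j} → (i , j) ∈ J → covers J i ≡ true × covers J j ≡ true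
covers-intro {i = i} {j} (here refl) = ∨-introˡ (∨-introˡ (eqᵇ-refl i)) , ∨-introˡ (∨-introʳ {eqᵇ i j} (eqᵇ-refl j))
covers-intro {J = (i' , j') ∷ J} {i} {j} (there p) = let a , b = covers-intro p in
  ∨-introʳ {eqᵇ i' i ∨ eqᵇ j' i} a , ∨-introʳ {eqᵇ i' j ∨ eqᵇ j' j} b

covered : ∀ {h} → List (Edge h) → ℕ
covered {h} J = ∑ (allFin h) (λ u → 𝟙 (covers J u))

∏-* : ∀ {h} (f g : Fin h → ℕ) → ∏ f * ∏ g ≡ ∏ (λ u → f u * g u)
∏-* {zero}  f g = refl
∏-* {suc h} f g = trans (lem (f zero) (∏ (f ∘ suc)) (g zero) (∏ (g ∘ suc))) (cong (f zero * g zero *_) (∏-* (f ∘ suc) (g ∘ suc)))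
  where lem : ∀ a b c d → a * b * (c * d) ≡ a * c * (b * d)
        lem = solve-∀

∏-power : ∀ {h} n (p : Fin h → Bool) → ∏ (λ u → if p u then n else 1) ≡ n ^ ∑ (allFin h) (λ u → 𝟙 (p u))
∏-power {zero}  n p = refl
∏-power {suc h} n p = trans (cong ((if p zero then n else 1) *_) (∏-power n (p ∘ suc)))
  (trans (factor (p zero) _) (cong (n ^_) (sym (∑-allFin-suc (λ u → 𝟙 (p u))))))
  where factor : ∀ b k → (if b then n else 1) * n ^ k ≡ n ^ (𝟙 b + k)
        factor true  k = refl
        factor false k = *-identityˡ _

coord : ∀ {n h} → Edge h → Vec (Fin n) h → Edge n
coord (i , j) φ = norm (lookup φ i) (lookup φ j)

-- Agreement on `J` forces each covered coordinate of `φ` into the image of `ψ`, leaving at most h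
-- choices, possibly with the two ends of an edge exchanged. The factor n for each covered vertex
-- makes all coordinates comparable with h n.
codegree : ∀ n h (J : List (Edge h)) (ψ : Vec (Fin n) h) (agrees : Vec (Fin n) h → Bool) →
  (∀ φ → agrees φ ≡ true → ∀ e → e ∈ J → coord e φ ≡ coord e ψ) →
  ∑ (vecs (allFin n) h) (λ φ → 𝟙 (agrees φ)) * n ^ covered J ≤ h ^ h * n ^ h
codegree n h J ψ agrees agrees⇒ = begin
  ∑ Φ (λ φ → 𝟙 (agrees φ)) * n ^ covered J
    ≤⟨ *-monoˡ-≤ (n ^ covered J) (∑-mono Φ (λ φ → ≤-trans (𝟙-mono (λ p → allF-intro (λ u → ⇒ᵇ-intro (in-image φ p u)))) (≤-reflexive (𝟙-allF _)))) ⟩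
  ∑ Φ (λ φ → ∏ (λ u → g u (lookup φ u))) * n ^ covered J
    ≡⟨ cong₂ _*_ (∑-∏ (allFin n) h g) (sym (∏-power n (covers J))) ⟩
  ∏ (λ u → ∑ (allFin n) (g u)) * ∏ (λ u → if covers J u then n else 1)
    ≡⟨ ∏-* (λ u → ∑ (allFin n) (g u)) (λ u → if covers J u then n else 1) ⟩
  ∏ (λ u → ∑ (allFin n) (g u) * (if covers J u then n else 1))
    ≤⟨ ∏-mono factor ⟩
  ∏ {h} (λ u → h * n)
    ≡⟨ trans (∏-const h (h * n)) (^-distribʳ-* h h n) ⟩
  h ^ h * n ^ h ∎
  where
    open ≤-Reasoning
    Φ = vecs (allFin n) h
    g : Fin h → Fin n → ℕ
    g u x = 𝟙 (covers J u ⇒ᵇ elem x ψ)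
    in-image : ∀ φ → agrees φ ≡ true → ∀ u → covers J u ≡ true → elem (lookup φ u) ψ ≡ true
    in-image φ p u c with covers-elim J u c
    ... | i , j , e∈ , i⊎j with norm-injective {i = lookup φ i} {lookup φ j} {lookup ψ i} {lookup ψ j} (agrees⇒ φ p (i , j) e∈) | i⊎j
    ...   | inj₁ (q , _) | inj₁ refl = trans (cong (λ x → elem x ψ) q) (elem-lookup ψ i)
    ...   | inj₁ (_ , q) | inj₂ refl = trans (cong (λ x → elem x ψ) q) (elem-lookup ψ j)
    ...   | inj₂ (q , _) | inj₁ refl = trans (cong (λ x → elem x ψ) q) (elem-lookup ψ j)
    ...   | inj₂ (_ , q) | inj₂ refl = trans (cong (λ x → elem x ψ) q) (elem-lookup ψ i)
    1≤ : ∀ {h} → Fin h → 1 ≤ h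
    1≤ u = ≤-<-trans z≤n (Fin.toℕ<n u)
    factor : ∀ u → ∑ (allFin n) (g u) * (if covers J u then n else 1) ≤ h * n
    factor u with covers J u in eq
    ... | true  = *-monoˡ-≤ n (≤-trans (∑-mono (allFin n) (λ x → 𝟙-mono {true ⇒ᵇ elem x ψ} (λ q → ⇒ᵇ-elim q refl))) (∑-elem ψ))
    ... | false = ≤-trans (≤-reflexive (*-identityʳ _)) (≤-trans (∑-mono (allFin n) (λ x → 𝟙≤1 (false ⇒ᵇ elem x ψ)))
                    (≤-trans (≤-reflexive (∑-allFin-const n 1)) (≤-trans (≤-reflexive (*-comm n 1)) (*-monoˡ-≤ n (1≤ u)))))

∑-sublist : ∀ {xs ys : List A} (f : A → ℕ) → xs ⊆ ys → ∑ xs f ≤ ∑ ys f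
∑-sublist f []         = ≤-refl
∑-sublist f (y ∷ʳ p)   = ≤-trans (∑-sublist f p) (m≤n+m _ (f y))
∑-sublist f (refl ∷ p) = +-monoʳ-≤ _ (∑-sublist f p)

-- Distinct edges are distinct pairs of covered vertices: this is |J| ≤ v (v - 1) / 2 without
-- subtraction.
edges≤pairs : ∀ {h} {J : List (Edge h)} → J ⊆ Ed h → 2 * length J + covered J ≤ covered J * covered J
edges≤pairs {h} {J} J⊆ = begin
  2 * length J + covered J
    ≤⟨ +-mono-≤ (*-monoʳ-≤ 2 (≤-trans (≤-reflexive (length-∑ J)) (≤-trans (∑-mono∈ J inside) (∑-sublist (λ (i , j) → s i * s j) J⊆))))
                (∑-mono V (λ u → square (covers J u))) ⟩
  2 * ∑ (Ed h) (λ (i , j) → s i * s j) + ∑ V (λ i → s i * s i)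
    ≡⟨ sym (∑∑-symmetric (λ i j → s i * s j) (λ i j → *-comm (s i) (s j))) ⟩
  ∑ V (λ i → ∑ V (λ j → s i * s j))
    ≡⟨ trans (∑-cong V (λ i → ∑-*ˡ V (s i) s)) (∑-*ʳ V (covered J) s) ⟩
  covered J * covered J ∎
  where
    open ≤-Reasoning
    V = allFin h
    s : Fin h → ℕ
    s u = 𝟙 (covers J u)
    square : ∀ b → 𝟙 b ≤ 𝟙 b * 𝟙 b
    square true  = ≤-refl
    square false = ≤-refl
    inside : ∀ e → e ∈ J → 1 ≤ s (proj₁ e) * s (proj₂ e)
    inside (i , j) e∈ = let a , b = covers-intro e∈ in ≤-reflexive (sym (cong₂ (λ x y → 𝟙 x * 𝟙 y) a b))

-- The 2-density

labels : ∀ {h} → Mat h → List (Edge h)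
labels {h} H = filterᵇ (on H) (Ed h)

labels⊆Ed : ∀ {h} (H : Mat h) → labels H ⊆ Ed h
labels⊆Ed {h} H = filter-⊆ _ (Ed h)

∣tabulate∣ : ∀ {h} (p : Fin h → Bool) → Subset.∣ Vec.tabulate p ∣ ≡ ∑ (allFin h) (λ u → 𝟙 (p u))
∣tabulate∣ {zero}  p = refl
∣tabulate∣ {suc h} p = trans (∣∷∣ (p zero) (Vec.tabulate (p ∘ suc)))
  (trans (cong (𝟙 (p zero) +_) (∣tabulate∣ (p ∘ suc))) (sym (∑-allFin-suc (λ u → 𝟙 (p u)))))
  where
    ∣∷∣ : ∀ {m} b (s : Subset.Subset m) → Subset.∣ b ∷ s ∣ ≡ 𝟙 b + Subset.∣ s ∣
    ∣∷∣ true  s = refl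
    ∣∷∣ false s = refl

ℤ-bound : ∀ x j q p v → suc j ≤ x → 3 ≤ v → (ℤ.+ x ℤ.- ℤ.+ 1) ℤ.* ℤ.+ q ℤ.≤ ℤ.+ p ℤ.* (ℤ.+ v ℤ.- ℤ.+ 2) → j * q ≤ p * (v ∸ 2)
ℤ-bound x j q p 1 _ (s≤s ()) _
ℤ-bound x j q p 2 _ (s≤s (s≤s ())) _
ℤ-bound (suc x) j q p (suc (suc (suc v))) (s≤s j≤x) _ le = ≤-trans (*-monoˡ-≤ q j≤x)
  (ℤ.drop‿+≤+ (subst₂ ℤ._≤_ (sym (ℤ.pos-* x q)) (sym (ℤ.pos-* p (suc v))) le))

edgeIn : ∀ {h} → List (Edge h) → Edge h → Bool
edgeIn []      e = false
edgeIn (f ∷ J) e = does (f ≟ᴱ e) ∨ edgeIn J e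

edgeIn-elim : ∀ {h} (J : List (Edge h)) {e} → edgeIn J e ≡ true → e ∈ J
edgeIn-elim (f ∷ J) {e} p with ∨-true {does (f ≟ᴱ e)} p
... | inj₁ q = here (sym (from-does (f ≟ᴱ e) q))
... | inj₂ q = there (edgeIn-elim J q)

edgeIn-intro : ∀ {h} {J : List (Edge h)} {e} → e ∈ J → edgeIn J e ≡ true
edgeIn-intro {e = e} (here refl) = ∨-introˡ (does-true (e ≟ᴱ e) refl)
edgeIn-intro {J = f ∷ J} {e} (there p) = ∨-introʳ {does (f ≟ᴱ e)} (edgeIn-intro p)

∈-sublist : ∀ {xs ys : List A} {x} → xs ⊆ ys → x ∈ xs → x ∈ ys
∈-sublist (y ∷ʳ p)   x∈          = there (∈-sublist p x∈)
∈-sublist (refl ∷ p) (here refl) = here refl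
∈-sublist (refl ∷ p) (there x∈)  = there (∈-sublist p x∈)

-- The maximum is applied to the subgraph formed by the edges of `J` on the vertices they cover. Its
-- vertex count has to be exact, whereas for the edges a lower bound suffices.
m₂-bound : ∀ {h} {H : Mat h} {p q} → IsGraph H → IsM2 H p q → ∀ {J} → J ⊆ labels H → 3 ≤ covered J →
           (length J ∸ 1) * q ≤ p * (covered J ∸ 2)
m₂-bound {H = H} isH m₂ {[]} J⊆ 3≤v = z≤n
m₂-bound {h} {H} {p} {q} isH m₂ {J@(_ ∷ J')} J⊆ 3≤v =
  ℤ-bound (e E) (length J') q p (covered J) J≤e 3≤v
    (subst (λ v → (ℤ.+ e E ℤ.- ℤ.+ 1) ℤ.* ℤ.+ q ℤ.≤ ℤ.+ p ℤ.* (ℤ.+ v ℤ.- ℤ.+ 2)) ∣S∣ (proj₂ (proj₂ m₂) S E (isE , E⊆H , E⊆S) (subst (3 ≤_) (sym ∣S∣) 3≤v)))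
  where
    S : Subset.Subset h
    S = Vec.tabulate (covers J)
    ∣S∣ : Subset.∣ S ∣ ≡ covered J
    ∣S∣ = ∣tabulate∣ (covers J)
    J⊆Ed : J ⊆ Ed h
    J⊆Ed = ⊆-trans J⊆ (labels⊆Ed H)
    E : Mat h
    E = fromAdj (adjOf (edgeIn J))
    isE : IsGraph E
    isE = fromAdj-isGraph (adjOf-irrefl (edgeIn J)) (adjOf-sym (edgeIn J))
    norm∈J : ∀ i j → adj E i j ≡ true → norm i j ∈ J
    norm∈J i j q = edgeIn-elim J (proj₂ (∧-true {not (eqᵇ i j)} (trans (sym (adj-fromAdj (adjOf (edgeIn J)) i j)) q)))
    E⊆H : E ⊆E H
    E⊆H i j q = trans (sym (on-norm {G = H} isH i j)) (proj₂ (∈-filterᵇ⁻ (on H) (Ed h) (∈-sublist J⊆ (norm∈J i j q))))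
    ∈S : ∀ {u} → covers J u ≡ true → u Subset.∈ S
    ∈S {u} c = Vec.lookup⇒[]= u S (trans (Vec.lookup∘tabulate (covers J) u) c)
    E⊆S : ∀ i j → adj E i j ≡ true → (i Subset.∈ S) × (j Subset.∈ S)
    E⊆S i j q with norm-cases i j | norm∈J i j q
    ... | inj₁ eq | ∈J = let a , b = covers-intro (subst (_∈ J) eq ∈J) in ∈S a , ∈S b
    ... | inj₂ eq | ∈J = let a , b = covers-intro (subst (_∈ J) eq ∈J) in ∈S b , ∈S a
    J≤e : length J ≤ e E
    J≤e = ≤-trans (≤-reflexive (length-∑ J)) (≤-trans (∑-mono∈ J (λ (i , j) e∈ → ≤-reflexive (sym (cong 𝟙
            (trans (adj-fromAdj (adjOf (edgeIn J)) i j) (trans (adjOf-< (edgeIn J) (∈Ed⁻ (∈-sublist J⊆Ed e∈))) (edgeIn-intro e∈)))))))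
            (≤-trans (∑-sublist (λ v → 𝟙 (on E v)) J⊆Ed) (≤-reflexive (sym (e-∑ E)))))

two-members : ∀ {xs : List A} {x y} (f : A → ℕ) → x ∈ xs → y ∈ xs → x ≢ y → f x + f y ≤ ∑ xs f
two-members f (here refl) (here refl) x≢y = ⊥-elim (x≢y refl)
two-members f (here refl) (there y∈)  x≢y = +-monoʳ-≤ _ (∑-∈-≤ f y∈)
two-members {y = y} f (there x∈) (here refl) x≢y = ≤-trans (≤-reflexive (+-comm _ (f y))) (+-monoʳ-≤ _ (∑-∈-≤ f x∈))
two-members {xs = z ∷ _} f (there x∈) (there y∈) x≢y = ≤-trans (two-members f x∈ y∈ x≢y) (m≤n+m _ (f z))

-- A graph without a path l < i < j is 2-colourable: colour i by whether it has a smaller neighbour.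
monotone-path : ∀ {h} {H : Mat h} → IsGraph H → ¬ Colourable H 2 →
  ∃[ l ] ∃[ i ] ∃[ j ] (toℕ l < toℕ i × toℕ i < toℕ j × adj H l i ≡ true × adj H i j ≡ true)
monotone-path {h} {H} isH ¬2col with findᵇ (λ (l , i , j) → (ltᵇ l i ∧ ltᵇ i j) ∧ (adj H l i ∧ adj H i j)) (cartesianProduct V (cartesianProduct V V))
  where V = allFin h
... | inj₁ ((l , i , j) , _ , p) =
  let a , b = ∧-true {ltᵇ l i ∧ ltᵇ i j} p ; c , d = ∧-true {ltᵇ l i} a ; x , y = ∧-true {adj H l i} b in
  l , i , j , <ᵇ-true c , <ᵇ-true d , x , y
... | inj₂ none = ⊥-elim (¬2col (colour , proper))
  where
    V = allFin h
    back : Fin h → ℕ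
    back i = ∑ V (λ l → 𝟙 (ltᵇ l i ∧ adj H l i))
    colour : Fin h → Fin 2
    colour i = if back i ≡ᵇ 0 then zero else suc zero
    no-path : ∀ {l i j} → toℕ l < toℕ i → toℕ i < toℕ j → adj H l i ≡ true → adj H i j ≡ true → ⊥
    no-path {l} {i} {j} l<i i<j x y = true≢false (∧-intro (∧-intro (true-<ᵇ l<i) (true-<ᵇ i<j)) (∧-intro x y))
      (none (l , i , j) (∈-cartesianProduct⁺ (∈-allFin l) (∈-cartesianProduct⁺ (∈-allFin i) (∈-allFin j))))
    upper : ∀ {i j} → toℕ i < toℕ j → adj H i j ≡ true → colour j ≡ suc zero
    upper {i} {j} lt x with back j in eq
    ... | suc _ = refl
    ... | zero  = ⊥-elim (<-irrefl refl (≤-trans (≤-reflexive (sym (cong 𝟙 (∧-intro (true-<ᵇ lt) x))))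
          (≤-trans (∑-∈-≤ (λ l → 𝟙 (ltᵇ l j ∧ adj H l j)) (∈-allFin i)) (≤-reflexive eq))))
    lower : ∀ {i j} → toℕ i < toℕ j → adj H i j ≡ true → colour i ≡ zero
    lower {i} {j} lt x with back i in eq
    ... | zero  = refl
    ... | suc _ with ∑-pos V (λ l → 𝟙 (ltᵇ l i ∧ adj H l i)) (subst (0 <_) (sym eq) (s≤s z≤n))
    ...   | l , _ , pos = let a , b = ∧-true {ltᵇ l i} (𝟙-pos pos) in ⊥-elim (no-path (<ᵇ-true a) lt b x)
    differ : ∀ {i j} → toℕ i < toℕ j → adj H i j ≡ true → colour i ≢ colour j
    differ lt x eq with trans (sym (lower lt x)) (trans eq (upper lt x))
    ... | ()
    proper : ProperColouring H 2 colour
    proper i j x eq with i Fin.≟ j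
    ... | yes refl = true≢false x (proj₁ isH i)
    ... | no i≢j with ≢⇒<⊎> i≢j
    ...   | inj₁ lt = differ lt x eq
    ...   | inj₂ gt = differ gt (trans (sym (proj₂ isH i j)) x) (sym eq)

square-bound : ∀ v → 4 + v ≤ v * v → 3 ≤ v
square-bound 1 (s≤s ())
square-bound 2 (s≤s (s≤s (s≤s (s≤s ()))))
square-bound (suc (suc (suc v))) _ = s≤s (s≤s (s≤s z≤n))

-- A path with two edges has 2-density 1. Its increasing vertex order puts both edges among `labels`
-- as they stand. The bound is what later gives m ≥ n.
m₂≥1 : ∀ {h} {H : Mat h} {p q} → IsGraph H → ¬ Colourable H 2 → IsM2 H p q → q ≤ p
m₂≥1 {h} {H} {p} {q} isH ¬2col m₂ with monotone-path {H = H} isH ¬2col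
... | l , i , j , l<i , i<j , li , ij = begin
  q                          ≡⟨ sym (*-identityˡ q) ⟩
  1 * q                      ≤⟨ *-monoˡ-≤ q (∸-monoˡ-≤ 1 2≤J) ⟩
  (length J ∸ 1) * q         ≤⟨ m₂-bound {H = H} {p} {q} isH m₂ J⊆ 3≤v ⟩
  p * (covered J ∸ 2)        ≤⟨ *-monoʳ-≤ p (∸-monoˡ-≤ 2 v≤3) ⟩
  p * 1                      ≡⟨ *-identityʳ p ⟩
  p                          ∎
  where
    open ≤-Reasoning
    on-path : Edge h → Bool
    on-path e = does (e ≟ᴱ (l , i)) ∨ does (e ≟ᴱ (i , j))
    J = filterᵇ on-path (labels H)
    J⊆ : J ⊆ labels H
    J⊆ = filter-⊆ _ (labels H)
    2≤J : 2 ≤ length J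
    2≤J = begin
      2                                                ≡⟨ sym (cong₂ (λ a b → 𝟙 a + 𝟙 b) (∨-introˡ (does-true ((l , i) ≟ᴱ (l , i)) refl))
                                                            (∨-introʳ {does ((i , j) ≟ᴱ (l , i))} (does-true ((i , j) ≟ᴱ (i , j)) refl))) ⟩
      𝟙 (on-path (l , i)) + 𝟙 (on-path (i , j))        ≤⟨ two-members (𝟙 ∘ on-path) (∈-filterᵇ⁺ (on H) (Ed h) (∈Ed⁺ l<i) li)
                                                            (∈-filterᵇ⁺ (on H) (Ed h) (∈Ed⁺ i<j) ij) (λ eq → <-irrefl (cong (toℕ ∘ proj₁) eq) l<i) ⟩
      ∑ (labels H) (𝟙 ∘ on-path)                       ≡⟨ sym (length-filterᵇ on-path (labels H)) ⟩
      length J                                         ∎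
    3≤v : 3 ≤ covered J
    3≤v = square-bound (covered J) (≤-trans (+-monoˡ-≤ (covered J) (*-monoʳ-≤ 2 2≤J)) (edges≤pairs (⊆-trans J⊆ (labels⊆Ed H))))
    v≤3 : covered J ≤ 3
    v≤3 = begin
      covered J
        ≤⟨ ∑-mono (allFin h) on-vertices ⟩
      ∑ (allFin h) (λ u → 𝟙 (eqᵇ l u) + (𝟙 (eqᵇ i u) + 𝟙 (eqᵇ j u)))
        ≡⟨ trans (∑-+ (allFin h) _ _) (cong₂ _+_ (∑-eqᵇ-1 l) (trans (∑-+ (allFin h) _ _) (cong₂ _+_ (∑-eqᵇ-1 i) (∑-eqᵇ-1 j)))) ⟩
      3 ∎
      where
        among : ∀ u → u ≡ l ⊎ u ≡ i ⊎ u ≡ j → 1 ≤ 𝟙 (eqᵇ l u) + (𝟙 (eqᵇ i u) + 𝟙 (eqᵇ j u))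
        among u (inj₁ refl) rewrite eqᵇ-refl l = s≤s z≤n
        among u (inj₂ (inj₁ refl)) rewrite eqᵇ-refl u = ≤-trans (m≤m+n 1 (𝟙 (eqᵇ j u))) (m≤n+m _ (𝟙 (eqᵇ l u)))
        among u (inj₂ (inj₂ refl)) rewrite eqᵇ-refl u = ≤-trans (m≤n+m 1 (𝟙 (eqᵇ i u))) (m≤n+m _ (𝟙 (eqᵇ l u)))
        endpoint : ∀ {a b} u → (a , b) ∈ J → a ≡ u ⊎ b ≡ u → u ≡ l ⊎ u ≡ i ⊎ u ≡ j
        endpoint {a} {b} u ∈J w with ∨-true {does ((a , b) ≟ᴱ (l , i))} (proj₂ (∈-filterᵇ⁻ on-path (labels H) ∈J)) | w
        ... | inj₁ q | inj₁ refl = inj₁ (cong proj₁ (from-does ((a , b) ≟ᴱ (l , i)) q))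
        ... | inj₁ q | inj₂ refl = inj₂ (inj₁ (cong proj₂ (from-does ((a , b) ≟ᴱ (l , i)) q)))
        ... | inj₂ q | inj₁ refl = inj₂ (inj₁ (cong proj₁ (from-does ((a , b) ≟ᴱ (i , j)) q)))
        ... | inj₂ q | inj₂ refl = inj₂ (inj₂ (cong proj₂ (from-does ((a , b) ≟ᴱ (i , j)) q)))
        on-vertices : ∀ u → 𝟙 (covers J u) ≤ 𝟙 (eqᵇ l u) + (𝟙 (eqᵇ i u) + 𝟙 (eqᵇ j u))
        on-vertices u with covers J u in eq
        ... | false = z≤n
        ... | true  = let a , b , ∈J , w = covers-elim J u eq in among u (endpoint u ∈J w)

-- Estimates

-- The identity (k + 1) C(n, k + 1) = (n - k) C(n, k) with the negative term moved across.
absorption : ∀ n k → bin n (suc k) * suc k + k * bin n k ≡ n * bin n k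
absorption zero    zero    = refl
absorption zero    (suc k) = *-zeroʳ (suc k)
absorption (suc n) zero    = cong suc (absorption n zero)
absorption (suc n) (suc k) = begin
  (A₁ + A₂) * suc (suc k) + suc k * (A₀ + A₁)
    ≡⟨ lem₁ k A₀ A₁ A₂ ⟩
  (A₂ * suc (suc k) + suc k * A₁) + (A₁ + ((A₁ * suc k + k * A₀) + A₀))
    ≡⟨ cong₂ (λ x y → x + (A₁ + (y + A₀))) (absorption n (suc k)) (absorption n k) ⟩
  n * A₁ + (A₁ + (n * A₀ + A₀))
    ≡⟨ lem₂ n A₀ A₁ ⟩
  suc n * (A₀ + A₁) ∎
  where
    open ≡-Reasoning
    A₀ = bin n k
    A₁ = bin n (suc k)
    A₂ = bin n (suc (suc k))
    lem₁ : ∀ k a b c → (b + c) * suc (suc k) + suc k * (a + b) ≡ (c * suc (suc k) + suc k * b) + (b + ((b * suc k + k * a) + a))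
    lem₁ = solve-∀
    lem₂ : ∀ n a b → n * b + (b + (n * a + a)) ≡ suc n * (a + b)
    lem₂ = solve-∀

bin-ratio : ∀ n k → bin n (suc k) * suc k ≡ (n ∸ k) * bin n k
bin-ratio n k = begin
  bin n (suc k) * suc k                              ≡⟨ sym (m+n∸n≡m _ (k * bin n k)) ⟩
  bin n (suc k) * suc k + k * bin n k ∸ k * bin n k  ≡⟨ cong (_∸ k * bin n k) (absorption n k) ⟩
  n * bin n k ∸ k * bin n k                          ≡⟨ sym (*-distribʳ-∸ (bin n k) n k) ⟩
  (n ∸ k) * bin n k                                  ∎
  where open ≡-Reasoning

-- The gap says that M - m ≥ N / Λ, so choosing one edge less divides the binomial coefficient by at
-- least N / (Λ (k + 1)). This pays for the position of a yes answer.
bin-growth : ∀ {M N Λ m} → N + Λ * m ≤ Λ * M → ∀ {k} → k ≤ m → N * bin M k ≤ Λ * (bin M (suc k) * suc k)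
bin-growth {M} {N} {Λ} {m} gap {k} k≤m = +-cancelʳ-≤ (Λ * m * bin M k) _ _ (begin
  N * bin M k + Λ * m * bin M k                      ≡⟨ sym (*-distribʳ-+ (bin M k) N (Λ * m)) ⟩
  (N + Λ * m) * bin M k                              ≤⟨ *-monoˡ-≤ (bin M k) gap ⟩
  Λ * M * bin M k                                    ≡⟨ *-assoc Λ M (bin M k) ⟩
  Λ * (M * bin M k)                                  ≡⟨ cong (Λ *_) (sym (absorption M k)) ⟩
  Λ * (bin M (suc k) * suc k + k * bin M k)          ≡⟨ *-distribˡ-+ Λ (bin M (suc k) * suc k) (k * bin M k) ⟩
  Λ * (bin M (suc k) * suc k) + Λ * (k * bin M k)    ≤⟨ +-monoʳ-≤ (Λ * (bin M (suc k) * suc k)) (*-monoʳ-≤ Λ (*-monoˡ-≤ (bin M k) k≤m)) ⟩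
  Λ * (bin M (suc k) * suc k) + Λ * (m * bin M k)    ≡⟨ cong (Λ * (bin M (suc k) * suc k) +_) (sym (*-assoc Λ m (bin M k))) ⟩
  Λ * (bin M (suc k) * suc k) + Λ * m * bin M k      ∎)
  where open ≤-Reasoning

module _ (N Y : ℕ) where

  -- overhead u s = Σ_{j ≤ s} C(u,j) Y^j N^(s-j)
  overhead : ℕ → ℕ → ℕ
  overhead zero    s       = N ^ s
  overhead (suc u) zero    = 1
  overhead (suc u) (suc s) = overhead u (suc s) + Y * overhead u s

  -- Chernoff's trick: for j ≤ s one has Y^j ≤ w^s (Y / w)^j, and then the truncated sum is
  -- completed to a binomial power. The price w^s buys a base 1 + Y / (N w) close to 1.
  overhead-bound : ∀ w {{_ : NonZero w}} u s → overhead u s * (N * w) ^ u ≤ (N * w) ^ s * (N * w + Y) ^ u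
  overhead-bound w zero    s       = *-monoˡ-≤ 1 (^-monoˡ-≤ s (m≤m*n N w))
  overhead-bound w (suc u) zero    = ≤-trans (≤-reflexive (+-identityʳ _)) (≤-trans (^-monoˡ-≤ (suc u) (m≤m+n (N * w) Y)) (≤-reflexive (sym (+-identityʳ _))))
  overhead-bound w (suc u) (suc s) = begin
    (overhead u (suc s) + Y * overhead u s) * (W * W ^ u)
      ≡⟨ lem₁ (overhead u (suc s)) Y (overhead u s) W (W ^ u) ⟩
    overhead u (suc s) * W ^ u * W + overhead u s * W ^ u * (W * Y)
      ≤⟨ +-mono-≤ (*-monoˡ-≤ W (overhead-bound w u (suc s))) (*-monoˡ-≤ (W * Y) (overhead-bound w u s)) ⟩
    W * W ^ s * (W + Y) ^ u * W + W ^ s * (W + Y) ^ u * (W * Y)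
      ≡⟨ lem₂ W Y (W ^ s) ((W + Y) ^ u) ⟩
    W * W ^ s * ((W + Y) * (W + Y) ^ u) ∎
    where
      open ≤-Reasoning
      W = N * w
      lem₁ : ∀ a y b w p → (a + y * b) * (w * p) ≡ a * p * w + b * p * (w * y)
      lem₁ = solve-∀
      lem₂ : ∀ w y p q → w * p * q * w + p * q * (w * y) ≡ w * p * ((w + y) * q)
      lem₂ = solve-∀

budget-bound : ∀ {M N Λ m} → N + Λ * m ≤ Λ * M → ∀ u s {k} → k ≤ m →
               budget M u s k * N ^ s ≤ bin M k * overhead N (2 * Λ * m) u s
budget-bound gap zero    s       k≤m = ≤-refl
budget-bound gap (suc u) zero    k≤m = ≤-refl
budget-bound {M} {N} {Λ} {m} gap (suc u) (suc s) {zero} k≤m = ≤-trans (budget-bound {M} {N} {Λ} {m} gap u (suc s) {zero} k≤m)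
  (*-monoʳ-≤ 1 (m≤m+n (overhead N (2 * Λ * m) u (suc s)) _))
budget-bound {M} {N} {Λ} {m} gap (suc u) (suc s) {suc k} k<m = begin
  (budget M u (suc s) (suc k) + 2 * budget M u s k) * (N * N ^ s)
    ≡⟨ lem₁ (budget M u (suc s) (suc k)) (budget M u s k) N (N ^ s) ⟩
  budget M u (suc s) (suc k) * (N * N ^ s) + 2 * N * (budget M u s k * N ^ s)
    ≤⟨ +-mono-≤ (budget-bound {M} {N} {Λ} {m} gap u (suc s) k<m) (*-monoʳ-≤ (2 * N) (budget-bound {M} {N} {Λ} {m} gap u s (<⇒≤ k<m))) ⟩
  B * o₁ + 2 * N * (bin M k * o₀)
    ≡⟨ lem₂ B o₁ N (bin M k) o₀ ⟩
  B * o₁ + 2 * o₀ * (N * bin M k)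
    ≤⟨ +-monoʳ-≤ (B * o₁) (*-monoʳ-≤ (2 * o₀) (≤-trans (bin-growth {M} {N} {Λ} {m} gap (<⇒≤ k<m)) (*-monoʳ-≤ Λ (*-monoʳ-≤ B k<m)))) ⟩
  B * o₁ + 2 * o₀ * (Λ * (B * m))
    ≡⟨ lem₃ B o₁ o₀ Λ m ⟩
  B * (o₁ + 2 * Λ * m * o₀) ∎
  where
    open ≤-Reasoning
    B = bin M (suc k)
    o₁ = overhead N (2 * Λ * m) u (suc s)
    o₀ = overhead N (2 * Λ * m) u s
    lem₁ : ∀ a b n p → (a + 2 * b) * (n * p) ≡ a * (n * p) + 2 * n * (b * p)
    lem₁ = solve-∀
    lem₂ : ∀ b o n c x → b * o + 2 * n * (c * x) ≡ b * o + 2 * x * (n * c)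
    lem₂ = solve-∀
    lem₃ : ∀ b o x l m → b * o + 2 * x * (l * (b * m)) ≡ b * (o + 2 * l * m * x)
    lem₃ = solve-∀

budget-closed : ∀ {M N Λ m} {{_ : NonZero N}} w {{_ : NonZero w}} → N + Λ * m ≤ Λ * M → ∀ u s →
  budget M u s m * (N * w) ^ u ≤ bin M m * (w ^ s * (N * w + 2 * Λ * m) ^ u)
budget-closed {M} {N} {Λ} {m} w gap u s = *-cancelʳ-≤ _ _ (N ^ s) {{m^n≢0 N s}} (begin
  budget M u s m * W ^ u * N ^ s
    ≡⟨ lem₁ (budget M u s m) (W ^ u) (N ^ s) ⟩
  budget M u s m * N ^ s * W ^ u
    ≤⟨ *-monoˡ-≤ (W ^ u) (budget-bound {M} {N} {Λ} {m} gap u s ≤-refl) ⟩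
  bin M m * overhead N (2 * Λ * m) u s * W ^ u
    ≡⟨ *-assoc (bin M m) _ (W ^ u) ⟩
  bin M m * (overhead N (2 * Λ * m) u s * W ^ u)
    ≤⟨ *-monoʳ-≤ (bin M m) (overhead-bound N (2 * Λ * m) w u s) ⟩
  bin M m * (W ^ s * (W + 2 * Λ * m) ^ u)
    ≡⟨ cong (λ k → bin M m * (k * (W + 2 * Λ * m) ^ u)) (^-distribʳ-* s N w) ⟩
  bin M m * (N ^ s * w ^ s * (W + 2 * Λ * m) ^ u)
    ≡⟨ lem₂ (bin M m) (N ^ s) (w ^ s) ((W + 2 * Λ * m) ^ u) ⟩
  bin M m * (w ^ s * (W + 2 * Λ * m) ^ u) * N ^ s ∎)
  where
    open ≤-Reasoning
    W = N * w
    lem₁ : ∀ a b c → a * b * c ≡ a * c * b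
    lem₁ = solve-∀
    lem₂ : ∀ a b c d → a * (b * c * d) ≡ a * (c * d) * b
    lem₂ = solve-∀

-- Compare factor by factor: the gap is Y (M' - m) ≤ (Y + 1)(M - m) without subtraction, and it
-- gives the same for every k ≤ m. The excess of M' over M thus costs only (1 + 1 / Y)^m.
bin-compare : ∀ {M M' Y m} → Y * M' + m ≤ Y * M + M → m ≤ M → ∀ {k} → k ≤ m → bin M' k * Y ^ k ≤ bin M k * suc Y ^ k
bin-compare gap m≤M {zero} k≤m = ≤-refl
bin-compare {M} {M'} {Y} {m} gap m≤M {suc k} k<m = *-cancelʳ-≤ _ _ (suc k) (begin
  bin M' (suc k) * (Y * Y ^ k) * suc k           ≡⟨ lem₁ (bin M' (suc k)) Y (Y ^ k) k ⟩
  bin M' (suc k) * suc k * (Y * Y ^ k)           ≡⟨ cong (_* (Y * Y ^ k)) (bin-ratio M' k) ⟩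
  (M' ∸ k) * bin M' k * (Y * Y ^ k)              ≡⟨ lem₂ (M' ∸ k) (bin M' k) Y (Y ^ k) ⟩
  Y * (M' ∸ k) * (bin M' k * Y ^ k)              ≤⟨ *-mono-≤ factor (bin-compare {M} {M'} gap m≤M (<⇒≤ k<m)) ⟩
  suc Y * (M ∸ k) * (bin M k * suc Y ^ k)        ≡⟨ sym (lem₂ (M ∸ k) (bin M k) (suc Y) (suc Y ^ k)) ⟩
  (M ∸ k) * bin M k * (suc Y * suc Y ^ k)        ≡⟨ cong (_* (suc Y * suc Y ^ k)) (sym (bin-ratio M k)) ⟩
  bin M (suc k) * suc k * (suc Y * suc Y ^ k)    ≡⟨ sym (lem₁ (bin M (suc k)) (suc Y) (suc Y ^ k) k) ⟩
  bin M (suc k) * (suc Y * suc Y ^ k) * suc k    ∎)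
  where
    open ≤-Reasoning
    lem₁ : ∀ b y p k → b * (y * p) * suc k ≡ b * suc k * (y * p)
    lem₁ = solve-∀
    lem₂ : ∀ a b y p → a * b * (y * p) ≡ y * a * (b * p)
    lem₂ = solve-∀
    lem₃ : ∀ y k t → y * (k + t) + (k + t) ≡ y * k + suc y * t + k
    lem₃ = solve-∀
    k≤M : k ≤ M
    k≤M = ≤-trans (<⇒≤ k<m) m≤M
    factor : Y * (M' ∸ k) ≤ suc Y * (M ∸ k)
    factor = ≤-trans (≤-reflexive (*-distribˡ-∸ Y M' k)) (m≤n+o⇒m∸n≤o (Y * M') (Y * k) (+-cancelʳ-≤ k _ _ (begin
      Y * M' + k                          ≤⟨ +-monoʳ-≤ (Y * M') (<⇒≤ k<m) ⟩
      Y * M' + m                          ≤⟨ gap ⟩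
      Y * M + M                           ≡⟨ cong (λ x → Y * x + x) (sym (m+[n∸m]≡n k≤M)) ⟩
      Y * (k + (M ∸ k)) + (k + (M ∸ k))   ≡⟨ lem₃ Y k (M ∸ k) ⟩
      Y * k + suc Y * (M ∸ k) + k         ∎)))

^-*-comm : ∀ a m n → (a ^ m) ^ n ≡ (a ^ n) ^ m
^-*-comm a m n = trans (^-*-assoc a m n) (trans (cong (a ^_) (*-comm m n)) (sym (^-*-assoc a n m)))

-- With Y = j + x this is (1 + 1 / Y)^j ≤ Y / (Y - j), a form of Bernoulli's inequality. The
-- induction moves a unit from j to x and keeps Y.
suc-power : ∀ j x → suc (j + x) ^ j * x ≤ (j + x) ^ suc j
suc-power zero    x = ≤-reflexive (trans (+-identityʳ x) (sym (*-identityʳ x)))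
suc-power (suc j) x = begin
  suc Y * suc Y ^ j * x       ≡⟨ lem₁ (suc Y) (suc Y ^ j) x ⟩
  suc Y ^ j * (suc Y * x)     ≤⟨ *-monoʳ-≤ (suc Y ^ j) (≤-trans (+-monoˡ-≤ (Y * x) (m≤n+m x (suc j))) (≤-reflexive (sym (*-suc Y x)))) ⟩
  suc Y ^ j * (Y * suc x)     ≡⟨ lem₂ (suc Y ^ j) Y (suc x) ⟩
  Y * (suc Y ^ j * suc x)     ≤⟨ *-monoʳ-≤ Y (subst (λ z → suc z ^ j * suc x ≤ z ^ suc j) (+-suc j x) (suc-power j (suc x))) ⟩
  Y * Y ^ suc j               ∎
  where
    open ≤-Reasoning
    Y = suc j + x
    lem₁ : ∀ a b c → a * b * c ≡ b * (a * c)
    lem₁ = solve-∀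
    lem₂ : ∀ a b c → a * (b * c) ≡ b * (a * c)
    lem₂ = solve-∀

suc-power≤2 : ∀ t Y → 2 * t ≤ Y → suc Y ^ t ≤ 2 * Y ^ t
suc-power≤2 zero    Y le = s≤s z≤n
suc-power≤2 t@(suc _) Y le with m≤n⇒∃[o]m+o≡n le
... | o , refl = *-cancelʳ-≤ _ _ (t + o) (begin
  suc (2 * t + o) ^ t * (t + o)     ≡⟨ cong (λ z → suc z ^ t * (t + o)) (sym (assoc t o)) ⟩
  suc (t + (t + o)) ^ t * (t + o)   ≤⟨ suc-power t (t + o) ⟩
  (t + (t + o)) * (t + (t + o)) ^ t ≤⟨ *-monoˡ-≤ _ (+-monoˡ-≤ (t + o) (m≤m+n t o)) ⟩
  (t + o + (t + o)) * (t + (t + o)) ^ t ≡⟨ lem (t + o) _ ⟩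
  2 * (t + (t + o)) ^ t * (t + o)   ≡⟨ cong (λ z → 2 * z ^ t * (t + o)) (assoc t o) ⟩
  2 * (2 * t + o) ^ t * (t + o)     ∎)
  where
    open ≤-Reasoning
    assoc : ∀ t o → t + (t + o) ≡ 2 * t + o
    assoc = solve-∀
    lem : ∀ x p → (x + x) * p ≡ 2 * p * x
    lem = solve-∀

-- Since 1 + (m + 1) / Z ≤ (1 + m / Z)(1 + 1 / Z), each unit of m costs one factor 1 + 1 / Z, whose
-- t-th power is at most 2.
plus-power : ∀ t Z {{_ : NonZero Z}} → 2 * t ≤ Z → ∀ m → (Z + m) ^ t ≤ 2 ^ m * Z ^ t
plus-power t Z le zero    = ≤-reflexive (trans (cong (_^ t) (+-identityʳ Z)) (sym (+-identityʳ _)))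
plus-power t Z le (suc m) = *-cancelʳ-≤ _ _ (Z ^ t) {{m^n≢0 Z t}} (begin
  (Z + suc m) ^ t * Z ^ t             ≡⟨ sym (^-distribʳ-* t (Z + suc m) Z) ⟩
  ((Z + suc m) * Z) ^ t               ≤⟨ ^-monoˡ-≤ t (≤-trans (m≤m+n _ m) (≤-reflexive (lem₁ Z m))) ⟩
  ((Z + m) * suc Z) ^ t               ≡⟨ ^-distribʳ-* t (Z + m) (suc Z) ⟩
  (Z + m) ^ t * suc Z ^ t             ≤⟨ *-mono-≤ (plus-power t Z le m) (suc-power≤2 t Z le) ⟩
  2 ^ m * Z ^ t * (2 * Z ^ t)         ≡⟨ lem₂ (2 ^ m) (Z ^ t) ⟩
  2 * 2 ^ m * Z ^ t * Z ^ t           ∎)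
  where
    open ≤-Reasoning
    lem₁ : ∀ z m → (z + suc m) * z + m ≡ (z + m) * suc z
    lem₁ = solve-∀
    lem₂ : ∀ p z → p * z * (2 * z) ≡ 2 * p * z * z
    lem₂ = solve-∀

n≤2^n : ∀ n → n ≤ 2 ^ n
n≤2^n zero    = z≤n
n≤2^n (suc n) = ≤-trans (+-mono-≤ (m^n>0 2 n) (n≤2^n n)) (≤-reflexive (cong (2 ^ n +_) (sym (+-identityʳ _))))

^-cancel-≤ : ∀ τ {{_ : NonZero τ}} {x y} → x ^ τ ≤ y ^ τ → x ≤ y
^-cancel-≤ τ@(suc _) {x} {y} le with x ≤? y
... | yes p = p
... | no ¬p = ⊥-elim (<-irrefl refl (<-≤-trans (^-monoˡ-< τ (≰⇒> ¬p)) le))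

-- All losses are compared with 2^m after raising to the power τ, which avoids roots.
exponential-gain : ∀ {x d u s m M M' N Λ τ β} {{_ : NonZero N}} {{_ : NonZero Λ}} {{_ : NonZero τ}} →
  u ≤ N → m ≤ M → N + Λ * m ≤ Λ * M' → 2 * τ * M' + m ≤ 2 * τ * M + M →
  (4 * Λ * τ) ^ (s * τ) ≤ 2 ^ m → 4 * m ≤ d * τ → β ^ τ ≤ 2 ^ m →
  x * 2 ^ d ≤ budget M' u s m → x * β ≤ bin M m
exponential-gain {x} {d} {u} {s} {m} {M} {M'} {N} {Λ} {τ} {β} u≤N m≤M gap gap' few d≥ β≤ count =
  ^-cancel-≤ τ (*-cancelʳ-≤ _ _ (2 ^ (3 * m)) {{m^n≢0 2 (3 * m)}} (begin
    (x * β) ^ τ * 2 ^ (3 * m)                ≡⟨ cong (_* 2 ^ (3 * m)) (^-distribʳ-* τ x β) ⟩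
    x ^ τ * β ^ τ * 2 ^ (3 * m)              ≤⟨ *-monoˡ-≤ (2 ^ (3 * m)) (*-monoʳ-≤ (x ^ τ) β≤) ⟩
    x ^ τ * 2 ^ m * 2 ^ (3 * m)              ≡⟨ trans (*-assoc (x ^ τ) (2 ^ m) _) (cong (x ^ τ *_) (sym (^-distribˡ-+-* 2 m (3 * m)))) ⟩
    -- Of the four factors 2^m, three pay for the losses in `main`: the excess M' - M, the factor
    -- w^s and the completed binomial sum. The fourth pays for `β`.
    x ^ τ * 2 ^ (4 * m)                      ≤⟨ *-monoʳ-≤ (x ^ τ) (^-monoʳ-≤ 2 d≥) ⟩
    x ^ τ * 2 ^ (d * τ)                      ≡⟨ cong (x ^ τ *_) (sym (^-*-assoc 2 d τ)) ⟩
    x ^ τ * (2 ^ d) ^ τ                      ≡⟨ sym (^-distribʳ-* τ x (2 ^ d)) ⟩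
    (x * 2 ^ d) ^ τ                          ≤⟨ main ⟩
    bin M m ^ τ * 2 ^ (3 * m)                ∎))
  where
    open ≤-Reasoning
    -- This `w` makes P / W equal to 1 + m / (2 N τ), whose (u τ)-th power is at most 2^m because u
    -- ≤ N; likewise (1 + 1 / Y)^τ ≤ 2 for Y = 2 τ.
    w = 4 * Λ * τ
    W = N * w
    Y = 2 * τ
    P = W + 2 * Λ * m
    instance
      4Λ≢0 : NonZero (4 * Λ)
      4Λ≢0 = m*n≢0 4 Λ
      2Λ≢0 : NonZero (2 * Λ)
      2Λ≢0 = m*n≢0 2 Λ
      w≢0 : NonZero w
      w≢0 = m*n≢0 (4 * Λ) τ
      W≢0 : NonZero W
      W≢0 = m*n≢0 N w
      Y≢0 : NonZero Y
      Y≢0 = m*n≢0 2 τ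
      Z≢0 : NonZero (2 * (N * τ))
      Z≢0 = m*n≢0 2 (N * τ) {{_}} {{m*n≢0 N τ}}
    step₁ : (x * 2 ^ d) * (W ^ u * Y ^ m) ≤ bin M m * (suc Y ^ m * (w ^ s * P ^ u))
    step₁ = begin
      x * 2 ^ d * (W ^ u * Y ^ m)
        ≤⟨ *-monoˡ-≤ (W ^ u * Y ^ m) count ⟩
      budget M' u s m * (W ^ u * Y ^ m)
        ≡⟨ sym (*-assoc (budget M' u s m) (W ^ u) (Y ^ m)) ⟩
      budget M' u s m * W ^ u * Y ^ m
        ≤⟨ *-monoˡ-≤ (Y ^ m) (budget-closed {M'} {N} {Λ} {m} w gap u s) ⟩
      bin M' m * (w ^ s * P ^ u) * Y ^ m
        ≡⟨ lem₁ (bin M' m) (w ^ s * P ^ u) (Y ^ m) ⟩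
      bin M' m * Y ^ m * (w ^ s * P ^ u)
        ≤⟨ *-monoˡ-≤ (w ^ s * P ^ u) (bin-compare {M} {M'} {Y} {m} gap' m≤M ≤-refl) ⟩
      bin M m * suc Y ^ m * (w ^ s * P ^ u)
        ≡⟨ *-assoc (bin M m) (suc Y ^ m) _ ⟩
      bin M m * (suc Y ^ m * (w ^ s * P ^ u)) ∎
      where lem₁ : ∀ a b c → a * b * c ≡ a * c * b
            lem₁ = solve-∀
    loss₁ : (suc Y ^ m) ^ τ ≤ 2 ^ m * (Y ^ m) ^ τ
    loss₁ = begin
      (suc Y ^ m) ^ τ        ≡⟨ ^-*-comm (suc Y) m τ ⟩
      (suc Y ^ τ) ^ m        ≤⟨ ^-monoˡ-≤ m (suc-power≤2 τ Y ≤-refl) ⟩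
      (2 * Y ^ τ) ^ m        ≡⟨ ^-distribʳ-* m 2 (Y ^ τ) ⟩
      2 ^ m * (Y ^ τ) ^ m    ≡⟨ cong (2 ^ m *_) (^-*-comm Y τ m) ⟩
      2 ^ m * (Y ^ m) ^ τ    ∎
    loss₂ : (P ^ u) ^ τ ≤ 2 ^ m * (W ^ u) ^ τ
    loss₂ = begin
      (P ^ u) ^ τ
        ≡⟨ ^-*-assoc P u τ ⟩
      P ^ (u * τ)
        ≡⟨ cong (_^ (u * τ)) (P≡ N Λ τ m) ⟩
      (2 * Λ * (2 * (N * τ) + m)) ^ (u * τ)
        ≡⟨ ^-distribʳ-* (u * τ) (2 * Λ) _ ⟩
      (2 * Λ) ^ (u * τ) * (2 * (N * τ) + m) ^ (u * τ)
        ≤⟨ *-monoʳ-≤ ((2 * Λ) ^ (u * τ)) (plus-power (u * τ) (2 * (N * τ)) (*-monoʳ-≤ 2 (*-monoˡ-≤ τ u≤N)) m) ⟩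
      (2 * Λ) ^ (u * τ) * (2 ^ m * (2 * (N * τ)) ^ (u * τ))
        ≡⟨ lem₂ ((2 * Λ) ^ (u * τ)) (2 ^ m) _ ⟩
      2 ^ m * ((2 * Λ) ^ (u * τ) * (2 * (N * τ)) ^ (u * τ))
        ≡⟨ cong (2 ^ m *_) (sym (^-distribʳ-* (u * τ) (2 * Λ) (2 * (N * τ)))) ⟩
      2 ^ m * (2 * Λ * (2 * (N * τ))) ^ (u * τ)
        ≡⟨ cong (λ z → 2 ^ m * z ^ (u * τ)) (sym (W≡ N Λ τ)) ⟩
      2 ^ m * W ^ (u * τ)
        ≡⟨ cong (2 ^ m *_) (sym (^-*-assoc W u τ)) ⟩
      2 ^ m * (W ^ u) ^ τ ∎
      where
        P≡ : ∀ n l t m → n * (4 * l * t) + 2 * l * m ≡ 2 * l * (2 * (n * t) + m)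
        P≡ = solve-∀
        W≡ : ∀ n l t → n * (4 * l * t) ≡ 2 * l * (2 * (n * t))
        W≡ = solve-∀
        lem₂ : ∀ a b c → a * (b * c) ≡ b * (a * c)
        lem₂ = solve-∀
    V = (W ^ u) ^ τ * (Y ^ m) ^ τ
    V≢0 : NonZero V
    V≢0 = m*n≢0 ((W ^ u) ^ τ) ((Y ^ m) ^ τ) {{m^n≢0 (W ^ u) τ {{m^n≢0 W u}}}} {{m^n≢0 (Y ^ m) τ {{m^n≢0 Y m}}}}
    main : (x * 2 ^ d) ^ τ ≤ bin M m ^ τ * 2 ^ (3 * m)
    main = *-cancelʳ-≤ _ _ V {{V≢0}} (begin
      (x * 2 ^ d) ^ τ * V
        ≡⟨ cong ((x * 2 ^ d) ^ τ *_) (sym (^-distribʳ-* τ (W ^ u) (Y ^ m))) ⟩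
      (x * 2 ^ d) ^ τ * (W ^ u * Y ^ m) ^ τ
        ≡⟨ sym (^-distribʳ-* τ (x * 2 ^ d) (W ^ u * Y ^ m)) ⟩
      (x * 2 ^ d * (W ^ u * Y ^ m)) ^ τ
        ≤⟨ ^-monoˡ-≤ τ step₁ ⟩
      (bin M m * (suc Y ^ m * (w ^ s * P ^ u))) ^ τ
        ≡⟨ trans (^-distribʳ-* τ (bin M m) _) (cong (bin M m ^ τ *_) (trans (^-distribʳ-* τ (suc Y ^ m) _)
             (cong ((suc Y ^ m) ^ τ *_) (^-distribʳ-* τ (w ^ s) (P ^ u))))) ⟩
      bin M m ^ τ * ((suc Y ^ m) ^ τ * ((w ^ s) ^ τ * (P ^ u) ^ τ))
        ≤⟨ *-monoʳ-≤ (bin M m ^ τ) (*-mono-≤ loss₁ (*-mono-≤ (≤-trans (≤-reflexive (^-*-assoc w s τ)) few) loss₂)) ⟩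
      bin M m ^ τ * (2 ^ m * (Y ^ m) ^ τ * (2 ^ m * (2 ^ m * (W ^ u) ^ τ)))
        ≡⟨ lem₃ (bin M m ^ τ) (2 ^ m) ((Y ^ m) ^ τ) ((W ^ u) ^ τ) ⟩
      bin M m ^ τ * (2 ^ m * (2 ^ m * 2 ^ m)) * V
        ≡⟨ cong (λ z → bin M m ^ τ * z * V) (trans (cong (2 ^ m *_) (sym (^-distribˡ-+-* 2 m m))) (trans (sym (^-distribˡ-+-* 2 m (m + m))) (cong (2 ^_) (3m m)))) ⟩
      bin M m ^ τ * 2 ^ (3 * m) * V ∎)
      where
        lem₃ : ∀ b p y w → b * (p * y * (p * (p * w))) ≡ b * (p * (p * p)) * (w * y)
        lem₃ = solve-∀
        3m : ∀ m → m + (m + m) ≡ 3 * m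
        3m = solve-∀

-- Consequences of m ≥ c n^(2 - q/p), with the exponent cleared by a p-th power

module Density {n m p q c b : ℕ} {{n≢0 : NonZero n}} {{p≢0 : NonZero p}} {{c≢0 : NonZero c}}
               (dense : c ^ p * n ^ (2 * p) ≤ m ^ p * n ^ q) where
  open ≤-Reasoning

  n^2p : n ^ (2 * p) ≡ (n * n) ^ p
  n^2p = trans (sym (^-*-assoc n 2 p)) (cong (λ z → (n * z) ^ p) (*-identityʳ n))

  m≥n : q ≤ p → n ≤ m
  m≥n q≤p = ≤-trans (m≤n*m n c) (*-cancelʳ-≤ _ _ n (^-cancel-≤ p (begin
    (c * n * n) ^ p         ≡⟨ cong (_^ p) (*-assoc c n n) ⟩
    (c * (n * n)) ^ p       ≡⟨ ^-distribʳ-* p c (n * n) ⟩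
    c ^ p * (n * n) ^ p     ≡⟨ cong (c ^ p *_) (sym n^2p) ⟩
    c ^ p * n ^ (2 * p)     ≤⟨ dense ⟩
    m ^ p * n ^ q           ≤⟨ *-monoʳ-≤ (m ^ p) (^-monoʳ-≤ n q≤p) ⟩
    m ^ p * n ^ p           ≡⟨ sym (^-distribʳ-* p m n) ⟩
    (m * n) ^ p             ∎)))

  module _ (m≤cb : m ≤ c * b) where

    N^p≤ : (n * n) ^ p ≤ b ^ p * n ^ q
    N^p≤ = *-cancelˡ-≤ (c ^ p) {{m^n≢0 c p}} (begin
      c ^ p * (n * n) ^ p       ≡⟨ cong (c ^ p *_) (sym n^2p) ⟩
      c ^ p * n ^ (2 * p)       ≤⟨ dense ⟩
      m ^ p * n ^ q             ≤⟨ *-monoˡ-≤ (n ^ q) (^-monoˡ-≤ p m≤cb) ⟩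
      (c * b) ^ p * n ^ q       ≡⟨ cong (_* n ^ q) (^-distribʳ-* p c b) ⟩
      c ^ p * b ^ p * n ^ q     ≡⟨ *-assoc (c ^ p) (b ^ p) (n ^ q) ⟩
      c ^ p * (b ^ p * n ^ q)   ∎)

    -- From m ≤ c b the density condition becomes N / b ≤ n^(q/p), and its j-th power is at most n^v
    -- by hypothesis.
    codegree-condition : ∀ j v → j * q ≤ p * v → (n * n) ^ j ≤ b ^ j * n ^ v
    codegree-condition j v jq≤pv = ^-cancel-≤ p (begin
      ((n * n) ^ j) ^ p         ≡⟨ ^-*-comm (n * n) j p ⟩
      ((n * n) ^ p) ^ j         ≤⟨ ^-monoˡ-≤ j N^p≤ ⟩
      (b ^ p * n ^ q) ^ j       ≡⟨ ^-distribʳ-* j (b ^ p) (n ^ q) ⟩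
      (b ^ p) ^ j * (n ^ q) ^ j ≡⟨ cong₂ _*_ (^-*-comm b p j) (trans (^-*-assoc n q j) (cong (n ^_) (*-comm q j))) ⟩
      (b ^ j) ^ p * n ^ (j * q) ≤⟨ *-monoʳ-≤ ((b ^ j) ^ p) (^-monoʳ-≤ n (≤-trans jq≤pv (≤-reflexive (*-comm p v)))) ⟩
      (b ^ j) ^ p * n ^ (v * p) ≡⟨ cong ((b ^ j) ^ p *_) (sym (^-*-assoc n v p)) ⟩
      (b ^ j) ^ p * (n ^ v) ^ p ≡⟨ sym (^-distribʳ-* p (b ^ j) (n ^ v)) ⟩
      (b ^ j * n ^ v) ^ p       ∎)

-- The theorem

-- Two errors of at most N / (2 D) add up: the stability error, by the choice of `L`, and the n / 2
-- by which `M` may fall short of ρ N / (2 (1 + ρ)), as D ≤ n.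
stable-weight : ∀ {ρ L D n W M T} {{_ : NonZero D}} → L ≡ 4 * (1 + ρ) * D → D ≤ n → T ≡ 2 * W →
  (1 + ρ) * L * T ≤ ρ * L * (n * n) + 4 * ((1 + ρ) * (1 + ρ)) * (n * n) →
  ρ * (n * n) ≤ 2 * (1 + ρ) * M + (1 + ρ) * n → W ≤ M + (n * n) / D
stable-weight {ρ} {L} {D} {n} {W} {M} refl D≤n refl stable crossing = ≤-trans (m≤n+m∸n W M) (+-monoʳ-≤ M quotient)
  where
    open ≤-Reasoning
    r = 1 + ρ
    scaled : 2 * (D * W) ≤ 2 * (D * M) + (D * n + n * n)
    scaled = *-cancelˡ-≤ (4 * r * r) (begin
      4 * r * r * (2 * (D * W))
        ≡⟨ lem₁ r D W ⟩
      r * (4 * r * D) * (2 * W)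
        ≤⟨ stable ⟩
      ρ * (4 * r * D) * (n * n) + 4 * (r * r) * (n * n)
        ≡⟨ lem₂ ρ r D (n * n) ⟩
      4 * r * D * (ρ * (n * n)) + 4 * (r * r) * (n * n)
        ≤⟨ +-monoˡ-≤ _ (*-monoʳ-≤ (4 * r * D) crossing) ⟩
      4 * r * D * (2 * r * M + r * n) + 4 * (r * r) * (n * n)
        ≡⟨ lem₃ r D M n ⟩
      4 * r * r * (2 * (D * M) + (D * n + n * n)) ∎)
      where
        lem₁ : ∀ r D W → 4 * r * r * (2 * (D * W)) ≡ r * (4 * r * D) * (2 * W)
        lem₁ = solve-∀
        lem₂ : ∀ ρ r D N → ρ * (4 * r * D) * N + 4 * (r * r) * N ≡ 4 * r * D * (ρ * N) + 4 * (r * r) * N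
        lem₂ = solve-∀
        lem₃ : ∀ r D M n → 4 * r * D * (2 * r * M + r * n) + 4 * (r * r) * (n * n) ≡ 4 * r * r * (2 * (D * M) + (D * n + n * n))
        lem₃ = solve-∀
    excess : D * W ≤ D * M + n * n
    excess = *-cancelˡ-≤ 2 (begin
      2 * (D * W)                        ≤⟨ scaled ⟩
      2 * (D * M) + (D * n + n * n)      ≤⟨ +-monoʳ-≤ (2 * (D * M)) (+-monoˡ-≤ (n * n) (*-monoˡ-≤ n D≤n)) ⟩
      2 * (D * M) + (n * n + n * n)      ≡⟨ lem (D * M) (n * n) ⟩
      2 * (D * M + n * n)                ∎)
      where lem : ∀ a b → 2 * a + (b + b) ≡ 2 * (a + b)
            lem = solve-∀
    quotient : W ∸ M ≤ (n * n) / D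
    quotient = *-cancelʳ-≤ _ _ D (≤-pred′ (begin-strict
      (W ∸ M) * D                              ≡⟨ trans (*-comm (W ∸ M) D) (*-distribˡ-∸ D W M) ⟩
      D * W ∸ D * M                            ≤⟨ m≤n+o⇒m∸n≤o (D * W) (D * M) excess ⟩
      n * n                                    ≡⟨ m≡m%n+[m/n]*n (n * n) D ⟩
      (n * n) % D + (n * n) / D * D            <⟨ +-monoˡ-< _ (m%n<n (n * n) D) ⟩
      D + (n * n) / D * D                      ∎))
      where
        ≤-pred′ : (W ∸ M) * D < D + (n * n) / D * D → (W ∸ M) * D ≤ (n * n) / D * D
        ≤-pred′ lt = *-monoˡ-≤ D (s≤s⁻¹ (*-cancelʳ-< D (W ∸ M) (suc ((n * n) / D)) lt))

-- If m is within N/Λ of the maximum, then an H-free graph with m edges is itself close to extremal.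
dense-regime : ∀ {Λ dq n m mc M x} {{_ : NonZero dq}} → Λ ≡ 64 * dq → 3 ≤ n → Λ * x ≤ n * n → n * n ≤ 4 * M + 2 * n →
  m + mc ≤ M + x → m < mc * dq → Λ * M < n * n + Λ * m → ⊥
dense-regime {Λ} {dq} {n} {m} {mc} {M} {x} refl 3≤n Λx≤N N≤ close bad large = <-irrefl refl (begin-strict
  39                         ≤⟨ *-monoʳ-≤ 13 3≤n ⟩
  13 * n                     <⟨ *-cancelʳ-< n (13 * n) 32 13n²<32n ⟩
  32                         ≤⟨ m≤m+n 32 7 ⟩
  39                         ∎)
  where
    open ≤-Reasoning
    N = n * n
    Λ' = 64 * dq
    -- Fewer than 2 N / Λ monochromatic edges, in a graph where they exceed m / dq, leave m < N /
    -- 32. Then M < 3 N / 64, although M is at least N / 4 - n / 2; for n ≥ 3 this is absurd.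
    Λmc<2N : Λ' * mc < 2 * N
    Λmc<2N = +-cancelˡ-< (Λ' * m) _ _ (begin-strict
      Λ' * m + Λ' * mc           ≡⟨ sym (*-distribˡ-+ Λ' m mc) ⟩
      Λ' * (m + mc)              ≤⟨ *-monoʳ-≤ Λ' close ⟩
      Λ' * (M + x)               ≡⟨ *-distribˡ-+ Λ' M x ⟩
      Λ' * M + Λ' * x            <⟨ +-mono-<-≤ large Λx≤N ⟩
      N + Λ' * m + N             ≡⟨ lem N (Λ' * m) ⟩
      Λ' * m + 2 * N             ∎)
      where lem : ∀ a b → a + b + a ≡ b + 2 * a
            lem = solve-∀
    64m<2N : 64 * m < 2 * N
    64m<2N = ≤-<-trans (*-monoʳ-≤ 64 (<⇒≤ bad)) (≤-<-trans (≤-reflexive (lem mc dq)) Λmc<2N)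
      where lem : ∀ c d → 64 * (c * d) ≡ 64 * d * c
            lem = solve-∀
    64M<3N : 64 * M < 3 * N
    64M<3N = *-cancelˡ-< dq _ _ (begin-strict
      dq * (64 * M)              ≡⟨ lem₁ dq M ⟩
      64 * dq * M                <⟨ large ⟩
      N + 64 * dq * m            ≡⟨ cong (N +_) (sym (lem₁ dq m)) ⟩
      N + dq * (64 * m)          ≤⟨ +-mono-≤ (m≤n*m N dq) (*-monoʳ-≤ dq (<⇒≤ 64m<2N)) ⟩
      dq * N + dq * (2 * N)      ≡⟨ lem₂ dq N ⟩
      dq * (3 * N)               ∎)
      where lem₁ : ∀ d c → d * (64 * c) ≡ 64 * d * c
            lem₁ = solve-∀
            lem₂ : ∀ d N → d * N + d * (2 * N) ≡ d * (3 * N)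
            lem₂ = solve-∀
    13n²<32n : 13 * n * n < 32 * n
    13n²<32n = +-cancelˡ-< (3 * N) _ _ (begin-strict
      3 * N + 13 * n * n         ≡⟨ lem₁ n ⟩
      16 * N                     ≤⟨ *-monoʳ-≤ 16 N≤ ⟩
      16 * (4 * M + 2 * n)       ≡⟨ lem₂ M n ⟩
      64 * M + 32 * n            <⟨ +-monoˡ-< (32 * n) 64M<3N ⟩
      3 * N + 32 * n             ∎)
      where lem₁ : ∀ n → 3 * (n * n) + 13 * n * n ≡ 16 * (n * n)
            lem₁ = solve-∀
            lem₂ : ∀ M n → 16 * (4 * M + 2 * n) ≡ 64 * M + 32 * n
            lem₂ = solve-∀

-- A copy of H in a subgraph of an r-partite graph would pull the r-colouring back to H. Hence every
-- choice of m crossing edges counts.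
many-free : ∀ {h n r m} (H : Mat h) (col : Fin n → Fin r) → ¬ Colourable H r → ∀ (ys : List (Mat n)) →
            (∀ G → FreeGraph H n m G → G ∈ ys) → bin (∑ (Ed n) (λ v → 𝟙 (crossing col v))) m ≤ length ys
many-free {h} {n} {r} {m} H col ¬colourable ys complete =
  many-graphs (∑ (Ed n) (λ v → 𝟙 (crossing col v))) ys (λ _ → false) (crossing col) m refl build
  where
    open Counting (_≟ᴱ_ {n}) (Ed n) (Ed-unique n) (on {n}) using (many-graphs)
    build : ∀ (σ : Edge n → Bool) → (∀ v → v ∈ Ed n → crossing col v ≡ false → σ v ≡ false) →
            ∑ (Ed n) (λ v → 𝟙 (crossing col v) * 𝟙 (σ v)) ≡ m → ∃[ G ] (G ∈ ys × (∀ v → v ∈ Ed n → on G v ≡ σ v))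
    build σ off count = G , complete G (isG , edges≡ , free) , on≡
      where
        G : Mat n
        G = fromAdj (adjOf σ)
        isG : IsGraph G
        isG = fromAdj-isGraph (adjOf-irrefl σ) (adjOf-sym σ)
        on≡ : ∀ v → v ∈ Ed n → on G v ≡ σ v
        on≡ (i , j) v∈ = trans (adj-fromAdj (adjOf σ) i j) (adjOf-< σ (∈Ed⁻ v∈))
        𝟙-only : ∀ {a b c} → a ≡ b → (c ≡ false → b ≡ false) → 𝟙 a ≡ 𝟙 c * 𝟙 b
        𝟙-only {c = true}  refl f = sym (*-identityˡ _)
        𝟙-only {c = false} refl f = cong 𝟙 (f refl)
        edges≡ : e G ≡ m
        edges≡ = trans (e-∑ G) (trans (∑-cong∈ (Ed n) (λ v v∈ → 𝟙-only (on≡ v v∈) (off v v∈))) count)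
        not-crossing : ∀ i j → col i ≡ col j → crossing col (norm i j) ≡ false
        not-crossing i j eq with norm-cases i j
        ... | inj₁ p = trans (cong (crossing col) p) (cong not (trans (cong (eqᵇ (col i)) (sym eq)) (eqᵇ-refl (col i))))
        ... | inj₂ p = trans (cong (crossing col) p) (cong not (trans (cong (eqᵇ (col j)) eq) (eqᵇ-refl (col j))))
        crosses : ∀ i j → adj G i j ≡ true → col i ≢ col j
        crosses i j x eq with i Fin.≟ j
        ... | yes refl = true≢false x (proj₁ isG i)
        ... | no i≢j   = true≢false (trans (sym (on≡ _ (norm∈Ed i≢j))) (trans (on-norm {G = G} isG i j) x))
                                    (off _ (norm∈Ed i≢j) (not-crossing i j eq))
        free : Free H G
        free (f , _ , hom) = ¬colourable ((λ i → col (f i)) , λ i j x eq → crosses (f i) (f j) (hom i j x) eq)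

-- A bad graph has more than m / dq monochromatic edges for every colouring, as dp ≥ 1. `τ` makes
-- the gain 2^(m/dq) worth 2^(4m) after a τ-th power, even with the exponent rounded down. `Λ`
-- separates the regimes, `D` keeps 2 τ times the excess N / D within N / Λ, and `L` is the
-- precision that stability needs for this excess.
module Assembly (h₂ : ℕ) (H : Mat (2 + h₂)) (isH : IsGraph H) (ρ : ℕ) (1≤ρ : 1 ≤ ρ)
                (chromatic : IsChromaticNumber H (2 + ρ)) (p q : ℕ) (m₂ : IsM2 H p q)
                (dp dq : ℕ) (0<dp : 0 < dp) {{dq≢0 : NonZero dq}}
                (τ Λ D L : ℕ) (τ≡ : τ ≡ 8 * dq) (Λ≡ : Λ ≡ 64 * dq) (D≡ : D ≡ 2 * τ * Λ) (L≡ : L ≡ 4 * (1 + ρ) * D) where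
  open ≤-Reasoning

  -- Copies are few below n^h / `a₀`, so that they and the non-injective maps each fill at most half
  -- of n^h / `B`. `g` is the value of `gain` and bounds the rounds. `Q` is such that w^(s τ) ≤ 2^m
  -- for s = (g + 1) ℓ b and Q b ≤ m, by w ≤ 2^w. With b = m / Q rounded down but positive one has m
  -- ≤ 2 Q b, whence `c`.
  h r ℓ B a₀ K g w Q c : ℕ
  h  = 2 + h₂
  r  = 1 + ρ
  ℓ  = length (labels H)
  B  = blowup h L (2 + ρ)
  a₀ = suc (2 * B)
  K  = h ^ h
  g  = 2 ^ ℓ * K * (4 * (a₀ * (4 * 2 ^ ℓ) ^ ℓ))
  w  = 4 * Λ * τ
  Q  = suc (w * (suc g * ℓ * τ))
  c  = 2 * Q

  instance
    τ≢0 : NonZero τ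
    τ≢0 = subst NonZero (sym τ≡) (m*n≢0 8 dq)
    Λ≢0 : NonZero Λ
    Λ≢0 = subst NonZero (sym Λ≡) (m*n≢0 64 dq)
    D≢0 : NonZero D
    D≢0 = subst NonZero (sym D≡) (m*n≢0 (2 * τ) Λ {{m*n≢0 2 τ}})
    K≢0 : NonZero K
    K≢0 = m^n≢0 h h

  ¬2-colourable : ¬ Colourable H 2
  ¬2-colourable col = <-irrefl refl (≤-trans (s≤s (s≤s 1≤ρ)) (proj₂ chromatic 2 col))

  q≤p : q ≤ p
  q≤p = m₂≥1 {H = H} isH ¬2-colourable m₂

  instance
    p≢0 : NonZero p
    p≢0 = >-nonZero (<-≤-trans (proj₁ m₂) q≤p)

  colourH : Fin h → ℕ
  colourH u = toℕ (proj₁ (proj₁ chromatic) u)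

  module AtSize (n : ℕ) (m b : ℕ) (1≤n : 1 ≤ n) (D≤n : D ≤ n) (dup≤n : 2 * B * (h * h) ≤ n) {{b≢0 : NonZero b}} where
    N P M M' : ℕ
    N = n * n
    P = n ^ h₂

    instance
      n≢0 : NonZero n
      n≢0 = >-nonZero 1≤n
      N≢0 : NonZero N
      N≢0 = m*n≢0 n n
      P≢0 : NonZero P
      P≢0 = m^n≢0 n h₂

    N*P≡n^h : N * P ≡ n ^ h
    N*P≡n^h = *-assoc n n P

    turán : Edge n → Bool
    turán = crossing (proj₁ (balanced r n))

    M  = ∑ (Ed n) (λ v → 𝟙 (turán v))
    M' = M + N / D

    M-large : ρ * N ≤ 2 * r * M + r * n
    M-large = many-crossing ρ n (proj₁ (balanced r n)) (proj₂ (balanced r n))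

    Colouring : Set
    Colouring = Σ (Fin n → ℕ) λ col → ∀ x → col x < r

    mono : Colouring → Edge n → Bool
    mono (col , _) = monochromatic col

    Φ Xs : List (Vec (Fin n) h)
    Φ = vecs (allFin n) h
    Xs = filterᵇ (λ φ → not (dup φ)) Φ

    open Rounds (_≟ᴱ_ {n}) (Ed n) (Ed-unique n) (on {n}) mono coord (labels H) Xs M' b N K P a₀ (Ed≤n² n) hiding (ℓ)

    ∈Xs : ∀ {φ} → φ ∈ Xs → ∀ i j → lookup φ i ≡ lookup φ j → i ≡ j
    ∈Xs {φ} φ∈ = dup-injective φ (not-true (proj₂ (∈-filterᵇ⁻ (λ φ → not (dup φ)) Φ φ∈)))

    label-< : ∀ {i j} → (i , j) ∈ labels H → toℕ i < toℕ j
    label-< e∈ = ∈Ed⁻ (∈-sublist (labels⊆Ed H) e∈)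

    label-adj : ∀ {i j} → (i , j) ∈ labels H → adj H i j ≡ true
    label-adj e∈ = proj₂ (∈-filterᵇ⁻ (on H) (Ed h) e∈)

    Xs⊆Ed : ∀ {φ} → φ ∈ Xs → ∀ e → e ∈ labels H → coord e φ ∈ Ed n
    Xs⊆Ed φ∈ (i , j) e∈ = norm∈Ed λ eq → <⇒≢ᶠ (label-< e∈) (∈Xs φ∈ i j eq)

    independent : ∀ {xs} → (∀ {G} → G ∈ xs → IsGraph G × Free H G) → Independent (labels H) Xs xs
    independent free {φ} {G} φ∈ G∈ all-on = proj₂ (free G∈) (lookup φ , (λ {i} {j} → ∈Xs φ∈ i j) , edge)
      where
        edge-< : ∀ {i j} → toℕ i < toℕ j → adj H i j ≡ true → adj G (lookup φ i) (lookup φ j) ≡ true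
        edge-< {i} {j} lt x = trans (sym (on-norm {G = G} (proj₁ (free G∈)) _ _)) (all-on (i , j) (∈-filterᵇ⁺ (on H) (Ed h) (∈Ed⁺ lt) x))
        edge : ∀ i j → adj H i j ≡ true → adj G (lookup φ i) (lookup φ j) ≡ true
        edge i j x with i Fin.≟ j
        ... | yes refl = ⊥-elim (true≢false x (proj₁ isH i))
        ... | no i≢j with ≢⇒<⊎> i≢j
        ...   | inj₁ lt = edge-< lt x
        ...   | inj₂ gt = trans (proj₂ (proj₁ (free G∈)) _ _) (edge-< gt (trans (sym (proj₂ isH i j)) x))

    -- Let t ∷ J cover v vertices. Then at most `K` n^(h - v) copies agree on it, and what remains
    -- is N^j ≤ b^j n^(v - 2). If v = 2 there is a single edge and j = 0; otherwise `m₂-bound`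
    -- supplies the premise of `condition`.
    spread : (∀ j v → j * q ≤ p * v → N ^ j ≤ b ^ j * n ^ v) → Spread 0 (labels H) Xs
    spread condition t J ψ J⊆ = begin
      d * N ^ (j + 0)                    ≡⟨ cong (λ k → d * N ^ k) (+-identityʳ j) ⟩
      d * N ^ j                          ≤⟨ *-monoʳ-≤ d (power v refl) ⟩
      d * (b ^ j * n ^ (v ∸ 2))          ≡⟨ lem₁ d (b ^ j) (n ^ (v ∸ 2)) ⟩
      d * n ^ (v ∸ 2) * b ^ j            ≤⟨ *-monoˡ-≤ (b ^ j) degree≤ ⟩
      K * P * b ^ j                      ≡⟨ lem₂ K P (b ^ j) ⟩
      1 * K * b ^ j * P                  ≡⟨ cong (λ k → 1 * K * b ^ k * P) (sym (+-identityʳ j)) ⟩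
      2 ^ 0 * K * b ^ (j + 0) * P        ∎
      where
        d = degree (t ∷ J) Xs ψ
        j = length J
        v = covered (t ∷ J)
        pairs : 2 * suc j + v ≤ v * v
        pairs = edges≤pairs (⊆-trans J⊆ (labels⊆Ed H))
        lem₁ : ∀ a b c → a * (b * c) ≡ a * c * b
        lem₁ = solve-∀
        lem₂ : ∀ k p b → k * p * b ≡ 1 * k * b * p
        lem₂ = solve-∀
        small : ∀ v → 2 * suc j + v ≤ v * v → v ≤ 2 → v ≡ 2 × j ≡ 0
        small 0 le _ = ⊥-elim (n≮0 le)
        small 1 le _ = ⊥-elim (n≮0 (+-cancelʳ-≤ 1 (2 * suc j) 0 le))
        small 2 le _ = refl , n≤0⇒n≡0 (s≤s⁻¹ (*-cancelˡ-≤ 2 (+-cancelʳ-≤ 2 (2 * suc j) 2 le)))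
        small (suc (suc (suc v))) le (s≤s (s≤s ()))
        2≤v : 2 ≤ v
        2≤v with v ≤? 2
        ... | yes v≤2 = ≤-reflexive (sym (proj₁ (small v pairs v≤2)))
        ... | no  v≰2 = <⇒≤ (≰⇒> v≰2)
        power : ∀ v' → v ≡ v' → N ^ j ≤ b ^ j * n ^ (v' ∸ 2)
        power v' refl with v ≤? 2
        ... | yes v≤2 = subst₂ (λ j v → N ^ j ≤ b ^ j * n ^ (v ∸ 2)) (sym (proj₂ (small v pairs v≤2))) (sym (proj₁ (small v pairs v≤2))) ≤-refl
        ... | no  v≰2 = condition j (v ∸ 2) (m₂-bound {H = H} {p} {q} isH m₂ J⊆ (≰⇒> v≰2))
        degree≤ : d * n ^ (v ∸ 2) ≤ K * P
        degree≤ = *-cancelʳ-≤ _ _ N (begin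
          d * n ^ (v ∸ 2) * N            ≡⟨ lem₃ d (n ^ (v ∸ 2)) n ⟩
          d * n ^ (2 + (v ∸ 2))          ≡⟨ cong (λ k → d * n ^ k) (m+[n∸m]≡n 2≤v) ⟩
          d * n ^ v                      ≤⟨ *-monoˡ-≤ (n ^ v) (≤-trans (≤-reflexive (∑-filter (λ φ → not (dup φ)) Φ _))
                                              (∑-mono Φ (λ φ → ≤-trans (*-monoˡ-≤ _ (𝟙≤1 (not (dup φ)))) (≤-reflexive (*-identityˡ _))))) ⟩
          ∑ Φ (λ φ → 𝟙 (match (t ∷ J) φ ψ)) * n ^ v
                                         ≤⟨ codegree n h (t ∷ J) ψ (λ φ → match (t ∷ J) φ ψ) (λ φ → match-elim (t ∷ J)) ⟩
          K * n ^ h                      ≡⟨ cong (K *_) (sym N*P≡n^h) ⟩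
          K * (N * P)                    ≡⟨ lem₄ K N P ⟩
          K * P * N                      ∎)
          where lem₃ : ∀ d x n → d * x * (n * n) ≡ d * (n * (n * x))
                lem₃ = solve-∀
                lem₄ : ∀ k n p → k * (n * p) ≡ k * p * n
                lem₄ = solve-∀

    module _ (u : Edge n → Bool) where
      open Stability n (suc h₂) colourH (adjOf u) (adjOf-sym u) using (good; hom; good-adj; total; stable; #_)

      everything : Fin n → Bool
      everything _ = true

      good-inside : ∀ φ → good (2 + ρ) everything φ ≡ true → inside u φ ≡ true
      good-inside φ p = inside-intro u φ λ (i , j) e∈ → ordered i j (label-adj e∈) (<-cmp-colours i j (label-adj e∈))
        where
          <-cmp-colours : ∀ i j → adj H i j ≡ true → colourH i < colourH j ⊎ colourH j < colourH i
          <-cmp-colours i j x = ≢⇒<⊎> (proj₂ (proj₁ chromatic) i j x)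
          ordered : ∀ i j → adj H i j ≡ true → colourH i < colourH j ⊎ colourH j < colourH i → u (norm (lookup φ i) (lookup φ j)) ≡ true
          ordered i j x (inj₁ lt) = proj₂ (∧-true {not (eqᵇ (lookup φ i) (lookup φ j))} (good-adj (2 + ρ) everything φ p i j lt (Fin.toℕ<n _)))
          ordered i j x (inj₂ gt) = trans (cong u (norm-sym (lookup φ i) (lookup φ j)))
            (proj₂ (∧-true {not (eqᵇ (lookup φ j) (lookup φ i))} (good-adj (2 + ρ) everything φ p j i gt (Fin.toℕ<n _))))

      -- Good maps may fail to be injective, whereas `Xs` lists only injective ones. The repetitions
      -- are controlled by the lower bound on `n`, the copies by `a₀`.
      few-homs : length (copies u) * a₀ ≤ N * P → hom (2 + ρ) everything * B ≤ n ^ h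
      few-homs few = *-cancelʳ-≤ _ _ 2 (begin
        hom (2 + ρ) everything * B * 2
          ≤⟨ *-monoˡ-≤ 2 (*-monoˡ-≤ B hom≤) ⟩
        (dups + length (copies u)) * B * 2
          ≡⟨ lem dups (length (copies u)) B ⟩
        dups * (2 * B) + length (copies u) * (2 * B)
          ≤⟨ +-mono-≤ few-dups (≤-trans (*-monoʳ-≤ (length (copies u)) (n≤1+n (2 * B))) (≤-trans few (≤-reflexive N*P≡n^h))) ⟩
        n ^ h + n ^ h
          ≡⟨ trans (cong (n ^ h +_) (sym (+-identityʳ _))) (*-comm 2 (n ^ h)) ⟩
        n ^ h * 2 ∎)
        where
          dups = ∑ Φ (λ φ → 𝟙 (dup φ))
          lem : ∀ x y b → (x + y) * b * 2 ≡ x * (2 * b) + y * (2 * b)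
          lem = solve-∀
          cases : ∀ φ b → (good (2 + ρ) everything φ ≡ true → inside u φ ≡ true) → 𝟙 (good (2 + ρ) everything φ) ≤ 𝟙 b + 𝟙 (not b) * 𝟙 (inside u φ)
          cases φ true  f = 𝟙≤1 _
          cases φ false f = ≤-trans (𝟙-mono f) (≤-reflexive (sym (+-identityʳ _)))
          hom≤ : hom (2 + ρ) everything ≤ dups + length (copies u)
          hom≤ = begin
            hom (2 + ρ) everything
              ≤⟨ ∑-mono Φ (λ φ → cases φ (dup φ) (good-inside φ)) ⟩
            ∑ Φ (λ φ → 𝟙 (dup φ) + 𝟙 (not (dup φ)) * 𝟙 (inside u φ))
              ≡⟨ ∑-+ Φ _ _ ⟩
            dups + ∑ Φ (λ φ → 𝟙 (not (dup φ)) * 𝟙 (inside u φ))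
              ≡⟨ cong (dups +_) (sym (trans (length-filterᵇ (inside u) Xs) (∑-filter (λ φ → not (dup φ)) Φ _))) ⟩
            dups + length (copies u) ∎
          few-dups : dups * (2 * B) ≤ n ^ h
          few-dups = *-cancelʳ-≤ _ _ (h * h) (begin
            dups * (2 * B) * (h * h)     ≡⟨ *-assoc dups (2 * B) (h * h) ⟩
            dups * (2 * B * (h * h))     ≤⟨ *-monoʳ-≤ dups dup≤n ⟩
            dups * n                     ≤⟨ few-dup n h ⟩
            h * h * n ^ h                ≡⟨ *-comm (h * h) (n ^ h) ⟩
            n ^ h * (h * h)              ∎)

      -- Serves twice: for the undecided edges at a leaf and, in the dense regime, for the edge set
      -- of a single H-free graph.
      structure : length (copies u) * a₀ ≤ N * P → Σ Colouring λ col → weightSum (mono col) u ≤ M'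
      structure few = conclude (stable L ρ everything (few-homs few))
        where
          #everything : # everything ≡ n
          #everything = trans (∑-allFin-const n 1) (*-identityʳ n)
          entry : (Fin n → ℕ) → Fin n → Fin n → ℕ
          entry col y z = 1 * (𝟙 (adjOf u y z) * (1 + 𝟙 (col y ≡ᵇ col z)))
          total≡ : ∀ col → total col everything ≡ 2 * weightSum (monochromatic col) u
          total≡ col = trans (∑∑-symmetric (entry col) (λ y z → cong (1 *_) (cong₂ (λ a b → 𝟙 a * (1 + 𝟙 b)) (adjOf-sym u y z) (≡ᵇ-sym (col y) (col z)))))
            (trans (cong₂ (λ x y → 2 * x + y) (∑-cong∈ (Ed n) (λ (i , j) e∈ → trans (*-identityˡ _)
                      (cong (λ b → 𝟙 b * (1 + 𝟙 (col i ≡ᵇ col j))) (adjOf-< u (∈Ed⁻ e∈)))))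
                    (trans (∑-cong (allFin n) (λ y → cong (λ b → 1 * (𝟙 b * (1 + 𝟙 (col y ≡ᵇ col y)))) (adjOf-irrefl u y))) (∑-zero (allFin n))))
              (+-identityʳ _))

          conclude : ∃[ col ] ((∀ x → col x < 1 + ρ) × (1 + ρ) * L * total col everything ≤ ρ * L * (# everything * # everything) + 4 * ((1 + ρ) * (1 + ρ)) * (n * n)) →
                     Σ Colouring λ col → weightSum (mono col) u ≤ M'
          conclude (col , col< , le) = (col , col<) , stable-weight {ρ} {L} {D} {n} {weightSum (monochromatic col) u} {M} L≡ D≤n (total≡ col)
              (subst (λ k → (1 + ρ) * L * total col everything ≤ ρ * L * (k * k) + 4 * ((1 + ρ) * (1 + ρ)) * (n * n)) #everything le) M-large

    -- The colouring depends only on `u` and so is shared by all graphs at the leaf. It is not known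
    -- before the leaf is reached, which is why states carry the monochromatic bound for every
    -- colouring.
    leaf : ∀ {xs u m d} → State mono xs u m d → length (copies u) * a₀ < N * P → length xs * 2 ^ d ≤ bin M' m
    leaf {xs} {u} {m} {d} st few = count (structure u (<⇒≤ few))
      where
        count : Σ Colouring (λ col → weightSum (mono col) u ≤ M') → length xs * 2 ^ d ≤ bin M' m
        count (col , le) = ≤-trans (few-graphs (size u) {mono col} refl (record
            { unique = unique st ; ext = ext st ; agree = agree st ; edges = edges st ; monos = λ G∈ _ → monos st G∈ col })) (bin-mono m le)

    all-edges : Edge n → Bool
    all-edges _ = true

    initial-state : ∀ {xs d} → Unique xs → (∀ {G} → G ∈ xs → IsGraph G × e G ≡ m) →
      (∀ {G} → G ∈ xs → ∀ (c : Colouring) → d ≤ ∑ (Ed n) (λ v → 𝟙 (on G v) * 𝟙 (mono c v))) → State mono xs all-edges m d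
    initial-state uq graphs monos' = record
      { unique = uq
      ; ext    = λ {G} {G'} p q → graph-ext {G = G} {G'} (proj₁ (graphs p)) (proj₁ (graphs q))
      ; agree  = λ _ _ _ _ ()
      ; edges  = λ {G} p → trans (∑-cong (Ed n) (λ v → *-identityˡ _)) (trans (sym (e-∑ G)) (proj₂ (graphs p)))
      ; monos  = λ p c → ≤-trans (monos' p c) (≤-reflexive (∑-cong (Ed n) (λ v → sym (*-identityˡ _))))
      }

    bad-mono : ∀ {G} → BadFreeGraph H n m dp dq r G → ∀ (col : Fin n → ℕ) → (∀ x → col x < r) →
               m < ∑ (Ed n) (λ v → 𝟙 (on G v) * 𝟙 (monochromatic col v)) * dq
    bad-mono {G} ((isG , eG , _) , ¬partite) col col< =
      ≤-<-trans (m≤n*m m dp {{>-nonZero 0<dp}}) (subst (λ k → dp * k < _) eG (not-partite {n} {dp} {dq} {r} {G} isG ¬partite col col<))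

    excess-small : Λ * (N / D) ≤ N
    excess-small = begin
      Λ * (N / D)                ≤⟨ *-monoˡ-≤ (N / D) (≤-trans (m≤n*m Λ (2 * τ) {{m*n≢0 2 τ}}) (≤-reflexive (sym D≡))) ⟩
      D * (N / D)                ≡⟨ *-comm D (N / D) ⟩
      N / D * D                  ≤⟨ m/n*n≤m N D ⟩
      N                          ∎

    -- No copy of H lies inside the edge set of an H-free graph, so `structure` applies to the graph
    -- itself, and its weight m + mono leaves no room for many monochromatic edges.
    dense-case : 3 ≤ n → Λ * M < N + Λ * m → ∀ G → ¬ BadFreeGraph H n m dp dq r G
    dense-case 3≤n large G bad@((isG , eG , freeG) , _) = conclude (structure (on G) (≤-trans (≤-reflexive (cong (_* a₀) no-copies)) z≤n))
      where
        no-copies : length (copies (on G)) ≡ 0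
        no-copies = none-in (copies (on G)) λ {φ} φ∈ → let φ∈Xs , ins = ∈-filterᵇ⁻ (inside (on G)) Xs φ∈ in
          independent {G ∷ []} (λ { (here refl) → isG , freeG }) {φ} {G} φ∈Xs (here refl) (inside-elim (on G) φ ins)
        n²≤ : N ≤ 4 * M + 2 * n
        n²≤ = *-cancelˡ-≤ ρ {{>-nonZero 1≤ρ}} (begin
          ρ * N                        ≤⟨ M-large ⟩
          2 * r * M + r * n            ≤⟨ +-mono-≤ (*-monoˡ-≤ M (*-monoʳ-≤ 2 r≤2ρ)) (*-monoˡ-≤ n r≤2ρ) ⟩
          2 * (2 * ρ) * M + 2 * ρ * n  ≡⟨ lem ρ M n ⟩
          ρ * (4 * M + 2 * n)          ∎)
          where
            lem : ∀ ρ M n → 2 * (2 * ρ) * M + 2 * ρ * n ≡ ρ * (4 * M + 2 * n)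
            lem = solve-∀
            r≤2ρ : r ≤ 2 * ρ
            r≤2ρ = ≤-trans (+-monoˡ-≤ ρ 1≤ρ) (≤-reflexive (cong (ρ +_) (sym (+-identityʳ ρ))))
        conclude : Σ Colouring (λ col → weightSum (mono col) (on G) ≤ M') → ⊥
        conclude ((col , col<) , le) = dense-regime {Λ} {dq} {n} {m} {mc} {M} {N / D} Λ≡ 3≤n excess-small n²≤
            (≤-trans (≤-reflexive (sym weight≡)) le) (bad-mono {G} bad col col<) large
          where
            mc = ∑ (Ed n) (λ v → 𝟙 (on G v) * 𝟙 (monochromatic col v))
            weight≡ : weightSum (monochromatic col) (on G) ≡ m + mc
            weight≡ = trans (∑-cong (Ed n) (λ v → *-suc (𝟙 (on G v)) (𝟙 (monochromatic col v))))
              (trans (∑-+ (Ed n) _ _) (cong (_+ mc) (trans (sym (e-∑ G)) eG)))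

    sparse-case : ∀ {β} → N + Λ * m ≤ Λ * M → Q * b ≤ m → dq ≤ m → β ^ τ ≤ 2 ^ m →
      (∀ j v → j * q ≤ p * v → N ^ j ≤ b ^ j * n ^ v) →
      ∀ {xs : List (Mat n)} → Unique xs → (∀ {G} → G ∈ xs → BadFreeGraph H n m dp dq r G) → length xs * β ≤ bin M m
    sparse-case {β} gap Qb≤m dq≤m β≤ condition {xs} uq bad =
      exponential-gain {length xs} {d} {size all-edges} {suc g * (ℓ * b)} {m} {M} {M'} {N} {Λ} {τ} {β}
        size≤ m≤M (≤-trans gap (*-monoʳ-≤ Λ (m≤m+n M (N / D)))) gap' few 4m≤dτ β≤
        (rounds Xs⊆Ed (spread condition) leaf g {xs} {all-edges} {m} {d} (*-monoʳ-≤ g size≤)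
          (initial-state {xs} {d} uq (λ {G} G∈ → proj₁ (proj₁ (bad G∈)) , proj₁ (proj₂ (proj₁ (bad G∈)))) monos≥)
          (independent {xs} (λ {G} G∈ → proj₁ (proj₁ (bad G∈)) , proj₂ (proj₂ (proj₁ (bad G∈))))))
      where
        d : ℕ
        d = m / dq
        size≤ : size all-edges ≤ N
        size≤ = ≤-trans (≤-reflexive (sym (length-∑ (Ed n)))) (Ed≤n² n)
        monos≥ : ∀ {G} → G ∈ xs → ∀ (col : Colouring) → d ≤ ∑ (Ed n) (λ v → 𝟙 (on G v) * 𝟙 (mono col v))
        monos≥ {G} G∈ (col , col<) = <⇒≤ (*-cancelʳ-< dq _ _ (≤-<-trans (m/n*n≤m m dq) (bad-mono {G} (bad G∈) col col<)))
        m≤M : m ≤ M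
        m≤M = *-cancelˡ-≤ Λ (≤-trans (m≤n+m (Λ * m) N) gap)
        gap' : 2 * τ * M' + m ≤ 2 * τ * M + M
        gap' = ≤-trans (≤-reflexive (lem (2 * τ) M (N / D) m)) (+-monoʳ-≤ (2 * τ * M) (*-cancelˡ-≤ Λ (begin
          Λ * (2 * τ * (N / D) + m)         ≡⟨ lem' Λ (2 * τ) (N / D) m ⟩
          N / D * (2 * τ * Λ) + Λ * m       ≡⟨ cong (λ k → N / D * k + Λ * m) (sym D≡) ⟩
          N / D * D + Λ * m                 ≤⟨ +-monoˡ-≤ (Λ * m) (m/n*n≤m N D) ⟩
          N + Λ * m                         ≤⟨ gap ⟩
          Λ * M                             ∎)))
          where
            lem : ∀ t M x m → t * (M + x) + m ≡ t * M + (t * x + m)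
            lem = solve-∀
            lem' : ∀ l t x m → l * (t * x + m) ≡ x * (t * l) + l * m
            lem' = solve-∀
        few : (4 * Λ * τ) ^ (suc g * (ℓ * b) * τ) ≤ 2 ^ m
        few = begin
          w ^ (suc g * (ℓ * b) * τ)                  ≤⟨ ^-monoˡ-≤ (suc g * (ℓ * b) * τ) (n≤2^n w) ⟩
          (2 ^ w) ^ (suc g * (ℓ * b) * τ)            ≡⟨ ^-*-assoc 2 w _ ⟩
          2 ^ (w * (suc g * (ℓ * b) * τ))            ≡⟨ cong (2 ^_) (lem w (suc g) ℓ b τ) ⟩
          2 ^ (w * (suc g * ℓ * τ) * b)              ≤⟨ ^-monoʳ-≤ 2 (≤-trans (*-monoˡ-≤ b (n≤1+n (w * (suc g * ℓ * τ)))) Qb≤m) ⟩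
          2 ^ m                                      ∎
          where
            lem : ∀ w g l b t → w * (g * (l * b) * t) ≡ w * (g * l * t) * b
            lem = solve-∀
        4m≤dτ : 4 * m ≤ d * τ
        4m≤dτ = begin
          4 * m                            ≡⟨ cong (4 *_) (m≡m%n+[m/n]*n m dq) ⟩
          4 * (m % dq + d * dq)            ≤⟨ *-monoʳ-≤ 4 (+-monoˡ-≤ (d * dq) (≤-trans (<⇒≤ (m%n<n m dq)) (m≤n*m dq d {{>-nonZero (m≥n⇒m/n>0 dq≤m)}}))) ⟩
          4 * (d * dq + d * dq)            ≡⟨ lem d dq ⟩
          d * (8 * dq)                     ≡⟨ cong (d *_) (sym τ≡) ⟩
          d * τ                            ∎
          where
            lem : ∀ d x → 4 * (d * x + d * x) ≡ d * (8 * x)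
            lem = solve-∀

  main : ∀ (α β : ℕ) → 0 < α → ∃[ n₀ ] (∀ (n m : ℕ) → n₀ ≤ n → c ^ p * n ^ (2 * p) ≤ m ^ p * n ^ q →
    ∀ (x y : ℕ) → HasCount (BadFreeGraph H n m dp dq r) x → HasCount (FreeGraph H n m) y → x * β ≤ α * y)
  main α β 0<α = n₀ , λ n m n₀≤n dense x y bads frees → bound n m n₀≤n dense bads frees
    where
      n₀ : ℕ
      -- One summand per use: 3 for the dense regime, `Q` for b ≥ 1, `β * τ` for β^τ ≤ 2^m, `dq` for
      -- m / dq ≥ 1, `D` for the error n / 2 in the Turán bound, and the last for non-injective
      -- maps. Those on m use m ≥ n.
      n₀ = 3 + (Q + (β * τ + (dq + (D + 2 * B * (h * h)))))
      bound : ∀ n m → n₀ ≤ n → c ^ p * n ^ (2 * p) ≤ m ^ p * n ^ q → ∀ {x y} →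
        HasCount (BadFreeGraph H n m dp dq r) x → HasCount (FreeGraph H n m) y → x * β ≤ α * y
      bound n m n₀≤n dense {x} {y} (xs , uq , refl , bad) (ys , _ , refl , complete) = conclude (N + Λ * m ≤? Λ * M)
        where
          3≤n : 3 ≤ n
          3≤n = ≤-trans (m≤m+n 3 _) n₀≤n
          rest₁ : Q + (β * τ + (dq + (D + 2 * B * (h * h)))) ≤ n
          rest₁ = ≤-trans (m≤n+m _ 3) n₀≤n
          rest₂ : β * τ + (dq + (D + 2 * B * (h * h))) ≤ n
          rest₂ = ≤-trans (m≤n+m _ Q) rest₁
          rest₃ : dq + (D + 2 * B * (h * h)) ≤ n
          rest₃ = ≤-trans (m≤n+m _ (β * τ)) rest₂
          rest₄ : D + 2 * B * (h * h) ≤ n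
          rest₄ = ≤-trans (m≤n+m _ dq) rest₃
          1≤n : 1 ≤ n
          1≤n = ≤-trans (s≤s z≤n) 3≤n
          instance
            n≢0′ : NonZero n
            n≢0′ = >-nonZero 1≤n
            c≢0 : NonZero c
            c≢0 = m*n≢0 2 Q
          n≤m : n ≤ m
          n≤m = Density.m≥n {n} {m} {p} {q} {c} {0} dense q≤p
          b : ℕ
          b = m / Q
          1≤b : 1 ≤ b
          1≤b = m≥n⇒m/n>0 (≤-trans (≤-trans (m≤m+n Q _) rest₁) n≤m)
          m≤cb : m ≤ c * b
          m≤cb = begin
            m                     ≡⟨ m≡m%n+[m/n]*n m Q ⟩
            m % Q + b * Q         ≤⟨ +-monoˡ-≤ (b * Q) (≤-trans (<⇒≤ (m%n<n m Q)) (m≤n*m Q b {{>-nonZero 1≤b}})) ⟩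
            b * Q + b * Q         ≡⟨ lem b Q ⟩
            2 * Q * b             ∎
            where lem : ∀ b q → b * q + b * q ≡ 2 * q * b
                  lem = solve-∀
          open AtSize n m b 1≤n (≤-trans (m≤m+n D _) rest₄) (≤-trans (m≤n+m _ D) rest₄) {{>-nonZero 1≤b}} using (M; N; dense-case; sparse-case)
          conclude : Dec (N + Λ * m ≤ Λ * M) → length xs * β ≤ α * length ys
          conclude (no large) = ≤-trans (≤-reflexive (cong (_* β) (none-in xs λ {G} G∈ →
            dense-case 3≤n (≰⇒> large) G (Equivalence.to (bad G) G∈)))) z≤n
          conclude (yes gap) = begin
            length xs * β
              ≤⟨ sparse-case gap (≤-trans (≤-reflexive (*-comm Q b)) (m/n*n≤m m Q)) (≤-trans (≤-trans (m≤m+n dq _) rest₃) n≤m) β≤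
                   (Density.codegree-condition {n} {m} {p} {q} {c} {b} dense m≤cb) uq (λ {G} G∈ → Equivalence.to (bad G) G∈) ⟩
            bin M m
              ≤⟨ many-free H (proj₁ (balanced r n)) (λ col → <-irrefl refl (proj₂ chromatic r col)) ys (λ G fr → Equivalence.from (complete G) fr) ⟩
            length ys
              ≤⟨ m≤n*m (length ys) α {{>-nonZero 0<α}} ⟩
            α * length ys ∎
            where
              β≤ : β ^ τ ≤ 2 ^ m
              β≤ = begin
                β ^ τ             ≤⟨ ^-monoˡ-≤ τ (n≤2^n β) ⟩
                (2 ^ β) ^ τ       ≡⟨ ^-*-assoc 2 β τ ⟩
                2 ^ (β * τ)       ≤⟨ ^-monoʳ-≤ 2 (≤-trans (≤-trans (m≤m+n (β * τ) _) rest₂) n≤m) ⟩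
                2 ^ m             ∎

-- Excludes an H with at most one vertex, so that h = 2 + h₂ and n^h splits as n² times n^h₂.
self-colourable : ∀ {h} (H : Mat h) → IsGraph H → Colourable H h
self-colourable H isH = id , λ i j x eq → true≢false x (trans (cong (adj H i) (sym eq)) (proj₁ isH i))

theorem1p6 : ∀ {h} (H : Mat h) → IsGraph H
    → ∀ (k : ℕ) → IsChromaticNumber H k → 3 ≤ k
    → ∀ (p q : ℕ) → IsM2 H p q
    → ∀ (dp dq : ℕ) → 0 < dp → 0 < dq
    → ∃[ c ] (0 < c
    × (∀ (a b : ℕ) → 0 < a → 0 < b
    → ∃[ n₀ ] (∀ (n m : ℕ) → n₀ ≤ n
    → c ^ p * n ^ (2 * p) ≤ m ^ p * n ^ q
    → m ≤ n C 2
    → ∀ (x y : ℕ)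
    → HasCount (BadFreeGraph H n m dp dq (k ∸ 1)) x
    → HasCount (FreeGraph H n m) y
    → x * b ≤ a * y)))
theorem1p6 {0} H isH k χ 3≤k = ⊥-elim (n≮0 (≤-trans 3≤k (proj₂ χ 0 (self-colourable H isH))))
theorem1p6 {1} H isH k χ 3≤k = ⊥-elim (n≮0 (s≤s⁻¹ (≤-trans 3≤k (proj₂ χ 1 (self-colourable H isH)))))
theorem1p6 {suc (suc h₂)} H isH 1 χ (s≤s ())
theorem1p6 {suc (suc h₂)} H isH (suc (suc ρ)) χ 3≤k p q m₂ dp dq 0<dp 0<dq =
  c , s≤s z≤n , λ a b 0<a _ → let n₀ , bound = main a b 0<a in
    n₀ , λ n m n₀≤n dense _ x y bads frees → bound n m n₀≤n dense x y bads frees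
  where
    D L : ℕ
    D = 2 * (8 * dq) * (64 * dq)
    L = 4 * (1 + ρ) * D
    open Assembly h₂ H isH ρ (s≤s⁻¹ (s≤s⁻¹ 3≤k)) χ p q m₂ dp dq 0<dp {{>-nonZero 0<dq}} (8 * dq) (64 * dq) D L refl refl refl refl
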